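{- Assume that for all integers $n\ge 1$ and $0\le k\le n-1$ one has \[\langle \Delta'_{e_{n-k-1}}e_n,h_1^n\rangle=\sum_{P\in\mathsf{stLD}(n)^{\bullet k}}q^{\mathsf{dinv}(P)}t^{\mathsf{area}(P)}.\] Then for all integers $n\ge 1$, \[\sum_{k=0}^{n-1}\left.\langle \Delta'_{e_{n-k-1}}e_n,h_1^n\rangle\right|_{q=-1}z^k=\sum_{\sigma\in\mathfrak S_n}t^{\mathsf{inv}_3(\sigma)}z^{\mathsf{monot}(\sigma)}.\]
   Context: Symmetric functions. $\Lambda$ is the algebra of symmetric functions over $\mathbb Q(q,t)$ with the Hall scalar product $\langle\,,\rangle$ (Schur functions are orthonormal); $e_n$, $h_n$ are the elementary and complete homogeneous symmetric functions. For a partition $\mu\vdash n$, $\tilde H_\mu=\tilde H_\mu[X;q,t]=\sum_{\lambda\vdash n}K_{\lambda\mu}(q,1/t)\,t^{n(\mu)}s_\lambda$ is the modified Macdonald polynomial, where $K_{\lambda\mu}(q,t)$ are the Macdonald $q,t$-Kostka coefficients and $n(\mu)=\sum_i(i-1)\mu_i$; equivalently, $\tilde H_\mu$ is characterised by $\tilde H_\mu[X(1-q)]\in\mathrm{span}\{s_\lambda:\lambda\ge\mu\}$, $\tilde H_\mu[X(1-t)]\in\mathrm{span}\{s_\lambda:\lambda\ge\mu'\}$ (dominance order, plethystic notation $p_r[X(1-u)]=(1-u^r)p_r$) and $\langle\tilde H_\mu,s_{(n)}\rangle=1$. The $\tilde H_\mu$ form a basis of $\Lambda$. With the cells of $\mu$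 being $(i,j)$, $1\le i\le\mu_j$, $1\le j\le\ell(\mu)$, put $B_\mu=\sum_{(i,j)\in\mu}q^{i-1}t^{j-1}$. For $f\in\Lambda$, the linear operator $\Delta'_f$ on $\Lambda$ is defined by $\Delta'_f\tilde H_\mu=f[B_\mu-1]\tilde H_\mu$ (plethystic evaluation, i.e. $f$ evaluated at the monomials $q^{i-1}t^{j-1}$, $(i,j)\in\mu$, $(i,j)\neq(1,1)$). Dyck paths. A Dyck path of size $n$ is a lattice path from $(0,0)$ to $(n,n)$ with unit north and east steps staying weakly above the line $x=y$. A standardly labelled Dyck path is a pair $(\pi,w)$ with $\pi$ a Dyck path of size $n$ and $w=w_1\cdots w_n$ a permutation of $\{1,\dots,n\}$, where $w_i$ labels the $i$-th vertical (north) step of $\pi$, such that the labels of vertical steps lying in the same column are increasing from bottom to top. The area word $a=a_1\cdots a_n$ of $\pi$: $a_i$ is the number of whole unit squares between the $i$-th vertical step and the line $x=y$. The $i$-th vertical step ($2\le i\le n$) is a contractible valley of $(\pi,w)$ if either $a_{i-1}>a_i$, or $a_{i-1}=a_i$ and $w_{i-1}<w_i$. The set $\mathsf{stLD}(n)^{\bullet k}$ consists of the triples $P=(\pi,w,dv)$ with $(\pi,w)$ a standardly labelled Dyck path of size $n$ and $dv$ a $k$-element subset of (the indices of) its contractible valleys. $\mathsf{area}(P)=\sum_i a_i$. A pair $(i,j)$ with $1\le i<j\le n$ is a primary diagonal inversion if $a_i=a_j$, $w_i<w_j$ and $i\notin dv$; a secondary diagonal inversion if $a_i=a_j+1$, $w_i>w_j$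 and $i\notin dv$. $\mathsf{dinv}(P)$ is the total number of primary and secondary diagonal inversions minus $|dv|$. Statistics on permutations. For $\sigma\in\mathfrak S_n$ put $\sigma_0=0$. For $i\in\{2,\dots,n\}$, $\sigma_i$ is a double ascent if $\sigma_{i-2}<\sigma_{i-1}<\sigma_i$; a double descent if $\sigma_{i-2}>\sigma_{i-1}>\sigma_i$; a peak if $\sigma_{i-2}<\sigma_{i-1}>\sigma_i$; a valley if $\sigma_{i-2}>\sigma_{i-1}<\sigma_i$. $\mathsf{monot}(\sigma)$ is the number of $i\in\{2,\dots,n\}$ such that $\sigma_i$ is a double ascent or a double descent. A pair $(i,j)$ with $1\le i<j\le n$ is a $3$-inversion of $\sigma$ if one of the following holds: $\sigma_j$ is a double ascent and $\sigma_{j-1}<\sigma_i<\sigma_j$; $\sigma_j$ is a double descent and $\sigma_{j-1}>\sigma_i>\sigma_j$; $\sigma_j$ is a peak and $\sigma_i>\sigma_j$; $\sigma_j$ is a valley and $\sigma_i<\sigma_j$. $\mathsf{inv}_3(\sigma)$ is the number of $3$-inversions of $\sigma$. -}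

module Defs where

open import Algebra.Bundles using (CommutativeRing; RawRing)
import Algebra.Definitions.RawSemiring as RawSemiringDefs
import Algebra.Properties.CommutativeSemigroup as CommutativeSemigroupProperties
import Algebra.Properties.Ring as RingProperties
import Algebra.Properties.Semiring.Exp as SemiringExp
import Algebra.Solver.Ring.NaturalCoefficients.Default as SemiringSolver
open import Data.Bool.Base using (if_then_else_)
open import Data.Fin.Base as Fin using (Fin; toℕ; punchIn)
import Data.Fin.Properties as Fin
open import Data.Fin.Subset using (Subset; inside; outside; _∈_; _∉_; ∣_∣)
open import Data.Fin.Subset.Properties using (_∈?_)
open import Data.Integer.Base as ℤ using (ℤ; +_; -[1+_])
open import Data.List.Base
  using (List; []; _∷_; _++_; [_]; map; foldr; filter; length; zip; take; upTo; allFin;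
         cartesianProduct; cartesianProductWith)
import Data.List.Base as List
open import Data.List.Relation.Binary.Permutation.Propositional using (_↭_; refl; prep; swap; trans; ↭-sym)
open import Data.List.Relation.Binary.Permutation.Propositional.Properties
  using (All-resp-↭; filter-↭; ↭-singleton-inv)
open import Data.List.Relation.Unary.All using (All; []; _∷_)
import Data.List.Relation.Unary.All as All
open import Data.List.Relation.Unary.Linked using (Linked; []; [-])
import Data.List.Properties as List
open import Data.Nat.Base as ℕ using (ℕ; zero; suc; _∸_; _≤_; _<_; _>_; _≥_; z≤n; s≤s)
open import Data.Nat.ListAction using (sum)
open import Data.Nat.ListAction.Properties using (sum-↭)
import Data.Nat.Properties as ℕ
open import Data.Product.Base using (_×_; _,_; Σ-syntax; ∃-syntax; proj₁; proj₂)
open import Data.Product.Properties using (≡-dec)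
import Data.Rational.Base
import Data.Rational.Properties as ℚ
open import Data.Sum.Base using (_⊎_; inj₁; inj₂; map₁; map₂)
open import Data.Vec.Base using (Vec; []; _∷_; lookup)
import Data.Vec.Base as Vec
open import Data.Vec.Relation.Unary.Unique.Propositional using (Unique)
import Data.Vec.Relation.Unary.AllPairs as AllPairs
open import Function.Base using (_∘_; flip; id)
open import Level using (0ℓ)
open import Relation.Binary.PropositionalEquality using (_≡_; _≢_; cong; cong₂; subst)
import Relation.Binary.PropositionalEquality as ≡
import Relation.Binary.Reasoning.Setoid as SetoidReasoning
open import Relation.Nullary.Decidable using (Dec; yes; no; does; map′; _×-dec_; _⊎-dec_; _→-dec_; ¬?)
open import Relation.Nullary.Negation using (¬_; contradiction)
open import Relation.Unary using (Decidable)

module FiniteSums (R : CommutativeRing 0ℓ 0ℓ) where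
  open CommutativeRing R renaming (refl to ≈-refl; sym to ≈-sym; trans to ≈-trans)
  open SetoidReasoning setoid
  open SemiringSolver commutativeSemiring using (solve; _:+_; _:=_)

  ∑ : {A : Set} → List A → (A → Carrier) → Carrier
  ∑ xs f = foldr (λ x s → f x + s) 0# xs

  ∏ : {A : Set} → List A → (A → Carrier) → Carrier
  ∏ xs f = foldr (λ x s → f x * s) 1# xs

  -- ∑₊ n h is the sum of h i j over all i + j = n.
  ∑₊ : ℕ → (ℕ → ℕ → Carrier) → Carrier
  ∑₊ zero    h = h 0 0
  ∑₊ (suc n) h = h 0 (suc n) + ∑₊ n (h ∘ suc)

  ∑₊-cong : ∀ n {g h} → (∀ i j → i ℕ.+ j ≡ n → g i j ≈ h i j) → ∑₊ n g ≈ ∑₊ n h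
  ∑₊-cong zero    eq = eq 0 0 ≡.refl
  ∑₊-cong (suc n) eq = +-cong (eq 0 (suc n) ≡.refl) (∑₊-cong n λ i j i+j → eq (suc i) j (cong suc i+j))

  ∑₊-0 : ∀ n → ∑₊ n (λ _ _ → 0#) ≈ 0#
  ∑₊-0 zero    = ≈-refl
  ∑₊-0 (suc n) = ≈-trans (+-identityˡ _) (∑₊-0 n)

  ∑₊-+ : ∀ n g h → ∑₊ n (λ i j → g i j + h i j) ≈ ∑₊ n g + ∑₊ n h
  ∑₊-+ zero    g h = ≈-refl
  ∑₊-+ (suc n) g h = begin
    (g 0 (suc n) + h 0 (suc n)) + ∑₊ n (λ i j → g (suc i) j + h (suc i) j)
      ≈⟨ +-congˡ (∑₊-+ n (g ∘ suc) (h ∘ suc)) ⟩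
    (g 0 (suc n) + h 0 (suc n)) + (∑₊ n (g ∘ suc) + ∑₊ n (h ∘ suc))
      ≈⟨ solve 4 (λ a b c d → (a :+ b) :+ (c :+ d) := (a :+ c) :+ (b :+ d)) ≈-refl _ _ _ _ ⟩
    (g 0 (suc n) + ∑₊ n (g ∘ suc)) + (h 0 (suc n) + ∑₊ n (h ∘ suc)) ∎

  *-distribˡ-∑₊ : ∀ n a h → a * ∑₊ n h ≈ ∑₊ n (λ i j → a * h i j)
  *-distribˡ-∑₊ zero    a h = ≈-refl
  *-distribˡ-∑₊ (suc n) a h = ≈-trans (distribˡ _ _ _) (+-congˡ (*-distribˡ-∑₊ n a (h ∘ suc)))

  *-distribʳ-∑₊ : ∀ n a h → ∑₊ n h * a ≈ ∑₊ n (λ i j → h i j * a)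
  *-distribʳ-∑₊ zero    a h = ≈-refl
  *-distribʳ-∑₊ (suc n) a h = ≈-trans (distribʳ _ _ _) (+-congˡ (*-distribʳ-∑₊ n a (h ∘ suc)))

  ∑₊-last : ∀ n h → ∑₊ (suc n) h ≈ ∑₊ n (λ i j → h i (suc j)) + h (suc n) 0
  ∑₊-last zero    h = ≈-refl
  ∑₊-last (suc n) h = ≈-trans (+-congˡ (∑₊-last n (h ∘ suc))) (≈-sym (+-assoc _ _ _))

  ∑₊-flip : ∀ n h → ∑₊ n h ≈ ∑₊ n (flip h)
  ∑₊-flip zero    h = ≈-refl
  ∑₊-flip (suc n) h = begin
    h 0 (suc n) + ∑₊ n (h ∘ suc)                ≈⟨ +-congˡ (∑₊-flip n (h ∘ suc)) ⟩
    h 0 (suc n) + ∑₊ n (λ i j → h (suc j) i)    ≈⟨ +-comm _ _ ⟩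
    ∑₊ n (λ i j → h (suc j) i) + h 0 (suc n)    ≈⟨ ∑₊-last n (flip h) ⟨
    ∑₊ (suc n) (flip h)                         ∎

  ∑₊-assoc : ∀ n (h : ℕ → ℕ → ℕ → Carrier) →
             ∑₊ n (λ i j → ∑₊ i (λ k l → h k l j)) ≈ ∑₊ n (λ k m → ∑₊ m (λ l j → h k l j))
  ∑₊-assoc zero    h = ≈-refl
  ∑₊-assoc (suc n) h = begin
    h 0 0 (suc n) + ∑₊ n (λ i j → h 0 (suc i) j + ∑₊ i (λ k l → h (suc k) l j))
      ≈⟨ +-congˡ (∑₊-+ n _ _) ⟩
    h 0 0 (suc n) + (∑₊ n (λ i j → h 0 (suc i) j) + ∑₊ n (λ i j → ∑₊ i (λ k l → h (suc k) l j)))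
      ≈⟨ +-assoc _ _ _ ⟨
    ∑₊ (suc n) (h 0) + ∑₊ n (λ i j → ∑₊ i (λ k l → h (suc k) l j))
      ≈⟨ +-congˡ (∑₊-assoc n (h ∘ suc)) ⟩
    ∑₊ (suc n) (h 0) + ∑₊ n (λ k m → ∑₊ m (λ l j → h (suc k) l j)) ∎

  ∑₊-exchange : ∀ m n (h : ℕ → ℕ → ℕ → ℕ → Carrier) →
                ∑₊ m (λ i j → ∑₊ n (λ k l → h i j k l)) ≈ ∑₊ n (λ k l → ∑₊ m (λ i j → h i j k l))
  ∑₊-exchange zero    n h = ≈-refl
  ∑₊-exchange (suc m) n h = ≈-trans (+-congˡ (∑₊-exchange m n (h ∘ suc))) (≈-sym (∑₊-+ n _ _))

record IntegralDomain : Set₁ where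
  field
    commutativeRing : CommutativeRing 0ℓ 0ℓ
  open CommutativeRing commutativeRing public
  field
    1≉0            : ¬ (1# ≈ 0#)
    noZeroDivisors : ∀ {x y} → x * y ≈ 0# → x ≈ 0# ⊎ y ≈ 0#
    0?             : Decidable (_≈ 0#)

-- Polynomials in one variable are coefficient lists, constant term first.
module Polynomials (R : CommutativeRing 0ℓ 0ℓ) where
  open CommutativeRing R renaming (refl to ≈-refl; sym to ≈-sym; trans to ≈-trans)
  open FiniteSums R
  open SetoidReasoning setoid
  open RingProperties ring using (-0#≈0#)

  Poly : Set
  Poly = List Carrier

  coeff : Poly → ℕ → Carrier
  coeff []      n       = 0#
  coeff (a ∷ p) zero    = a
  coeff (a ∷ p) (suc n) = coeff p n

  -- Trailing zeros are irrelevant.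
  infix 4 _≈ₚ_
  record _≈ₚ_ (p q : Poly) : Set where
    constructor coeffwise
    field coeff-≈ : ∀ n → coeff p n ≈ coeff q n
  open _≈ₚ_ public

  infixl 6 _+ₚ_
  infixl 7 _*ₚ_
  infix  8 -ₚ_

  _+ₚ_ : Poly → Poly → Poly
  []      +ₚ q       = q
  (a ∷ p) +ₚ []      = a ∷ p
  (a ∷ p) +ₚ (b ∷ q) = a + b ∷ p +ₚ q

  -ₚ_ : Poly → Poly
  -ₚ p = map (-_) p

  _*ₚ_ : Poly → Poly → Poly
  []      *ₚ q = []
  (a ∷ p) *ₚ q = map (a *_) q +ₚ (0# ∷ p *ₚ q)

  constant : Carrier → Poly
  constant a = a ∷ []

  0ₚ 1ₚ X : Poly
  0ₚ = []
  1ₚ = constant 1#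
  X  = 0# ∷ 1# ∷ []

  evaluate : Carrier → Poly → Carrier
  evaluate x []      = 0#
  evaluate x (a ∷ p) = a + x * evaluate x p

  coeff-+ : ∀ p q n → coeff (p +ₚ q) n ≈ coeff p n + coeff q n
  coeff-+ []      q       n       = ≈-sym (+-identityˡ _)
  coeff-+ (a ∷ p) []      n       = ≈-sym (+-identityʳ _)
  coeff-+ (a ∷ p) (b ∷ q) zero    = ≈-refl
  coeff-+ (a ∷ p) (b ∷ q) (suc n) = coeff-+ p q n

  coeff-neg : ∀ p n → coeff (-ₚ p) n ≈ - coeff p n
  coeff-neg []      n       = ≈-sym -0#≈0#
  coeff-neg (a ∷ p) zero    = ≈-refl
  coeff-neg (a ∷ p) (suc n) = coeff-neg p n

  coeff-scale : ∀ a p n → coeff (map (a *_) p) n ≈ a * coeff p n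
  coeff-scale a []      n       = ≈-sym (zeroʳ a)
  coeff-scale a (b ∷ p) zero    = ≈-refl
  coeff-scale a (b ∷ p) (suc n) = coeff-scale a p n

  coeff-* : ∀ p q n → coeff (p *ₚ q) n ≈ ∑₊ n (λ i j → coeff p i * coeff q j)
  coeff-* []      q n = ≈-sym (≈-trans (∑₊-cong n (λ _ _ _ → zeroˡ _)) (∑₊-0 n))
  coeff-* (a ∷ p) q n = ≈-trans (coeff-+ (map (a *_) q) _ n) (≈-trans (+-congʳ (coeff-scale a q n)) (rest n))
    where
    rest : ∀ n → a * coeff q n + coeff (0# ∷ p *ₚ q) n ≈ ∑₊ n (λ i j → coeff (a ∷ p) i * coeff q j)
    rest zero    = +-identityʳ _
    rest (suc n) = +-congˡ (coeff-* p q n)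

  private
    +-cong′ : ∀ {p p′ q q′} → p ≈ₚ p′ → q ≈ₚ q′ → p +ₚ q ≈ₚ p′ +ₚ q′
    +-cong′ {p} {p′} {q} {q′} e f = coeffwise λ n →
      ≈-trans (coeff-+ p q n) (≈-trans (+-cong (coeff-≈ e n) (coeff-≈ f n)) (≈-sym (coeff-+ p′ q′ n)))

    *-cong′ : ∀ {p p′ q q′} → p ≈ₚ p′ → q ≈ₚ q′ → p *ₚ q ≈ₚ p′ *ₚ q′
    *-cong′ {p} {p′} {q} {q′} e f = coeffwise λ n →
      ≈-trans (coeff-* p q n) (≈-trans (∑₊-cong n λ i j _ → *-cong (coeff-≈ e i) (coeff-≈ f j)) (≈-sym (coeff-* p′ q′ n)))

    -‿cong′ : ∀ {p p′} → p ≈ₚ p′ → -ₚ p ≈ₚ -ₚ p′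
    -‿cong′ {p} {p′} e = coeffwise λ n →
      ≈-trans (coeff-neg p n) (≈-trans (-‿cong (coeff-≈ e n)) (≈-sym (coeff-neg p′ n)))

    +-assoc′ : ∀ p q r → (p +ₚ q) +ₚ r ≈ₚ p +ₚ (q +ₚ r)
    +-assoc′ p q r = coeffwise λ n → begin
      coeff ((p +ₚ q) +ₚ r) n               ≈⟨ coeff-+ (p +ₚ q) r n ⟩
      coeff (p +ₚ q) n + coeff r n          ≈⟨ +-congʳ (coeff-+ p q n) ⟩
      (coeff p n + coeff q n) + coeff r n   ≈⟨ +-assoc _ _ _ ⟩
      coeff p n + (coeff q n + coeff r n)   ≈⟨ +-congˡ (coeff-+ q r n) ⟨
      coeff p n + coeff (q +ₚ r) n          ≈⟨ coeff-+ p (q +ₚ r) n ⟨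
      coeff (p +ₚ (q +ₚ r)) n               ∎

    +-comm′ : ∀ p q → p +ₚ q ≈ₚ q +ₚ p
    +-comm′ p q = coeffwise λ n →
      ≈-trans (coeff-+ p q n) (≈-trans (+-comm _ _) (≈-sym (coeff-+ q p n)))

    -‿inverse′ : ∀ p → -ₚ p +ₚ p ≈ₚ 0ₚ
    -‿inverse′ p = coeffwise λ n →
      ≈-trans (coeff-+ (-ₚ p) p n) (≈-trans (+-congʳ (coeff-neg p n)) (-‿inverseˡ _))

    *-comm′ : ∀ p q → p *ₚ q ≈ₚ q *ₚ p
    *-comm′ p q = coeffwise λ n → begin
      coeff (p *ₚ q) n                        ≈⟨ coeff-* p q n ⟩
      ∑₊ n (λ i j → coeff p i * coeff q j)    ≈⟨ ∑₊-flip n _ ⟩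
      ∑₊ n (λ i j → coeff p j * coeff q i)    ≈⟨ ∑₊-cong n (λ _ _ _ → *-comm _ _) ⟩
      ∑₊ n (λ i j → coeff q i * coeff p j)    ≈⟨ coeff-* q p n ⟨
      coeff (q *ₚ p) n                        ∎

    *-assoc′ : ∀ p q r → (p *ₚ q) *ₚ r ≈ₚ p *ₚ (q *ₚ r)
    *-assoc′ p q r = coeffwise λ n → begin
      coeff ((p *ₚ q) *ₚ r) n
        ≈⟨ coeff-* (p *ₚ q) r n ⟩
      ∑₊ n (λ i j → coeff (p *ₚ q) i * coeff r j)
        ≈⟨ ∑₊-cong n (λ i j _ → ≈-trans (*-congʳ (coeff-* p q i)) (*-distribʳ-∑₊ i _ _)) ⟩
      ∑₊ n (λ i j → ∑₊ i (λ k l → (coeff p k * coeff q l) * coeff r j))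
        ≈⟨ ∑₊-assoc n _ ⟩
      ∑₊ n (λ k m → ∑₊ m (λ l j → (coeff p k * coeff q l) * coeff r j))
        ≈⟨ ∑₊-cong n (λ k m _ → ∑₊-cong m λ _ _ _ → *-assoc _ _ _) ⟩
      ∑₊ n (λ k m → ∑₊ m (λ l j → coeff p k * (coeff q l * coeff r j)))
        ≈⟨ ∑₊-cong n (λ k m _ → ≈-trans (*-congˡ (coeff-* q r m)) (*-distribˡ-∑₊ m _ _)) ⟨
      ∑₊ n (λ k m → coeff p k * coeff (q *ₚ r) m)
        ≈⟨ coeff-* p (q *ₚ r) n ⟨
      coeff (p *ₚ (q *ₚ r)) n ∎

    *-identityˡ′ : ∀ p → 1ₚ *ₚ p ≈ₚ p
    *-identityˡ′ p = coeffwise λ n → begin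
      coeff (1ₚ *ₚ p) n                           ≈⟨ coeff-+ (map (1# *_) p) (0# ∷ []) n ⟩
      coeff (map (1# *_) p) n + coeff (0# ∷ []) n ≈⟨ +-cong (≈-trans (coeff-scale 1# p n) (*-identityˡ _)) (zeros n) ⟩
      coeff p n + 0#                              ≈⟨ +-identityʳ _ ⟩
      coeff p n                                   ∎
      where
      zeros : ∀ n → coeff (0# ∷ []) n ≈ 0#
      zeros zero    = ≈-refl
      zeros (suc n) = ≈-refl

    *-distribˡ-+′ : ∀ p q r → p *ₚ (q +ₚ r) ≈ₚ p *ₚ q +ₚ p *ₚ r
    *-distribˡ-+′ p q r = coeffwise λ n → begin
      coeff (p *ₚ (q +ₚ r)) n
        ≈⟨ coeff-* p (q +ₚ r) n ⟩
      ∑₊ n (λ i j → coeff p i * coeff (q +ₚ r) j)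
        ≈⟨ ∑₊-cong n (λ i j _ → ≈-trans (*-congˡ (coeff-+ q r j)) (distribˡ _ _ _)) ⟩
      ∑₊ n (λ i j → coeff p i * coeff q j + coeff p i * coeff r j)
        ≈⟨ ∑₊-+ n _ _ ⟩
      ∑₊ n (λ i j → coeff p i * coeff q j) + ∑₊ n (λ i j → coeff p i * coeff r j)
        ≈⟨ +-cong (coeff-* p q n) (coeff-* p r n) ⟨
      coeff (p *ₚ q) n + coeff (p *ₚ r) n
        ≈⟨ coeff-+ (p *ₚ q) (p *ₚ r) n ⟨
      coeff (p *ₚ q +ₚ p *ₚ r) n ∎

    ≈ₚ-refl : ∀ {p} → p ≈ₚ p
    ≈ₚ-refl = coeffwise λ _ → ≈-refl

    ≈ₚ-trans : ∀ {p q r} → p ≈ₚ q → q ≈ₚ r → p ≈ₚ r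
    ≈ₚ-trans e f = coeffwise λ n → ≈-trans (coeff-≈ e n) (coeff-≈ f n)

  polynomialRing : CommutativeRing 0ℓ 0ℓ
  polynomialRing = record
    { Carrier = Poly ; _≈_ = _≈ₚ_ ; _+_ = _+ₚ_ ; _*_ = _*ₚ_ ; -_ = -ₚ_ ; 0# = 0ₚ ; 1# = 1ₚ
    ; isCommutativeRing = record
      { isRing = record
        { +-isAbelianGroup = record
          { isGroup = record
            { isMonoid = record
              { isSemigroup = record
                { isMagma = record
                  { isEquivalence = record
                    { refl  = ≈ₚ-refl
                    ; sym   = λ e → coeffwise λ n → ≈-sym (coeff-≈ e n)
                    ; trans = ≈ₚ-trans
                    }
                  ; ∙-cong = +-cong′
                  }
                ; assoc = +-assoc′
                }
              ; identity = (λ _ → ≈ₚ-refl) , λ p → +-comm′ p 0ₚ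
              }
            ; inverse = -‿inverse′ , λ p → ≈ₚ-trans (+-comm′ p (-ₚ p)) (-‿inverse′ p)
            ; ⁻¹-cong = -‿cong′
            }
          ; comm = +-comm′
          }
        ; *-cong     = *-cong′
        ; *-assoc    = *-assoc′
        ; *-identity = *-identityˡ′ , λ p → ≈ₚ-trans (*-comm′ p 1ₚ) (*-identityˡ′ p)
        ; distrib    = *-distribˡ-+′ , λ p q r →
            ≈ₚ-trans (*-comm′ (q +ₚ r) p)
              (≈ₚ-trans (*-distribˡ-+′ p q r) (+-cong′ (*-comm′ p q) (*-comm′ p r)))
        }
      ; *-comm = *-comm′
      }
    }

module PolynomialDomain (D : IntegralDomain) where
  open IntegralDomain D renaming (refl to ≈-refl; sym to ≈-sym; trans to ≈-trans)
  open Polynomials commutativeRing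
  private
    module P = CommutativeRing polynomialRing

    ∷≈0 : ∀ {a p} → a ≈ 0# → p ≈ₚ 0ₚ → a ∷ p ≈ₚ 0ₚ
    ∷≈0 a≈0 p≈0 = coeffwise λ { zero → a≈0 ; (suc n) → coeff-≈ p≈0 n }

    tail≈0 : ∀ {a p} → a ∷ p ≈ₚ 0ₚ → p ≈ₚ 0ₚ
    tail≈0 e = coeffwise λ n → coeff-≈ e (suc n)

    tail-*≈0 : ∀ {a} p q → a ≈ 0# → (a ∷ p) *ₚ q ≈ₚ 0ₚ → p *ₚ q ≈ₚ 0ₚ
    tail-*≈0 {a} p q a≈0 e = coeffwise λ n → ≈-trans
      (≈-sym (≈-trans (coeff-+ (map (a *_) q) (0# ∷ p *ₚ q) (suc n))
        (≈-trans (+-congʳ (≈-trans (coeff-scale a q (suc n)) (≈-trans (*-congʳ a≈0) (zeroˡ _))))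
          (+-identityˡ _))))
      (coeff-≈ e (suc n))

    zero-divisors : ∀ p q → p *ₚ q ≈ₚ 0ₚ → p ≈ₚ 0ₚ ⊎ q ≈ₚ 0ₚ
    zero-divisors []      q       e = inj₁ P.refl
    zero-divisors (a ∷ p) []      e = inj₂ P.refl
    zero-divisors (a ∷ p) (b ∷ q) e = split (0? a) (0? b)
      (λ a≈0 → zero-divisors p (b ∷ q) (tail-*≈0 p (b ∷ q) a≈0 e))
      (λ b≈0 → zero-divisors (a ∷ p) q (P.trans (P.*-comm (a ∷ p) q)
        (tail-*≈0 q (a ∷ p) b≈0 (P.trans (P.*-comm (b ∷ q) (a ∷ p)) e))))
      where
      split : Dec (a ≈ 0#) → Dec (b ≈ 0#) →
              (a ≈ 0# → p ≈ₚ 0ₚ ⊎ b ∷ q ≈ₚ 0ₚ) → (b ≈ 0# → a ∷ p ≈ₚ 0ₚ ⊎ q ≈ₚ 0ₚ) →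
              a ∷ p ≈ₚ 0ₚ ⊎ b ∷ q ≈ₚ 0ₚ
      split (yes a≈0) _         recᵃ recᵇ = map₁ (∷≈0 a≈0) (recᵃ a≈0)
      split (no _)    (yes b≈0) recᵃ recᵇ = map₂ (∷≈0 b≈0) (recᵇ b≈0)
      split (no a≉0)  (no b≉0)  recᵃ recᵇ
        with noZeroDivisors (≈-trans (≈-sym (coeff-* (a ∷ p) (b ∷ q) 0)) (coeff-≈ e 0))
      ... | inj₁ a≈0 = contradiction a≈0 a≉0
      ... | inj₂ b≈0 = contradiction b≈0 b≉0

    zero? : Decidable (_≈ₚ 0ₚ)
    zero? []      = yes P.refl
    zero? (a ∷ p) = map′ (λ (a≈0 , p≈0) → ∷≈0 a≈0 p≈0) (λ e → coeff-≈ e 0 , tail≈0 e) (0? a ×-dec zero? p)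

  polynomialDomain : IntegralDomain
  polynomialDomain = record
    { commutativeRing = polynomialRing
    ; 1≉0             = λ e → 1≉0 (coeff-≈ e 0)
    ; noZeroDivisors  = λ {p} {q} → zero-divisors p q
    ; 0?              = zero?
    }

open PolynomialDomain using (polynomialDomain)

module Fractions (D : IntegralDomain) where
  open IntegralDomain D renaming (refl to ≈-refl; sym to ≈-sym; trans to ≈-trans)
  open SetoidReasoning setoid
  open SemiringSolver commutativeSemiring using (solve; _:+_; _:*_; _:=_)
  open RingProperties ring using (-‿distribˡ-*; -‿distribʳ-*; x∙y⁻¹≈ε⇒x≈y)

  record Fraction : Set where
    constructor frac
    field
      num   : Carrier
      den   : Carrier
      den≉0 : ¬ (den ≈ 0#)
  open Fraction public

  infix 4 _≈ᶠ_
  record _≈ᶠ_ (x y : Fraction) : Set where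
    constructor cross
    field cross-≈ : num x * den y ≈ num y * den x
  open _≈ᶠ_ public

  *-≉0 : ∀ {x y} → ¬ (x ≈ 0#) → ¬ (y ≈ 0#) → ¬ (x * y ≈ 0#)
  *-≉0 x≉0 y≉0 e with noZeroDivisors e
  ... | inj₁ x≈0 = x≉0 x≈0
  ... | inj₂ y≈0 = y≉0 y≈0

  *-cancelˡ-≉0 : ∀ {a} x y → ¬ (a ≈ 0#) → a * x ≈ a * y → x ≈ y
  *-cancelˡ-≉0 {a} x y a≉0 e with noZeroDivisors a*[x-y]≈0
    where
    a*[x-y]≈0 : a * (x + - y) ≈ 0#
    a*[x-y]≈0 = begin
      a * (x + - y)       ≈⟨ distribˡ _ _ _ ⟩
      a * x + a * - y     ≈⟨ +-cong e (≈-sym (-‿distribʳ-* a y)) ⟩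
      a * y + - (a * y)   ≈⟨ -‿inverseʳ _ ⟩
      0#                  ∎
  ... | inj₁ a≈0   = contradiction a≈0 a≉0
  ... | inj₂ x-y≈0 = x∙y⁻¹≈ε⇒x≈y x y x-y≈0

  infixl 6 _+ᶠ_
  infixl 7 _*ᶠ_
  infix  8 -ᶠ_

  _+ᶠ_ _*ᶠ_ : Fraction → Fraction → Fraction
  frac a b b≉0 +ᶠ frac c d d≉0 = frac (a * d + c * b) (b * d) (*-≉0 b≉0 d≉0)
  frac a b b≉0 *ᶠ frac c d d≉0 = frac (a * c) (b * d) (*-≉0 b≉0 d≉0)

  -ᶠ_ : Fraction → Fraction
  -ᶠ frac a b b≉0 = frac (- a) b b≉0

  embed : Carrier → Fraction
  embed a = frac a 1# 1≉0

  private
    ≈ᶠ-trans : ∀ {x y z} → x ≈ᶠ y → y ≈ᶠ z → x ≈ᶠ z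
    ≈ᶠ-trans {frac a b _} {frac c d d≉0} {frac e f _} (cross ad≈cb) (cross cf≈ed) =
      cross (*-cancelˡ-≉0 (a * f) (e * b) d≉0 (begin
        d * (a * f)   ≈⟨ solve 3 (λ d a f → d :* (a :* f) := (a :* d) :* f) ≈-refl d a f ⟩
        (a * d) * f   ≈⟨ *-congʳ ad≈cb ⟩
        (c * b) * f   ≈⟨ solve 3 (λ c b f → (c :* b) :* f := (c :* f) :* b) ≈-refl c b f ⟩
        (c * f) * b   ≈⟨ *-congʳ cf≈ed ⟩
        (e * d) * b   ≈⟨ solve 3 (λ e d b → (e :* d) :* b := d :* (e :* b)) ≈-refl e d b ⟩
        d * (e * b)   ∎))

    +-cong′ : ∀ {x x′ y y′} → x ≈ᶠ x′ → y ≈ᶠ y′ → x +ᶠ y ≈ᶠ x′ +ᶠ y′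
    +-cong′ {frac a b _} {frac a′ b′ _} {frac c d _} {frac c′ d′ _} (cross e) (cross f) = cross (begin
      (a * d + c * b) * (b′ * d′)
        ≈⟨ solve 6 (λ a b c d b′ d′ → (a :* d :+ c :* b) :* (b′ :* d′)
             := (a :* b′) :* (d :* d′) :+ (c :* d′) :* (b :* b′)) ≈-refl a b c d b′ d′ ⟩
      (a * b′) * (d * d′) + (c * d′) * (b * b′)
        ≈⟨ +-cong (*-congʳ e) (*-congʳ f) ⟩
      (a′ * b) * (d * d′) + (c′ * d) * (b * b′)
        ≈⟨ solve 6 (λ a′ b c′ d b′ d′ → (a′ :* b) :* (d :* d′) :+ (c′ :* d) :* (b :* b′)
             := (a′ :* d′ :+ c′ :* b′) :* (b :* d)) ≈-refl a′ b c′ d b′ d′ ⟩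
      (a′ * d′ + c′ * b′) * (b * d) ∎)

    *-cong′ : ∀ {x x′ y y′} → x ≈ᶠ x′ → y ≈ᶠ y′ → x *ᶠ y ≈ᶠ x′ *ᶠ y′
    *-cong′ {frac a b _} {frac a′ b′ _} {frac c d _} {frac c′ d′ _} (cross e) (cross f) = cross (begin
      (a * c) * (b′ * d′)
        ≈⟨ solve 4 (λ a c b′ d′ → (a :* c) :* (b′ :* d′) := (a :* b′) :* (c :* d′)) ≈-refl a c b′ d′ ⟩
      (a * b′) * (c * d′)
        ≈⟨ *-cong e f ⟩
      (a′ * b) * (c′ * d)
        ≈⟨ solve 4 (λ a′ b c′ d → (a′ :* b) :* (c′ :* d) := (a′ :* c′) :* (b :* d)) ≈-refl a′ b c′ d ⟩
      (a′ * c′) * (b * d) ∎)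

    -‿cong′ : ∀ {x y} → x ≈ᶠ y → -ᶠ x ≈ᶠ -ᶠ y
    -‿cong′ (cross e) = cross (≈-trans (≈-sym (-‿distribˡ-* _ _)) (≈-trans (-‿cong e) (-‿distribˡ-* _ _)))

    +-assoc′ : ∀ x y z → (x +ᶠ y) +ᶠ z ≈ᶠ x +ᶠ (y +ᶠ z)
    +-assoc′ (frac a b _) (frac c d _) (frac e f _) = cross (solve 6 (λ a b c d e f →
      ((a :* d :+ c :* b) :* f :+ e :* (b :* d)) :* (b :* (d :* f))
        := (a :* (d :* f) :+ (c :* f :+ e :* d) :* b) :* ((b :* d) :* f)) ≈-refl a b c d e f)

    +-comm′ : ∀ x y → x +ᶠ y ≈ᶠ y +ᶠ x
    +-comm′ (frac a b _) (frac c d _) = cross (solve 4 (λ a b c d →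
      (a :* d :+ c :* b) :* (d :* b) := (c :* b :+ a :* d) :* (b :* d)) ≈-refl a b c d)

    +-identityˡ′ : ∀ x → embed 0# +ᶠ x ≈ᶠ x
    +-identityˡ′ (frac a b _) = cross (begin
      (0# * b + a * 1#) * b   ≈⟨ *-congʳ (≈-trans (+-cong (zeroˡ b) (*-identityʳ a)) (+-identityˡ a)) ⟩
      a * b                   ≈⟨ *-congˡ (*-identityˡ b) ⟨
      a * (1# * b)            ∎)

    -‿inverseˡ′ : ∀ x → -ᶠ x +ᶠ x ≈ᶠ embed 0#
    -‿inverseˡ′ (frac a b _) = cross (begin
      (- a * b + a * b) * 1#   ≈⟨ *-identityʳ _ ⟩
      - a * b + a * b          ≈⟨ distribʳ b (- a) a ⟨
      (- a + a) * b            ≈⟨ *-congʳ (-‿inverseˡ a) ⟩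
      0# * b                   ≈⟨ zeroˡ b ⟩
      0#                       ≈⟨ zeroˡ (b * b) ⟨
      0# * (b * b)             ∎)

    *-assoc′ : ∀ x y z → (x *ᶠ y) *ᶠ z ≈ᶠ x *ᶠ (y *ᶠ z)
    *-assoc′ (frac a b _) (frac c d _) (frac e f _) = cross (solve 6 (λ a b c d e f →
      ((a :* c) :* e) :* (b :* (d :* f)) := (a :* (c :* e)) :* ((b :* d) :* f)) ≈-refl a b c d e f)

    *-comm′ : ∀ x y → x *ᶠ y ≈ᶠ y *ᶠ x
    *-comm′ (frac a b _) (frac c d _) = cross (solve 4 (λ a b c d →
      (a :* c) :* (d :* b) := (c :* a) :* (b :* d)) ≈-refl a b c d)

    *-identityˡ′ : ∀ x → embed 1# *ᶠ x ≈ᶠ x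
    *-identityˡ′ (frac a b _) = cross (≈-trans (*-congʳ (*-identityˡ a)) (*-congˡ (≈-sym (*-identityˡ b))))

    *-distribˡ-+′ : ∀ x y z → x *ᶠ (y +ᶠ z) ≈ᶠ x *ᶠ y +ᶠ x *ᶠ z
    *-distribˡ-+′ (frac a b _) (frac c d _) (frac e f _) = cross (solve 6 (λ a b c d e f →
      (a :* (c :* f :+ e :* d)) :* ((b :* d) :* (b :* f))
        := ((a :* c) :* (b :* f) :+ (a :* e) :* (b :* d)) :* (b :* (d :* f))) ≈-refl a b c d e f)

  fractionField : CommutativeRing 0ℓ 0ℓ
  fractionField = record
    { Carrier = Fraction ; _≈_ = _≈ᶠ_ ; _+_ = _+ᶠ_ ; _*_ = _*ᶠ_ ; -_ = -ᶠ_
    ; 0# = embed 0# ; 1# = embed 1#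
    ; isCommutativeRing = record
      { isRing = record
        { +-isAbelianGroup = record
          { isGroup = record
            { isMonoid = record
              { isSemigroup = record
                { isMagma = record
                  { isEquivalence = record
                    { refl  = cross ≈-refl
                    ; sym   = λ e → cross (≈-sym (cross-≈ e))
                    ; trans = ≈ᶠ-trans
                    }
                  ; ∙-cong = +-cong′
                  }
                ; assoc = +-assoc′
                }
              ; identity = +-identityˡ′ , λ x → ≈ᶠ-trans (+-comm′ x (embed 0#)) (+-identityˡ′ x)
              }
            ; inverse = -‿inverseˡ′ , λ x → ≈ᶠ-trans (+-comm′ x (-ᶠ x)) (-‿inverseˡ′ x)
            ; ⁻¹-cong = -‿cong′
            }
          ; comm = +-comm′
          }
        ; *-cong     = *-cong′
        ; *-assoc    = *-assoc′
        ; *-identity = *-identityˡ′ , λ x → ≈ᶠ-trans (*-comm′ x (embed 1#)) (*-identityˡ′ x)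
        ; distrib    = *-distribˡ-+′ , λ x y z →
            ≈ᶠ-trans (*-comm′ (y +ᶠ z) x)
              (≈ᶠ-trans (*-distribˡ-+′ x y z) (+-cong′ (*-comm′ x y) (*-comm′ x z)))
        }
      ; *-comm = *-comm′
      }
    }

ℚ-domain : IntegralDomain
ℚ-domain = record
  { commutativeRing = ℚ.+-*-commutativeRing
  ; 1≉0             = ℚ.1≢0
  ; noZeroDivisors  = zero-divisors _ _
  ; 0?              = ℚ._≟ Data.Rational.Base.0ℚ
  }
  where
  open Data.Rational.Base using (0ℚ; 1ℚ; _*_; 1/_; NonZero; ≢-nonZero)
  zero-divisors : ∀ x y → x * y ≡ 0ℚ → x ≡ 0ℚ ⊎ y ≡ 0ℚ
  zero-divisors x y xy≡0 with x ℚ.≟ 0ℚ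
  ... | yes x≡0 = inj₁ x≡0
  ... | no x≢0  = inj₂ (begin
    y                ≡⟨ ℚ.*-identityˡ y ⟨
    1ℚ * y           ≡⟨ cong (_* y) (ℚ.*-inverseˡ x) ⟨
    (1/ x * x) * y   ≡⟨ ℚ.*-assoc (1/ x) x y ⟩
    1/ x * (x * y)   ≡⟨ cong (1/ x *_) xy≡0 ⟩
    1/ x * 0ℚ        ≡⟨ ℚ.*-zeroʳ (1/ x) ⟩
    0ℚ               ∎)
    where
    open ≡.≡-Reasoning
    instance _ = ≢-nonZero x≢0

-- Elements of ℚ[t][q] are polynomials in q with coefficients in ℚ[t].
ℚ[t] ℚ[t][q] : IntegralDomain
ℚ[t]    = polynomialDomain ℚ-domain
ℚ[t][q] = polynomialDomain ℚ[t]

ℚ⟨t⟩ ℚ⟨q,t⟩ : CommutativeRing 0ℓ 0ℓ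
ℚ⟨t⟩   = Fractions.fractionField ℚ[t]
ℚ⟨q,t⟩ = Fractions.fractionField ℚ[t][q]

module ℚ[t] = IntegralDomain ℚ[t]
module ℚ[t][q] = IntegralDomain ℚ[t][q]
module ℚ⟨t⟩ where
  open CommutativeRing ℚ⟨t⟩ public
  open SemiringExp semiring public using (_^_)
  open FiniteSums ℚ⟨t⟩ public using (∑; ∏)

  t : Carrier
  t = Fractions.embed ℚ[t] (Polynomials.X (IntegralDomain.commutativeRing ℚ-domain))

module ℚ⟨q,t⟩ where
  open CommutativeRing ℚ⟨q,t⟩ public
  open SemiringExp semiring public using (_^_)
  open FiniteSums ℚ⟨q,t⟩ public using (∑; ∏)

  private
    q≉0 : ¬ (Polynomials.X ℚ[t].commutativeRing ℚ[t][q].≈ ℚ[t][q].0#)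
    q≉0 e = ℚ[t].1≉0 (Polynomials.coeff-≈ e 1)

  q q⁻¹ t : Carrier
  q   = Fractions.embed ℚ[t][q] (Polynomials.X ℚ[t].commutativeRing)
  q⁻¹ = Fractions.frac ℚ[t][q].1# (Polynomials.X ℚ[t].commutativeRing) q≉0
  t   = Fractions.embed ℚ[t][q] (Polynomials.constant ℚ[t].commutativeRing
          (Polynomials.X (IntegralDomain.commutativeRing ℚ-domain)))

  q^ᶻ_ : ℤ → Carrier
  q^ᶻ (+ n)    = q ^ n
  q^ᶻ -[1+ n ] = q⁻¹ ^ suc n

-- f ∣q=-1↦ g: the rational function f is defined at q = -1 and takes the
-- value g there.  This holds as soon as some representation of f as a quotient
-- has a denominator that does not vanish at q = -1, and g does not depend on
-- the representation.
infix 4 _∣q=-1↦_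
_∣q=-1↦_ : ℚ⟨q,t⟩.Carrier → ℚ⟨t⟩.Carrier → Set
f ∣q=-1↦ g =
  Σ[ a ∈ ℚ[t][q].Carrier ] Σ[ b ∈ ℚ[t][q].Carrier ]
  Σ[ b≉0 ∈ ¬ (b ℚ[t][q].≈ ℚ[t][q].0#) ] Σ[ b[-1]≉0 ∈ ¬ (at-1 b ℚ[t].≈ ℚ[t].0#) ]
    f ℚ⟨q,t⟩.≈ Fractions.frac a b b≉0 × g ℚ⟨t⟩.≈ Fractions.frac (at-1 a) (at-1 b) b[-1]≉0
  where
  at-1 : ℚ[t][q].Carrier → ℚ[t].Carrier
  at-1 = Polynomials.evaluate ℚ[t].commutativeRing (ℚ[t].- ℚ[t].1#)

module ℚ⟨t⟩[z] where
  open CommutativeRing (Polynomials.polynomialRing ℚ⟨t⟩) public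
  open SemiringExp semiring public using (_^_)
  open FiniteSums (Polynomials.polynomialRing ℚ⟨t⟩) public using (∑)

  z : Carrier
  z = Polynomials.X ℚ⟨t⟩

  const : ℚ⟨t⟩.Carrier → Carrier
  const = Polynomials.constant ℚ⟨t⟩

record Partition : Set where
  constructor partition
  field
    parts      : List ℕ
    positive   : All (0 <_) parts
    decreasing : Linked _≥_ parts
open Partition public

oneRow : ℕ → Partition
oneRow zero    = partition [] [] []
oneRow (suc n) = partition [ suc n ] (s≤s z≤n ∷ []) [-]

-- Dominance order and conjugation, on lists of parts.
infix 4 _⊵_
_⊵_ : List ℕ → List ℕ → Set
λs ⊵ μs = sum λs ≡ sum μs × (∀ k → sum (take k μs) ≤ sum (take k λs))

conjugate : List ℕ → List ℕ
conjugate μs = map (λ i → length (filter (i ℕ.<?_) μs)) (upTo (foldr ℕ._⊔_ 0 μs))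

-- The cells (i , j) of the diagram, both coordinates counted from 0:
-- j is the row and i < μⱼ the position in it.
cells : List ℕ → List (ℕ × ℕ)
cells = from 0
  where
  from : ℕ → List ℕ → List (ℕ × ℕ)
  from j []       = []
  from j (m ∷ μs) = map (_, j) (upTo m) ++ from (suc j) μs

nonCornerCells : List ℕ → List (ℕ × ℕ)
nonCornerCells μs = filter (λ c → ¬? (≡-dec ℕ._≟_ ℕ._≟_ c (0 , 0))) (cells μs)

module Determinant (R : RawRing 0ℓ 0ℓ) where
  open RawRing R
  open RawSemiringDefs rawSemiring using (_^_) renaming (sum to ∑ᵥ)

  det : ∀ {n} → (Fin n → Fin n → Carrier) → Carrier
  det {zero}  M = 1#
  det {suc n} M = ∑ᵥ λ j → (- 1#) ^ toℕ j * (M Fin.zero j * det λ i k → M (Fin.suc i) (punchIn j k))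

module SymmetricFunctions (K : CommutativeRing 0ℓ 0ℓ) where
  open CommutativeRing K renaming (refl to ≈-refl; sym to ≈-sym; trans to ≈-trans)
  open SemiringExp semiring using (_^_)
  open FiniteSums K
  open RingProperties ring using (-0#≈0#)

  -- The monomial x₁^α₁ ⋯ xₘ^αₘ in the variables x₁, x₂, … is given by its
  -- exponents.  A symmetric function is a formal power series of bounded
  -- degree that is invariant under permutations of the variables; by
  -- `permute`, `pad` says that exponents 0 may be omitted.
  record Λ : Set where
    field
      series  : List ℕ → Carrier
      permute : ∀ {α β} → α ↭ β → series α ≈ series β
      pad     : ∀ α → series (0 ∷ α) ≈ series α
      degree  : ℕ
      bounded : ∀ α → degree < sum α → series α ≈ 0#
  open Λ public

  infix 4 _≈Λ_
  record _≈Λ_ (f g : Λ) : Set where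
    constructor monomialwise
    field series-≈ : ∀ α → series f α ≈ series g α
  open _≈Λ_ public

  infixl 6 _+Λ_
  infixl 7 _*Λ_
  infixr 8 _•_

  0Λ : Λ
  0Λ = record
    { series = λ _ → 0# ; permute = λ _ → ≈-refl ; pad = λ _ → ≈-refl
    ; degree = 0 ; bounded = λ _ _ → ≈-refl }

  _+Λ_ : Λ → Λ → Λ
  f +Λ g = record
    { series  = λ α → series f α + series g α
    ; permute = λ p → +-cong (permute f p) (permute g p)
    ; pad     = λ α → +-cong (pad f α) (pad g α)
    ; degree  = degree f ℕ.⊔ degree g
    ; bounded = λ α d<α → ≈-trans
        (+-cong (bounded f α (ℕ.≤-<-trans (ℕ.m≤m⊔n (degree f) (degree g)) d<α))
                (bounded g α (ℕ.≤-<-trans (ℕ.m≤n⊔m (degree f) (degree g)) d<α)))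
        (+-identityˡ 0#)
    }

  -Λ_ : Λ → Λ
  -Λ f = record
    { series  = λ α → - series f α
    ; permute = -‿cong ∘ permute f
    ; pad     = -‿cong ∘ pad f
    ; degree  = degree f
    ; bounded = λ α d<α → ≈-trans (-‿cong (bounded f α d<α)) -0#≈0#
    }

  _•_ : Carrier → Λ → Λ
  c • f = record
    { series  = λ α → c * series f α
    ; permute = *-congˡ ∘ permute f
    ; pad     = *-congˡ ∘ pad f
    ; degree  = degree f
    ; bounded = λ α d<α → ≈-trans (*-congˡ (bounded f α d<α)) (zeroʳ c)
    }

  -- convolve F G α is the sum of F β * G γ over all β + γ = α.
  convolve : (List ℕ → Carrier) → (List ℕ → Carrier) → List ℕ → Carrier
  convolve F G []      = F [] * G []
  convolve F G (a ∷ α) = ∑₊ a λ i j → convolve (F ∘ (i ∷_)) (G ∘ (j ∷_)) α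

  private
    convolve-cong : ∀ α {F F′ G G′} → (∀ β → F β ≈ F′ β) → (∀ γ → G γ ≈ G′ γ) →
                    convolve F G α ≈ convolve F′ G′ α
    convolve-cong []      F≈ G≈ = *-cong (F≈ []) (G≈ [])
    convolve-cong (a ∷ α) F≈ G≈ = ∑₊-cong a λ i j _ → convolve-cong α (F≈ ∘ (i ∷_)) (G≈ ∘ (j ∷_))

    convolve-permute : ∀ {α β} F G → (∀ {α β} → α ↭ β → F α ≈ F β) → (∀ {α β} → α ↭ β → G α ≈ G β) →
                       α ↭ β → convolve F G α ≈ convolve F G β
    convolve-permute F G F↭ G↭ refl         = ≈-refl
    convolve-permute F G F↭ G↭ (prep a p)   = ∑₊-cong a λ i j _ →
      convolve-permute (F ∘ (i ∷_)) (G ∘ (j ∷_)) (F↭ ∘ prep i) (G↭ ∘ prep j) p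
    convolve-permute {β = _ ∷ _ ∷ β} F G F↭ G↭ (swap a b p) = ≈-trans (∑₊-exchange a b _)
      (∑₊-cong b λ k l _ → ∑₊-cong a λ i j _ → ≈-trans
        (convolve-permute (λ α → F (i ∷ k ∷ α)) (λ α → G (j ∷ l ∷ α))
          (λ r → F↭ (prep i (prep k r))) (λ r → G↭ (prep j (prep l r))) p)
        (convolve-cong β (λ _ → F↭ (swap i k refl)) (λ _ → G↭ (swap j l refl))))
    convolve-permute F G F↭ G↭ (trans p p′) =
      ≈-trans (convolve-permute F G F↭ G↭ p) (convolve-permute F G F↭ G↭ p′)

    convolve-0 : ∀ α F G → (∀ β γ → sum β ℕ.+ sum γ ≡ sum α → F β * G γ ≈ 0#) → convolve F G α ≈ 0#
    convolve-0 []      F G FG≈0 = FG≈0 [] [] ≡.refl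
    convolve-0 (a ∷ α) F G FG≈0 = ≈-trans
      (∑₊-cong a λ i j i+j≡a → convolve-0 α (F ∘ (i ∷_)) (G ∘ (j ∷_)) λ β γ eq →
        FG≈0 (i ∷ β) (j ∷ γ) (≡.trans (interchange i (sum β) j (sum γ)) (cong₂ ℕ._+_ i+j≡a eq)))
      (∑₊-0 a)
      where
      interchange : ∀ i b j c → (i ℕ.+ b) ℕ.+ (j ℕ.+ c) ≡ (i ℕ.+ j) ℕ.+ (b ℕ.+ c)
      interchange i b j c = CommutativeSemigroupProperties.interchange ℕ.+-commutativeSemigroup i b j c

  _*Λ_ : Λ → Λ → Λ
  f *Λ g = record
    { series  = convolve (series f) (series g)
    ; permute = convolve-permute (series f) (series g) (permute f) (permute g)
    ; pad     = λ α → convolve-cong α (pad f) (pad g)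
    ; degree  = degree f ℕ.+ degree g
    ; bounded = λ α d<α → convolve-0 α (series f) (series g) λ β γ eq → vanish β γ (subst (_ <_) (≡.sym eq) d<α)
    }
    where
    vanish : ∀ β γ → degree f ℕ.+ degree g < sum β ℕ.+ sum γ → series f β * series g γ ≈ 0#
    vanish β γ d<β+γ with degree f ℕ.<? sum β
    ... | yes d<β = ≈-trans (*-congʳ (bounded f β d<β)) (zeroˡ _)
    ... | no d≮β  with degree g ℕ.<? sum γ
    ...   | yes d<γ = ≈-trans (*-congˡ (bounded g γ d<γ)) (zeroʳ _)
    ...   | no d≮γ  = contradiction d<β+γ (ℕ.≤⇒≯ (ℕ.+-mono-≤ (ℕ.≮⇒≥ d≮β) (ℕ.≮⇒≥ d≮γ)))

  indicator : {P : Set} → Dec P → Carrier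
  indicator P? = if does P? then 1# else 0#

  private
    indicator-cong : {P Q : Set} (P? : Dec P) (Q? : Dec Q) → (P → Q) → (Q → P) → indicator P? ≈ indicator Q?
    indicator-cong (yes _) (yes _) _   _   = ≈-refl
    indicator-cong (yes p) (no ¬q) P⇒Q _   = contradiction (P⇒Q p) ¬q
    indicator-cong (no ¬p) (yes q) _   Q⇒P = contradiction (Q⇒P q) ¬p
    indicator-cong (no _)  (no _)  _   _   = ≈-refl

    indicator-no : {P : Set} (P? : Dec P) → ¬ P → indicator P? ≈ 0#
    indicator-no (yes p) ¬p = contradiction p ¬p
    indicator-no (no _)  _  = ≈-refl

  -- The sum of all monomials x^α such that P α.
  sumOfMonomials : {P : List ℕ → Set} → Decidable P → (d : ℕ) →
                   (∀ {α β} → α ↭ β → P α → P β) →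
                   (∀ {α} → P (0 ∷ α) → P α) → (∀ {α} → P α → P (0 ∷ α)) →
                   (∀ {α} → P α → sum α ≡ d) → Λ
  sumOfMonomials P? d P↭ unpadP padP deg = record
    { series  = indicator ∘ P?
    ; permute = λ p → indicator-cong (P? _) (P? _) (P↭ p) (P↭ (↭-sym p))
    ; pad     = λ α → indicator-cong (P? _) (P? _) unpadP padP
    ; degree  = d
    ; bounded = λ α d<α → indicator-no (P? α) λ Pα → ℕ.<-irrefl (≡.sym (deg Pα)) d<α
    }

  -- complete homogeneous, elementary and power sum symmetric functions
  h e p : ℕ → Λ
  h n = sumOfMonomials (λ α → sum α ℕ.≟ n) n
    (λ α↭β α≡n → ≡.trans (≡.sym (sum-↭ α↭β)) α≡n) id id id
  e n = sumOfMonomials (λ α → sum α ℕ.≟ n ×-dec All.all? (ℕ._≤? 1) α) n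
    (λ α↭β (α≡n , α≤1) → ≡.trans (≡.sym (sum-↭ α↭β)) α≡n , All-resp-↭ α↭β α≤1)
    (λ { (α≡n , _ ∷ α≤1) → α≡n , α≤1 }) (λ (α≡n , α≤1) → α≡n , z≤n ∷ α≤1) proj₁
  p r = sumOfMonomials (λ α → List.≡-dec ℕ._≟_ (filter (0 ℕ.<?_) α) [ r ]) r
    (λ α↭β α≡r → ↭-singleton-inv (subst (_ ↭_) α≡r (↭-sym (filter-↭ (0 ℕ.<?_) α↭β))))
    id id
    (λ {α} α≡r → ≡.trans (≡.sym (sum-nonzero α)) (≡.trans (cong sum α≡r) (ℕ.+-identityʳ r)))
    where
    sum-nonzero : ∀ α → sum (filter (0 ℕ.<?_) α) ≡ sum α
    sum-nonzero []          = ≡.refl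
    sum-nonzero (zero ∷ α)  = sum-nonzero α
    sum-nonzero (suc a ∷ α) = cong (suc a ℕ.+_) (sum-nonzero α)

  Λ-rawRing : RawRing 0ℓ 0ℓ
  Λ-rawRing = record
    { Carrier = Λ ; _≈_ = _≈Λ_ ; _+_ = _+Λ_ ; _*_ = _*Λ_ ; -_ = -Λ_ ; 0# = 0Λ ; 1# = h 0 }

  open RawSemiringDefs (RawRing.rawSemiring Λ-rawRing) public using () renaming (_^_ to _^Λ_)

  -- Schur functions, by the Jacobi–Trudi formula det (h_{λᵢ-i+j}), with h_m = 0 for m < 0.
  s : Partition → Λ
  s ν = Determinant.det Λ-rawRing λ i j → hᶻ (+ List.lookup (parts ν) i ℤ.- + toℕ i ℤ.+ + toℕ j)
    where
    hᶻ : ℤ → Λ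
    hᶻ (+ m)    = h m
    hᶻ -[1+ _ ] = 0Λ

  powerSum : Partition → Λ
  powerSum ν = foldr (λ r f → p r *Λ f) (h 0) (parts ν)

  -- f ⟦ xs ⟧ evaluates f at x₁ , … , xₘ = xs and xᵢ = 0 for i > m.
  _⟦_⟧ : Λ → List Carrier → Carrier
  f ⟦ xs ⟧ = ∑ (exponents xs) λ α → series f α * ∏ (zip xs α) λ (x , a) → x ^ a
    where
    exponents : List Carrier → List (List ℕ)
    exponents []       = [ [] ]
    exponents (_ ∷ xs) = cartesianProductWith _∷_ (upTo (suc (degree f))) (exponents xs)

  linearCombination : (Partition → Λ) → List (Carrier × Partition) → Λ
  linearCombination b = foldr (λ (c , ν) f → c • b ν +Λ f) 0Λ

  InSchurSpan : (Partition → Set) → Λ → Set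
  InSchurSpan P f = ∃[ L ] All (P ∘ proj₂) L × f ≈Λ linearCombination s L

  -- f [X⟨1- u ⟩]≔ g: g is the plethysm f[X(1-u)], obtained by expanding f in
  -- power sums and replacing every p_r by (1-u^r) p_r.
  _[X⟨1-_⟩]≔_ : Λ → Carrier → Λ → Set
  f [X⟨1- u ⟩]≔ g = ∃[ L ]
    f ≈Λ linearCombination powerSum L ×
    g ≈Λ linearCombination (λ ν → ∏ (parts ν) (λ r → 1# - u ^ r) • powerSum ν) L

  record IsLinear (φ : Λ → Λ) : Set where
    field
      cong-Λ : ∀ {f g} → f ≈Λ g → φ f ≈Λ φ g
      homo-+ : ∀ f g → φ (f +Λ g) ≈Λ φ f +Λ φ g
      homo-• : ∀ c f → φ (c • f) ≈Λ c • φ f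

  record IsLinearForm (φ : Λ → Carrier) : Set where
    field
      cong-Λ : ∀ {f g} → f ≈Λ g → φ f ≈ φ g
      homo-+ : ∀ f g → φ (f +Λ g) ≈ φ f + φ g
      homo-• : ∀ c f → φ (c • f) ≈ c * φ f

  record IsHallScalarProduct (⟨_,_⟩ : Λ → Λ → Carrier) : Set where
    field
      linearˡ    : ∀ g → IsLinearForm (λ f → ⟨ f , g ⟩)
      linearʳ    : ∀ f → IsLinearForm (λ g → ⟨ f , g ⟩)
      normalised : ∀ μ → ⟨ s μ , s μ ⟩ ≈ 1#
      orthogonal : ∀ μ ν → parts μ ≢ parts ν → ⟨ s μ , s ν ⟩ ≈ 0#

  record IsModifiedMacdonald (q t : Carrier) (⟨_,_⟩ : Λ → Λ → Carrier) (H̃ : Partition → Λ) : Set where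
    field
      triangular-q : ∀ μ → ∃[ g ] (H̃ μ [X⟨1- q ⟩]≔ g) × InSchurSpan (λ ν → parts ν ⊵ parts μ) g
      triangular-t : ∀ μ → ∃[ g ] (H̃ μ [X⟨1- t ⟩]≔ g) × InSchurSpan (λ ν → parts ν ⊵ conjugate (parts μ)) g
      normalised   : ∀ μ → ⟨ H̃ μ , s (oneRow (sum (parts μ))) ⟩ ≈ 1#

  -- Δ′ f is the operator Δ′_f, with eigenvalue f[B_μ - 1] on H̃ μ.
  record IsDeltaPrime (q t : Carrier) (H̃ : Partition → Λ) (Δ′ : Λ → Λ → Λ) : Set where
    field
      linear     : ∀ f → IsLinear (Δ′ f)
      eigenvalue : ∀ f μ →
        Δ′ f (H̃ μ) ≈Λ f ⟦ map (λ (i , j) → q ^ i * t ^ j) (nonCornerCells (parts μ)) ⟧ • H̃ μ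

count : {A : Set} {P : A → Set} → Decidable P → List A → ℕ
count P? xs = length (filter P? xs)

words : ∀ n m → List (Vec (Fin n) m)
words n zero    = [ [] ]
words n (suc m) = cartesianProductWith _∷_ (allFin n) (words n m)

subsets : ∀ n → List (Subset n)
subsets zero    = [ [] ]
subsets (suc n) = cartesianProductWith _∷_ (inside ∷ outside ∷ []) (subsets n)

-- Dyck m d: a lattice path that starts on the diagonal y = x + d, makes m
-- north steps, stays weakly above y = x and ends on y = x.
data Dyck : ℕ → ℕ → Set where
  end   : Dyck 0 0
  north : ∀ {m d} → Dyck m (suc d) → Dyck (suc m) d
  east  : ∀ {m d} → Dyck m d → Dyck m (suc d)

DyckPath : ℕ → Set
DyckPath n = Dyck n 0

dyckPaths : ∀ m d → List (Dyck m d)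
dyckPaths zero    zero    = [ end ]
dyckPaths zero    (suc d) = map east (dyckPaths zero d)
dyckPaths (suc m) zero    = map north (dyckPaths m 1)
dyckPaths (suc m) (suc d) = map north (dyckPaths m (suc (suc d))) ++ map east (dyckPaths (suc m) d)

-- The vertical step from (x,y) to (x,y+1) has y - x whole squares between it and the diagonal.
areaWord : ∀ {m d} → Dyck m d → Vec ℕ m
areaWord end               = []
areaWord (north {d = d} π) = d ∷ areaWord π
areaWord (east π)          = areaWord π

-- The abscissae of the vertical steps, for a path starting at abscissa x.
columns : ∀ {m d} → ℕ → Dyck m d → Vec ℕ m
columns x end       = []
columns x (north π) = x ∷ columns x π
columns x (east π)  = columns (suc x) π

-- Vertical steps are indexed by Fin n, in order from bottom to top; the label
-- k ∈ {1,…,n} is represented by k - 1 in Fin n.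
record DecoratedPath (n : ℕ) : Set where
  constructor decorated
  field
    path : DyckPath n
    word : Vec (Fin n) n
    dv   : Subset n

  a : Fin n → ℕ
  a = lookup (areaWord path)

  w : Fin n → Fin n
  w = lookup word

  column : Fin n → ℕ
  column = lookup (columns 0 path)

  IsStandardLabelling : Set
  IsStandardLabelling = Unique word × (∀ i j → i Fin.< j → column i ≡ column j → w i Fin.< w j)

  ContractibleValley : Fin n → Set
  ContractibleValley i = ∃[ i⁻ ] toℕ i ≡ suc (toℕ i⁻) × (a i⁻ > a i ⊎ a i⁻ ≡ a i × w i⁻ Fin.< w i)

  IsStLD : ℕ → Set
  IsStLD k = IsStandardLabelling × (∀ i → i ∈ dv → ContractibleValley i) × ∣ dv ∣ ≡ k

  isStLD? : ∀ k → Dec (IsStLD k)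
  isStLD? k =
    (AllPairs.allPairs? (λ x y → ¬? (x Fin.≟ y)) word
      ×-dec Fin.all? λ i → Fin.all? λ j → (i Fin.<? j) →-dec (column i ℕ.≟ column j) →-dec (w i Fin.<? w j))
    ×-dec Fin.all? (λ i → (i ∈? dv) →-dec Fin.any? λ i⁻ → (toℕ i ℕ.≟ suc (toℕ i⁻)) ×-dec
            ((a i⁻ ℕ.>? a i) ⊎-dec (a i⁻ ℕ.≟ a i) ×-dec (w i⁻ Fin.<? w i)))
    ×-dec (∣ dv ∣ ℕ.≟ k)

  area : ℕ
  area = Vec.sum (areaWord path)

  PrimaryInversion SecondaryInversion : Fin n × Fin n → Set
  PrimaryInversion   (i , j) = i Fin.< j × a i ≡ a j × w i Fin.< w j × i ∉ dv
  SecondaryInversion (i , j) = i Fin.< j × a i ≡ suc (a j) × w i Fin.> w j × i ∉ dv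

  primaryInversion? : Decidable PrimaryInversion
  primaryInversion? (i , j) = (i Fin.<? j) ×-dec (a i ℕ.≟ a j) ×-dec (w i Fin.<? w j) ×-dec ¬? (i ∈? dv)

  secondaryInversion? : Decidable SecondaryInversion
  secondaryInversion? (i , j) = (i Fin.<? j) ×-dec (a i ℕ.≟ suc (a j)) ×-dec (w j Fin.<? w i) ×-dec ¬? (i ∈? dv)

  dinv : ℤ
  dinv = + (count primaryInversion? pairs ℕ.+ count secondaryInversion? pairs) ℤ.- + ∣ dv ∣
    where pairs = cartesianProduct (allFin n) (allFin n)

stLD : ∀ n k → List (DecoratedPath n)
stLD n k = filter (λ P → DecoratedPath.isStLD? P k)
  (cartesianProductWith (λ π (word , dv) → decorated π word dv) (dyckPaths n 0)
    (cartesianProduct (words n n) (subsets n)))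

permutations : ∀ n → List (Vec (Fin n) n)
permutations n = filter (AllPairs.allPairs? (λ x y → ¬? (x Fin.≟ y))) (words n n)

-- The one-line word σ₁ ⋯ σₙ with values in {1,…,n}, preceded by σ₀ = 0.
-- Positions beyond the end of the word are never used.
letter : ∀ {n m} → Vec (Fin n) m → ℕ → ℕ
letter σ       zero          = 0
letter []      (suc i)       = 0
letter (x ∷ σ) (suc zero)    = suc (toℕ x)
letter (x ∷ σ) (suc (suc i)) = letter σ (suc i)

module _ {n : ℕ} (σ : Vec (Fin n) n) where
  private
    σ⟨_⟩ : ℕ → ℕ
    σ⟨_⟩ = letter σ

    positions : List ℕ
    positions = map suc (upTo n)

  DoubleAscent DoubleDescent Peak Valley : ℕ → Set
  DoubleAscent  i = 2 ≤ i × σ⟨ i ∸ 2 ⟩ < σ⟨ i ∸ 1 ⟩ × σ⟨ i ∸ 1 ⟩ < σ⟨ i ⟩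
  DoubleDescent i = 2 ≤ i × σ⟨ i ∸ 2 ⟩ > σ⟨ i ∸ 1 ⟩ × σ⟨ i ∸ 1 ⟩ > σ⟨ i ⟩
  Peak          i = 2 ≤ i × σ⟨ i ∸ 2 ⟩ < σ⟨ i ∸ 1 ⟩ × σ⟨ i ∸ 1 ⟩ > σ⟨ i ⟩
  Valley        i = 2 ≤ i × σ⟨ i ∸ 2 ⟩ > σ⟨ i ∸ 1 ⟩ × σ⟨ i ∸ 1 ⟩ < σ⟨ i ⟩

  doubleAscent? : Decidable DoubleAscent
  doubleAscent? i = (2 ℕ.≤? i) ×-dec (σ⟨ i ∸ 2 ⟩ ℕ.<? σ⟨ i ∸ 1 ⟩) ×-dec (σ⟨ i ∸ 1 ⟩ ℕ.<? σ⟨ i ⟩)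

  doubleDescent? : Decidable DoubleDescent
  doubleDescent? i = (2 ℕ.≤? i) ×-dec (σ⟨ i ∸ 2 ⟩ ℕ.>? σ⟨ i ∸ 1 ⟩) ×-dec (σ⟨ i ∸ 1 ⟩ ℕ.>? σ⟨ i ⟩)

  peak? : Decidable Peak
  peak? i = (2 ℕ.≤? i) ×-dec (σ⟨ i ∸ 2 ⟩ ℕ.<? σ⟨ i ∸ 1 ⟩) ×-dec (σ⟨ i ∸ 1 ⟩ ℕ.>? σ⟨ i ⟩)

  valley? : Decidable Valley
  valley? i = (2 ℕ.≤? i) ×-dec (σ⟨ i ∸ 2 ⟩ ℕ.>? σ⟨ i ∸ 1 ⟩) ×-dec (σ⟨ i ∸ 1 ⟩ ℕ.<? σ⟨ i ⟩)

  monot : ℕ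
  monot = count (λ i → doubleAscent? i ⊎-dec doubleDescent? i) positions

  ThreeInversion : ℕ × ℕ → Set
  ThreeInversion (i , j) = i < j ×
    ( DoubleAscent  j × σ⟨ j ∸ 1 ⟩ < σ⟨ i ⟩ × σ⟨ i ⟩ < σ⟨ j ⟩
    ⊎ DoubleDescent j × σ⟨ j ∸ 1 ⟩ > σ⟨ i ⟩ × σ⟨ i ⟩ > σ⟨ j ⟩
    ⊎ Peak          j × σ⟨ i ⟩ > σ⟨ j ⟩
    ⊎ Valley        j × σ⟨ i ⟩ < σ⟨ j ⟩)

  threeInversion? : Decidable ThreeInversion
  threeInversion? (i , j) = (i ℕ.<? j) ×-dec
    ( (doubleAscent?  j ×-dec (σ⟨ j ∸ 1 ⟩ ℕ.<? σ⟨ i ⟩) ×-dec (σ⟨ i ⟩ ℕ.<? σ⟨ j ⟩))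
    ⊎-dec (doubleDescent? j ×-dec (σ⟨ j ∸ 1 ⟩ ℕ.>? σ⟨ i ⟩) ×-dec (σ⟨ i ⟩ ℕ.>? σ⟨ j ⟩))
    ⊎-dec (peak?          j ×-dec (σ⟨ i ⟩ ℕ.>? σ⟨ j ⟩))
    ⊎-dec (valley?        j ×-dec (σ⟨ i ⟩ ℕ.<? σ⟨ j ⟩)))

  inv₃ : ℕ
  inv₃ = count threeInversion? (cartesianProduct positions positions)

{-# OPTIONS --safe #-}
-- Write N = n + 1.  A vertical step with area a and label k gets the position
-- a N + (N - k); then a decorated labelled path is a word in n positions, and
-- its conditions and inversions only compare positions up to shifts by N.  Fix
-- the set of letters and sum (-1)^dinv over its words.  The lowest letter X can
-- be inserted into a word in several places, with alternating signs, and this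
-- removes it from the sum: if X is decorated, there remains the parity of the
-- number of undecorated letters between X and X + N; if X is undecorated, only
-- the words that start with X matter, and X becomes the new origin of the
-- positions.  Hence every signed sum is 0 or 1.  When the letters are rotated
-- cyclically until the lowest one has area 0, c rotations lower the area by c.
-- Recording c and the label r of the undecorated letter of area 0 for each
-- removed letter gives a recursion on n, in which c < r if and only if the
-- removed letter is decorated.  On permutations the same recursion arises by
-- removing the last letter, where c counts the 3-inversions that it makes.
module Submission where

open import Algebra.Bundles using (CommutativeRing)
import Algebra.Properties.CommutativeSemigroup as CommutativeSemigroupProperties
import Algebra.Properties.Ring as RingProperties
import Algebra.Properties.Semiring.Exp as SemiringExp
open import Data.Bool.Base using (Bool; true; false; not; _∧_; _∨_; _xor_; if_then_else_; T)
import Data.Bool.Properties as Bool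
open import Data.Fin.Base as Fin using (Fin; toℕ; punchIn)
import Data.Fin.Properties as Fin
open import Data.Fin.Subset using (Subset; ∣_∣) renaming (_∈_ to _∈ˢ_; _∉_ to _∉ˢ_)
open import Data.Fin.Subset.Properties using (∣p∣≤n)
open import Data.Integer.Base as ℤ using (ℤ; +_; -[1+_])
import Data.Integer.Properties as ℤ
open import Data.List.Base
  using (List; []; _∷_; _++_; [_]; map; foldr; filter; concatMap; length; null; zip; upTo; allFin; applyUpTo;
         tabulate; cartesianProduct; cartesianProductWith; initLast; _∷ʳ′_)
open import Data.List.Membership.Propositional using (_∈_)
open import Data.List.Membership.Propositional.Properties using (∈-map⁺; ∈-upTo⁺)
import Data.List.Properties as List
open import Data.List.Relation.Binary.Permutation.Propositional
  using (_↭_; prep; swap; ↭-refl; ↭-sym; ↭-trans; ↭-reflexive; ↭⇒↭ₛ)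
open import Data.List.Relation.Binary.Permutation.Propositional.Properties using (All-resp-↭; ¬x∷xs↭[]; ∷↭∷ʳ)
import Data.List.Relation.Binary.Permutation.Propositional.Properties as Perm
import Data.List.Relation.Binary.Permutation.Setoid.Properties as SetoidPerm
open import Data.List.Relation.Unary.All using (All; []; _∷_)
import Data.List.Relation.Unary.All as All
import Data.List.Relation.Unary.All.Properties as All
open import Data.List.Relation.Unary.AllPairs using (AllPairs; []; _∷_)
import Data.List.Relation.Unary.AllPairs.Properties as AllPairs
open import Data.List.Relation.Unary.Unique.Propositional using (Unique)
import Data.List.Relation.Unary.Unique.Propositional.Properties as Unique
open import Data.Nat.Base as ℕ using (ℕ; zero; suc; _∸_; _≤_; _<_; _>_; _<ᵇ_; _≡ᵇ_; z≤n; s≤s)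
open import Data.Nat.ListAction using (sum)
open import Data.Nat.ListAction.Properties using (sum-↭)
import Data.Nat.Properties as ℕ
open import Data.Product.Base using (Σ-syntax; ∃-syntax; _×_; _,_; proj₁; proj₂)
open import Data.Sum.Base using (_⊎_; inj₁; inj₂)
open import Data.Unit.Base using (⊤; tt)
open import Data.Vec.Base using (Vec; []; _∷_; toList; lookup; here; there)
import Data.Vec.Base as Vec
import Data.Vec.Properties as Vec
import Data.Vec.Relation.Unary.All as VecAll
import Data.Vec.Relation.Unary.AllPairs as VecAllPairs
open import Function.Base using (_∘_; id)
open import Function.Bundles using (Equivalence; mk⇔)
open import Level using (0ℓ)
open import Relation.Binary.Definitions using (tri<; tri≈; tri>)
open import Relation.Binary.PropositionalEquality
  using (_≡_; _≢_; refl; sym; trans; cong; cong₂; subst; module ≡-Reasoning) renaming (setoid to ≡-setoid)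
import Relation.Binary.Reasoning.Setoid as SetoidReasoning
open import Relation.Nullary.Decidable using (Dec; yes; no; does; ¬?; T?; _×-dec_; does-⇔)
open import Relation.Nullary.Negation using (¬_; contradiction)
open import Relation.Unary using (Decidable)
open import Defs
open SymmetricFunctions ℚ⟨q,t⟩ using (Λ; e; h; _^Λ_; IsHallScalarProduct; IsModifiedMacdonald; IsDeltaPrime)
open DecoratedPath using (dinv; area)

-- In terms of positions, y may follow p when y < p + N, a decorated y needs y < p, and an
-- undecorated y is inverted with a later z when z < y < z + N. Hence the lowest letter X, behind
-- some other letter of a legal word, fits exactly at the end or in front of an undecorated letter
-- below X + N. Each such letter that X moves past gains an inversion, so the signs of the places
-- alternate and only their parity remains. The obstacle is the first letter, which is undecorated
-- and bounded: X in front makes the rest start below X + N, while X further back keeps the old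
-- bound. For an undecorated X the count is therefore a difference of two counts. The second one
-- vanishes or equals the first (`good-merge`), which is why no value other than 0 and 1 occurs. For
-- the bound N, a non-empty set of letters with count 1 has exactly one undecorated letter of area
-- 0, so a single label r is enough as the state of the recursion.

private variable A B D : Set

-- Arrangements and finite sums

insertions : A → List A → List (List A)
insertions x []      = [ [ x ] ]
insertions x (y ∷ v) = (x ∷ y ∷ v) ∷ map (y ∷_) (insertions x v)

arrangements : List A → List (List A)
arrangements []       = [ [] ]
arrangements (x ∷ xs) = concatMap (insertions x) (arrangements xs)

insertions-↭ : (x : A) (v : List A) → All (_↭ x ∷ v) (insertions x v)
insertions-↭ x []      = ↭-refl ∷ []
insertions-↭ x (y ∷ v) = ↭-refl ∷ All.map⁺ (All.map (λ p → ↭-trans (prep y p) (swap y x ↭-refl)) (insertions-↭ x v))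

arrangements-↭ : (xs : List A) → All (_↭ xs) (arrangements xs)
arrangements-↭ []       = ↭-refl ∷ []
arrangements-↭ (x ∷ xs) = All.concat⁺ (All.map⁺ (All.map
  (λ {v} p → All.map (λ q → ↭-trans q (prep x p)) (insertions-↭ x v)) (arrangements-↭ xs)))

insertions-map : (f : A → B) (x : A) (v : List A) → insertions (f x) (map f v) ≡ map (map f) (insertions x v)
insertions-map f x []      = refl
insertions-map f x (y ∷ v) = cong ((f x ∷ f y ∷ map f v) ∷_) (trans (cong (map (f y ∷_)) (insertions-map f x v))
  (trans (sym (List.map-∘ (insertions x v))) (List.map-∘ (insertions x v))))

arrangements-map : (f : A → B) (xs : List A) → arrangements (map f xs) ≡ map (map f) (arrangements xs)
arrangements-map f []       = refl
arrangements-map f (x ∷ xs) = trans (cong (concatMap (insertions (f x))) (arrangements-map f xs)) (go (arrangements xs))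
  where
  go : ∀ vs → concatMap (insertions (f x)) (map (map f) vs) ≡ map (map f) (concatMap (insertions x) vs)
  go []       = refl
  go (v ∷ vs) = trans (cong₂ _++_ (insertions-map f x v) (go vs)) (sym (List.map-++ (map f) (insertions x v) _))

select : List A → List (A × List A)
select []       = []
select (x ∷ xs) = (x , xs) ∷ map (λ (y , rest) → y , x ∷ rest) (select xs)

tuples : List A → ℕ → List (List A)
tuples xs zero    = [ [] ]
tuples xs (suc m) = cartesianProductWith _∷_ xs (tuples xs m)

parity : (A → Bool) → List A → Bool
parity f = foldr (λ x b → f x xor b) false

xor-exchange : ∀ a b c → a xor (b xor c) ≡ b xor (a xor c)
xor-exchange a b c = trans (sym (Bool.xor-assoc a b c)) (trans (cong (_xor c) (Bool.xor-comm a b)) (Bool.xor-assoc b a c))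

parity-↭ : (f : A → Bool) {xs ys : List A} → xs ↭ ys → parity f xs ≡ parity f ys
parity-↭ f _↭_.refl          = refl
parity-↭ f (prep x p)        = cong (f x xor_) (parity-↭ f p)
parity-↭ f (swap {xs = xs} x y p) = trans (xor-exchange (f x) (f y) (parity f xs)) (cong (λ b → f y xor (f x xor b)) (parity-↭ f p))
parity-↭ f (_↭_.trans p q)   = trans (parity-↭ f p) (parity-↭ f q)

parity-false : (f : A → Bool) {xs : List A} → All (λ x → f x ≡ false) xs → parity f xs ≡ false
parity-false f []       = refl
parity-false f (e ∷ es) = cong₂ _xor_ e (parity-false f es)

module Sums (K : CommutativeRing 0ℓ 0ℓ) where
  open CommutativeRing K hiding (zero)
    renaming (refl to ≈-refl; sym to ≈-sym; trans to ≈-trans; reflexive to ≈-reflexive)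
  open FiniteSums K using (∑) public
  open RingProperties ring using (-1*x≈-x; -‿involutive)
  open CommutativeSemigroupProperties +-commutativeSemigroup using (interchange)
  open SetoidReasoning setoid

  ∑-cong : (xs : List A) {f g : A → Carrier} → (∀ x → f x ≈ g x) → ∑ xs f ≈ ∑ xs g
  ∑-cong []       e = ≈-refl
  ∑-cong (x ∷ xs) e = +-cong (e x) (∑-cong xs e)

  ∑-cong-All : {xs : List A} {f g : A → Carrier} → All (λ x → f x ≈ g x) xs → ∑ xs f ≈ ∑ xs g
  ∑-cong-All []       = ≈-refl
  ∑-cong-All (e ∷ es) = +-cong e (∑-cong-All es)

  ∑-++ : (xs ys : List A) (f : A → Carrier) → ∑ (xs ++ ys) f ≈ ∑ xs f + ∑ ys f
  ∑-++ []       ys f = ≈-sym (+-identityˡ _)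
  ∑-++ (x ∷ xs) ys f = ≈-trans (+-congˡ (∑-++ xs ys f)) (≈-sym (+-assoc _ _ _))

  ∑-map : (h : A → B) (xs : List A) (f : B → Carrier) → ∑ (map h xs) f ≈ ∑ xs (f ∘ h)
  ∑-map h []       f = ≈-refl
  ∑-map h (x ∷ xs) f = +-congˡ (∑-map h xs f)

  ∑-concatMap : (h : A → List B) (xs : List A) (f : B → Carrier) → ∑ (concatMap h xs) f ≈ ∑ xs (λ x → ∑ (h x) f)
  ∑-concatMap h []       f = ≈-refl
  ∑-concatMap h (x ∷ xs) f = ≈-trans (∑-++ (h x) (concatMap h xs) f) (+-congˡ (∑-concatMap h xs f))

  ∑-product : (h : A → B → D) (xs : List A) (ys : List B) (f : D → Carrier) →
              ∑ (cartesianProductWith h xs ys) f ≈ ∑ xs (λ x → ∑ ys (λ y → f (h x y)))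
  ∑-product h []       ys f = ≈-refl
  ∑-product h (x ∷ xs) ys f =
    ≈-trans (∑-++ (map (h x) ys) _ f) (+-cong (∑-map (h x) ys f) (∑-product h xs ys f))

  ∑-0 : (xs : List A) → ∑ xs (λ _ → 0#) ≈ 0#
  ∑-0 []       = ≈-refl
  ∑-0 (x ∷ xs) = ≈-trans (+-identityˡ _) (∑-0 xs)

  ∑-zero : (xs : List A) {f : A → Carrier} → (∀ x → f x ≈ 0#) → ∑ xs f ≈ 0#
  ∑-zero xs e = ≈-trans (∑-cong xs e) (∑-0 xs)

  ∑-+ : (xs : List A) (f g : A → Carrier) → ∑ xs (λ x → f x + g x) ≈ ∑ xs f + ∑ xs g
  ∑-+ []       f g = ≈-sym (+-identityˡ _)
  ∑-+ (x ∷ xs) f g = ≈-trans (+-congˡ (∑-+ xs f g)) (interchange _ _ _ _)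

  *-∑ : (a : Carrier) (xs : List A) (f : A → Carrier) → a * ∑ xs f ≈ ∑ xs (λ x → a * f x)
  *-∑ a []       f = zeroʳ a
  *-∑ a (x ∷ xs) f = ≈-trans (distribˡ _ _ _) (+-congˡ (*-∑ a xs f))

  ∑-* : (xs : List A) (f : A → Carrier) (a : Carrier) → ∑ xs f * a ≈ ∑ xs (λ x → f x * a)
  ∑-* xs f a = ≈-trans (*-comm _ a) (≈-trans (*-∑ a xs f) (∑-cong xs λ _ → *-comm a _))

  ∑-swap : (xs : List A) (ys : List B) (f : A → B → Carrier) →
           ∑ xs (λ x → ∑ ys (f x)) ≈ ∑ ys (λ y → ∑ xs (λ x → f x y))
  ∑-swap []       ys f = ≈-sym (∑-0 ys)
  ∑-swap (x ∷ xs) ys f = ≈-trans (+-congˡ (∑-swap xs ys f)) (≈-sym (∑-+ ys _ _))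

  infixr 5 _▹_
  _▹_ : Bool → Carrier → Carrier
  b ▹ x = if b then x else 0#

  ▹-cong : ∀ b {x y} → (b ≡ true → x ≈ y) → b ▹ x ≈ b ▹ y
  ▹-cong true  e = e refl
  ▹-cong false e = ≈-refl

  ▹-congʳ : ∀ b {x y} → x ≈ y → b ▹ x ≈ b ▹ y
  ▹-congʳ b e = ▹-cong b λ _ → e

  ▹-congˡ : ∀ {b c} → b ≡ c → ∀ x → b ▹ x ≈ c ▹ x
  ▹-congˡ refl x = ≈-refl

  ▹-∧ : ∀ b c x → b ∧ c ▹ x ≈ b ▹ c ▹ x
  ▹-∧ true  c x = ≈-refl
  ▹-∧ false c x = ≈-refl

  *-▹ : ∀ a b x → a * (b ▹ x) ≈ b ▹ a * x
  *-▹ a true  x = ≈-refl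
  *-▹ a false x = zeroʳ a

  ▹-* : ∀ b x a → (b ▹ x) * a ≈ b ▹ x * a
  ▹-* true  x a = ≈-refl
  ▹-* false x a = zeroˡ a

  ▹-∑ : ∀ b (xs : List A) f → b ▹ ∑ xs f ≈ ∑ xs (λ x → b ▹ f x)
  ▹-∑ true  xs f = ≈-refl
  ▹-∑ false xs f = ≈-sym (∑-0 xs)

  ∑-filter : {P : A → Set} (P? : Decidable P) (xs : List A) (f : A → Carrier) →
             ∑ (filter P? xs) f ≈ ∑ xs (λ x → does (P? x) ▹ f x)
  ∑-filter P? []       f = ≈-refl
  ∑-filter P? (x ∷ xs) f with does (P? x)
  ... | true  = +-congˡ (∑-filter P? xs f)
  ... | false = ≈-trans (∑-filter P? xs f) (≈-sym (+-identityˡ _))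

  sign : Bool → Carrier
  sign b = if b then - 1# else 1#

  sign-xor : ∀ a b → sign (a xor b) ≈ sign a * sign b
  sign-xor false b     = ≈-sym (*-identityˡ _)
  sign-xor true  false = ≈-sym (*-identityʳ _)
  sign-xor true  true  = ≈-sym (≈-trans (-1*x≈-x (- 1#)) (-‿involutive 1#))

  sign-not : ∀ a → sign (not a) ≈ - sign a
  sign-not true  = ≈-sym (-‿involutive 1#)
  sign-not false = ≈-refl

  sign-cancel : ∀ a → sign a + sign (not a) ≈ 0#
  sign-cancel a = ≈-trans (+-congˡ (sign-not a)) (-‿inverseʳ _)

  ∑-insertions-∷ : (x y : A) (v : List A) (f : List A → Carrier) →
                   ∑ (insertions x (y ∷ v)) f ≈ f (x ∷ y ∷ v) + ∑ (insertions x v) (f ∘ (y ∷_))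
  ∑-insertions-∷ x y v f = +-congˡ (∑-map (y ∷_) (insertions x v) f)

  ∑-insertions-∷ʳ : (x y : A) (v : List A) (f : List A → Carrier) →
                    ∑ (insertions x (v ++ [ y ])) f ≈ ∑ (insertions x v) (λ u → f (u ++ [ y ])) + f ((v ++ [ y ]) ++ [ x ])
  ∑-insertions-∷ʳ x y []      f = ≈-trans (+-congˡ (+-identityʳ _)) (+-congʳ (≈-sym (+-identityʳ _)))
  ∑-insertions-∷ʳ x y (z ∷ v) f = begin
    ∑ (insertions x (z ∷ v ++ [ y ])) f
      ≈⟨ ∑-insertions-∷ x z (v ++ [ y ]) f ⟩
    f (x ∷ z ∷ v ++ [ y ]) + ∑ (insertions x (v ++ [ y ])) (f ∘ (z ∷_))
      ≈⟨ +-congˡ (∑-insertions-∷ʳ x y v (f ∘ (z ∷_))) ⟩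
    f (x ∷ z ∷ v ++ [ y ]) + (∑ (insertions x v) (λ u → f (z ∷ u ++ [ y ])) + f (z ∷ (v ++ [ y ]) ++ [ x ]))
      ≈⟨ +-assoc _ _ _ ⟨
    (f (x ∷ z ∷ v ++ [ y ]) + ∑ (insertions x v) (λ u → f (z ∷ u ++ [ y ]))) + f (z ∷ (v ++ [ y ]) ++ [ x ])
      ≈⟨ +-congʳ (∑-insertions-∷ x z v (λ u → f (u ++ [ y ]))) ⟨
    ∑ (insertions x (z ∷ v)) (λ u → f (u ++ [ y ])) + f (z ∷ (v ++ [ y ]) ++ [ x ]) ∎

  ∑-arrangements-∷ : (x : A) (xs : List A) (f : List A → Carrier) →
                     ∑ (arrangements (x ∷ xs)) f ≈ ∑ (arrangements xs) (λ v → ∑ (insertions x v) f)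
  ∑-arrangements-∷ x xs f = ∑-concatMap (insertions x) (arrangements xs) f

  -- Inserting two letters one after the other yields the same words in either order, only listed
  -- differently. The words are grouped by which of the two letters stand before z: both (two
  -- words), one (`R`) or none (`Q`). Only the last group needs the induction.
  ∑-insertions-comm : (x y : A) (v : List A) (f : List A → Carrier) →
                      ∑ (insertions y v) (λ u → ∑ (insertions x u) f) ≈ ∑ (insertions x v) (λ u → ∑ (insertions y u) f)
  ∑-insertions-comm x y []      f = +-congʳ (begin
    f (x ∷ y ∷ []) + (f (y ∷ x ∷ []) + 0#)   ≈⟨ +-congˡ (+-identityʳ _) ⟩
    f (x ∷ y ∷ []) + f (y ∷ x ∷ [])          ≈⟨ +-comm _ _ ⟩
    f (y ∷ x ∷ []) + f (x ∷ y ∷ [])          ≈⟨ +-congˡ (+-identityʳ _) ⟨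
    f (y ∷ x ∷ []) + (f (x ∷ y ∷ []) + 0#)   ∎)
  ∑-insertions-comm x y (z ∷ v) f = begin
    ∑ (insertions y (z ∷ v)) (λ u → ∑ (insertions x u) f)
      ≈⟨ expand x y ⟩
    (f (x ∷ y ∷ z ∷ v) + (f (y ∷ x ∷ z ∷ v) + R x y)) + (R y x + Q x y)
      ≈⟨ +-cong (≈-sym (+-assoc _ _ _)) (+-congˡ (∑-insertions-comm x y v (f ∘ (z ∷_)))) ⟩
    ((f (x ∷ y ∷ z ∷ v) + f (y ∷ x ∷ z ∷ v)) + R x y) + (R y x + Q y x)
      ≈⟨ +-assoc _ _ _ ⟩
    (f (x ∷ y ∷ z ∷ v) + f (y ∷ x ∷ z ∷ v)) + (R x y + (R y x + Q y x))
      ≈⟨ +-cong (+-comm _ _) (≈-trans (≈-sym (+-assoc _ _ _)) (≈-trans (+-congʳ (+-comm _ _)) (+-assoc _ _ _))) ⟩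
    (f (y ∷ x ∷ z ∷ v) + f (x ∷ y ∷ z ∷ v)) + (R y x + (R x y + Q y x))
      ≈⟨ +-assoc _ _ _ ⟨
    ((f (y ∷ x ∷ z ∷ v) + f (x ∷ y ∷ z ∷ v)) + R y x) + (R x y + Q y x)
      ≈⟨ +-congʳ (+-assoc _ _ _) ⟩
    (f (y ∷ x ∷ z ∷ v) + (f (x ∷ y ∷ z ∷ v) + R y x)) + (R x y + Q y x)
      ≈⟨ expand y x ⟨
    ∑ (insertions x (z ∷ v)) (λ u → ∑ (insertions y u) f) ∎
    where
    R Q : (a b : _) → Carrier
    R a b = ∑ (insertions a v) (λ u → f (b ∷ z ∷ u))
    Q a b = ∑ (insertions b v) (λ u → ∑ (insertions a u) (f ∘ (z ∷_)))
    expand : ∀ a b → ∑ (insertions b (z ∷ v)) (λ u → ∑ (insertions a u) f)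
                     ≈ (f (a ∷ b ∷ z ∷ v) + (f (b ∷ a ∷ z ∷ v) + R a b)) + (R b a + Q a b)
    expand a b = ≈-trans (∑-insertions-∷ b z v _) (+-cong
      (≈-trans (∑-insertions-∷ a b (z ∷ v) f) (+-congˡ (∑-insertions-∷ a z v (f ∘ (b ∷_)))))
      (≈-trans (∑-cong (insertions b v) λ u → ∑-insertions-∷ a z u f) (∑-+ (insertions b v) _ _)))

  -- This makes a signed count a function of the multiset of letters, so that any letter may be
  -- treated as the one inserted last.
  ∑-arrangements-↭ : {xs ys : List A} → xs ↭ ys → (f : List A → Carrier) → ∑ (arrangements xs) f ≈ ∑ (arrangements ys) f
  ∑-arrangements-↭ _↭_.refl        f = ≈-refl
  ∑-arrangements-↭ (prep {xs = xs} {ys = ys} x p) f = begin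
    ∑ (arrangements (x ∷ xs)) f                        ≈⟨ ∑-arrangements-∷ x xs f ⟩
    ∑ (arrangements xs) (λ v → ∑ (insertions x v) f)   ≈⟨ ∑-arrangements-↭ p _ ⟩
    ∑ (arrangements ys) (λ v → ∑ (insertions x v) f)   ≈⟨ ∑-arrangements-∷ x ys f ⟨
    ∑ (arrangements (x ∷ ys)) f                        ∎
  ∑-arrangements-↭ (swap {xs = xs} {ys = ys} x y p) f = begin
    ∑ (arrangements (x ∷ y ∷ xs)) f
      ≈⟨ unfold x y xs ⟩
    ∑ (arrangements xs) (λ v → ∑ (insertions y v) (λ u → ∑ (insertions x u) f))
      ≈⟨ ∑-arrangements-↭ p _ ⟩
    ∑ (arrangements ys) (λ v → ∑ (insertions y v) (λ u → ∑ (insertions x u) f))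
      ≈⟨ ∑-cong (arrangements ys) (λ v → ∑-insertions-comm x y v f) ⟩
    ∑ (arrangements ys) (λ v → ∑ (insertions x v) (λ u → ∑ (insertions y u) f))
      ≈⟨ unfold y x ys ⟨
    ∑ (arrangements (y ∷ x ∷ ys)) f ∎
    where
    unfold : ∀ a b zs → ∑ (arrangements (a ∷ b ∷ zs)) f
             ≈ ∑ (arrangements zs) (λ v → ∑ (insertions b v) (λ u → ∑ (insertions a u) f))
    unfold a b zs = ≈-trans (∑-arrangements-∷ a (b ∷ zs) f) (∑-arrangements-∷ b zs _)
  ∑-arrangements-↭ (_↭_.trans p q) f = ≈-trans (∑-arrangements-↭ p f) (∑-arrangements-↭ q f)

  ∑-select-∷ : (x : A) (xs : List A) (f : A → List A → Carrier) →
               ∑ (select (x ∷ xs)) (λ (y , r) → f y r) ≈ f x xs + ∑ (select xs) (λ (y , r) → f y (x ∷ r))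
  ∑-select-∷ x xs f = +-congˡ (∑-map _ (select xs) _)

  -- The split by first letter matches the enumeration of vectors by `words`.
  ∑-arrangements-first : (x : A) (xs : List A) (f : List A → Carrier) →
    ∑ (arrangements (x ∷ xs)) f ≈ ∑ (select (x ∷ xs)) (λ (y , r) → ∑ (arrangements r) (λ v → f (y ∷ v)))
  ∑-arrangements-first x []       f = ≈-sym (+-congʳ (+-identityʳ _))
  ∑-arrangements-first x (z ∷ zs) f = begin
    ∑ (arrangements (x ∷ z ∷ zs)) f
      ≈⟨ ∑-arrangements-∷ x (z ∷ zs) f ⟩
    ∑ (arrangements (z ∷ zs)) (λ v → ∑ (insertions x v) f)
      ≈⟨ ∑-cong (arrangements (z ∷ zs)) insert ⟩
    ∑ (arrangements (z ∷ zs)) (λ v → f (x ∷ v) + behind v)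
      ≈⟨ ∑-+ (arrangements (z ∷ zs)) _ _ ⟩
    ∑ (arrangements (z ∷ zs)) (f ∘ (x ∷_)) + ∑ (arrangements (z ∷ zs)) behind
      ≈⟨ +-congˡ (∑-arrangements-first z zs behind) ⟩
    ∑ (arrangements (z ∷ zs)) (f ∘ (x ∷_))
      + ∑ (select (z ∷ zs)) (λ (y , r) → ∑ (arrangements r) (λ v → ∑ (insertions x v) (f ∘ (y ∷_))))
      ≈⟨ +-congˡ (∑-cong (select (z ∷ zs)) λ (y , r) → ∑-arrangements-∷ x r (f ∘ (y ∷_))) ⟨
    ∑ (arrangements (z ∷ zs)) (f ∘ (x ∷_))
      + ∑ (select (z ∷ zs)) (λ (y , r) → ∑ (arrangements (x ∷ r)) (f ∘ (y ∷_)))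
      ≈⟨ ∑-select-∷ x (z ∷ zs) (λ y r → ∑ (arrangements r) (λ v → f (y ∷ v))) ⟨
    ∑ (select (x ∷ z ∷ zs)) (λ (y , r) → ∑ (arrangements r) (λ v → f (y ∷ v))) ∎
    where
    behind : List _ → Carrier
    behind []      = 0#
    behind (y ∷ v) = ∑ (insertions x v) (f ∘ (y ∷_))
    insert : ∀ v → ∑ (insertions x v) f ≈ f (x ∷ v) + behind v
    insert []      = ≈-refl
    insert (y ∷ v) = ∑-insertions-∷ x y v f

  -- A 3-inversion (i, j) belongs to its larger index j, so deleting the last letter of a
  -- permutation leaves the other 3-inversions intact. The recursion on permutations therefore
  -- splits by the last letter.
  ∑-arrangements-last : (x : A) (xs : List A) (f : List A → Carrier) →
    ∑ (arrangements (x ∷ xs)) f ≈ ∑ (select (x ∷ xs)) (λ (y , r) → ∑ (arrangements r) (λ v → f (v ++ [ y ])))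
  ∑-arrangements-last x []       f = ≈-sym (+-congʳ (+-identityʳ _))
  ∑-arrangements-last x (z ∷ zs) f = begin
    ∑ (arrangements (x ∷ z ∷ zs)) f
      ≈⟨ ∑-arrangements-∷ x (z ∷ zs) f ⟩
    ∑ (arrangements (z ∷ zs)) (λ v → ∑ (insertions x v) f)
      ≈⟨ ∑-arrangements-last z zs _ ⟩
    ∑ (select (z ∷ zs)) (λ (y , r) → ∑ (arrangements r) (λ v → ∑ (insertions x (v ++ [ y ])) f))
      ≈⟨ ∑-cong (select (z ∷ zs)) (λ (y , r) → ≈-trans
           (∑-cong (arrangements r) (λ v → ∑-insertions-∷ʳ x y v f))
           (≈-trans (∑-+ (arrangements r) _ _) (+-congʳ (≈-sym (∑-arrangements-∷ x r (λ u → f (u ++ [ y ]))))))) ⟩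
    ∑ (select (z ∷ zs)) (λ (y , r) → ∑ (arrangements (x ∷ r)) (λ u → f (u ++ [ y ]))
                                      + ∑ (arrangements r) (λ v → f ((v ++ [ y ]) ++ [ x ])))
      ≈⟨ ∑-+ (select (z ∷ zs)) _ _ ⟩
    ∑ (select (z ∷ zs)) (λ (y , r) → ∑ (arrangements (x ∷ r)) (λ u → f (u ++ [ y ])))
      + ∑ (select (z ∷ zs)) (λ (y , r) → ∑ (arrangements r) (λ v → f ((v ++ [ y ]) ++ [ x ])))
      ≈⟨ +-congˡ (∑-arrangements-last z zs (λ v → f (v ++ [ x ]))) ⟨
    ∑ (select (z ∷ zs)) (λ (y , r) → ∑ (arrangements (x ∷ r)) (λ u → f (u ++ [ y ])))
      + ∑ (arrangements (z ∷ zs)) (λ v → f (v ++ [ x ]))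
      ≈⟨ +-comm _ _ ⟩
    ∑ (arrangements (z ∷ zs)) (λ v → f (v ++ [ x ]))
      + ∑ (select (z ∷ zs)) (λ (y , r) → ∑ (arrangements (x ∷ r)) (λ u → f (u ++ [ y ])))
      ≈⟨ ∑-select-∷ x (z ∷ zs) (λ y r → ∑ (arrangements r) (λ v → f (v ++ [ y ]))) ⟨
    ∑ (select (x ∷ z ∷ zs)) (λ (y , r) → ∑ (arrangements r) (λ v → f (v ++ [ y ]))) ∎

-- Signed counts of words

<ᵇ-true : ∀ {m n} → m < n → (m <ᵇ n) ≡ true
<ᵇ-true m<n = Equivalence.to Bool.T-≡ (ℕ.<⇒<ᵇ m<n)

<ᵇ-false : ∀ {m n} → n ≤ m → (m <ᵇ n) ≡ false
<ᵇ-false {m} {n} n≤m with m <ᵇ n in eq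
... | false = refl
... | true  = contradiction (ℕ.<ᵇ⇒< m n (subst T (sym eq) tt)) (ℕ.≤⇒≯ n≤m)

<ᵇ-true⁻ : ∀ m n → (m <ᵇ n) ≡ true → m < n
<ᵇ-true⁻ m n eq = ℕ.<ᵇ⇒< m n (subst T (sym eq) tt)

<ᵇ-false⁻ : ∀ m n → (m <ᵇ n) ≡ false → n ≤ m
<ᵇ-false⁻ m n eq = ℕ.≮⇒≥ λ m<n → contradiction (trans (sym eq) (<ᵇ-true m<n)) λ ()

-- The vertical step with area a and label k ∈ {1,…,n} is the letter at
-- position a * N + (N ∸ k), where N = suc n, with its decoration.  Positions
-- modulo N are labels, and all conditions on decorated labelled paths, as well
-- as diagonal inversions, only compare positions up to shifts by N.
Letter : Set
Letter = ℕ × Bool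

module Words (N : ℕ) where

  -- p is the position of the preceding letter.
  continues : ℕ → List Letter → Bool
  continues p []            = true
  continues p ((y , e) ∷ v) = (y <ᵇ p ℕ.+ N) ∧ (not e ∨ (y <ᵇ p)) ∧ continues y v

  -- For a whole path B is N, which says that the first area is 0; after a lowest letter X has been
  -- removed from the front it is X + N. The first letter is undecorated because a contractible
  -- valley needs a preceding step.
  starts : ℕ → List Letter → Bool
  starts B []            = true
  starts B ((y , e) ∷ v) = not e ∧ (y <ᵇ B) ∧ continues y v

  undecoratedBelow : ℕ → Letter → Bool
  undecoratedBelow L (y , e) = not e ∧ (y <ᵇ L)

  -- Both kinds of diagonal inversion at once: within equal areas z < y says that the later label is
  -- larger, and if y has one more unit of area, y < z + N says that the later label is smaller.
  inverted : ℕ → Letter → Bool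
  inverted y (z , _) = (z <ᵇ y) ∧ (y <ᵇ z ℕ.+ N)

  -- A decorated letter opens no inversion and contributes -1 through the number of decorations,
  -- hence parity `true`.
  dinvParity : List Letter → Bool
  dinvParity []            = false
  dinvParity ((y , e) ∷ v) = (if e then true else parity (inverted y) v) xor dinvParity v

  private
    dinvParity-lowest : ∀ X d v → All ((X <_) ∘ proj₁) v → dinvParity ((X , d) ∷ v) ≡ d xor dinvParity v
    dinvParity-lowest X true  v X<v = refl
    dinvParity-lowest X false v X<v = cong (_xor dinvParity v) (parity-false (inverted X)
      (All.map (λ {z} X<z → cong (_∧ (X <ᵇ proj₁ z ℕ.+ N)) (<ᵇ-false (ℕ.<⇒≤ X<z))) X<v))

    dinvParity-∷ : ∀ X d y e v → X < y → ∀ {u} → u ↭ (X , d) ∷ v →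
      dinvParity ((y , e) ∷ u) ≡ (if e then true else ((y <ᵇ X ℕ.+ N) xor parity (inverted y) v)) xor dinvParity u
    dinvParity-∷ X d y e v X<y {u} u↭ = cong (λ s → (if e then true else s) xor dinvParity u)
      (trans (parity-↭ (inverted y) u↭)
        (cong (λ s → (s ∧ (y <ᵇ X ℕ.+ N)) xor parity (inverted y) v) (<ᵇ-true X<y)))

  module SignedCount (K : CommutativeRing 0ℓ 0ℓ) where
    open CommutativeRing K hiding (zero)
      renaming (refl to ≈-refl; sym to ≈-sym; trans to ≈-trans; reflexive to ≈-reflexive)
    open RingProperties ring using (-1*x≈-x)
    open Sums K
    open SetoidReasoning setoid

    signedCount : List Letter → ℕ → Carrier
    signedCount c B = ∑ (arrangements c) (λ v → starts B v ▹ sign (dinvParity v))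

    signedCount-↭ : ∀ {c c′} → c ↭ c′ → ∀ B → signedCount c B ≈ signedCount c′ B
    signedCount-↭ p B = ∑-arrangements-↭ p _

    private
      ▹-sign-≡ : ∀ {a b s u} → a ≡ b → s ≡ u → a ▹ sign s ≈ b ▹ sign u
      ▹-sign-≡ refl refl = ≈-refl

      ▹-sign : ∀ a s b u → a ▹ sign s * (b ▹ sign u) ≈ a ∧ b ▹ sign (s xor u)
      ▹-sign true  s true  u = ≈-sym (sign-xor s u)
      ▹-sign true  s false u = zeroʳ _
      ▹-sign false s b     u = ≈-refl

      -- The summands are the insertions of a new lowest letter before and after a letter at y.
      step : ∀ d e m a b n C O P → (m ≡ true → a ≡ true) →
        (C ∧ (not e ∧ m) ▹ sign (d xor ((if e then true else n) xor P)))
          + (a ∧ (not e ∨ b) ▹ sign (if e then true else (m xor n)) * (C ∧ not O ▹ sign (d xor P)))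
        ≈ (a ∧ (not e ∨ b) ∧ C) ∧ not ((not e ∧ m) xor O) ▹ sign (d xor ((if e then true else n) xor P))
      step d true m a b n C O P m⇒a = begin
        (C ∧ false ▹ _) + (a ∧ b ▹ sign true * (C ∧ not O ▹ sign (d xor P)))
          ≈⟨ +-cong (▹-congˡ (Bool.∧-zeroʳ C) _) (▹-sign (a ∧ b) true (C ∧ not O) (d xor P)) ⟩
        0# + ((a ∧ b) ∧ C ∧ not O ▹ sign (not (d xor P)))
          ≈⟨ +-identityˡ _ ⟩
        ((a ∧ b) ∧ C ∧ not O ▹ sign (not (d xor P)))
          ≈⟨ ▹-sign-≡ (trans (sym (Bool.∧-assoc (a ∧ b) C (not O))) (cong (_∧ not O) (Bool.∧-assoc a b C))) (Bool.not-distribʳ-xor d P) ⟩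
        ((a ∧ b ∧ C) ∧ not O ▹ sign (d xor not P)) ∎
      step d false false a b n C O P m⇒a = begin
        (C ∧ false ▹ _) + (a ∧ true ▹ sign n * (C ∧ not O ▹ sign (d xor P)))
          ≈⟨ +-cong (▹-congˡ (Bool.∧-zeroʳ C) _) (▹-sign (a ∧ true) n (C ∧ not O) (d xor P)) ⟩
        0# + ((a ∧ true) ∧ C ∧ not O ▹ sign (n xor (d xor P)))
          ≈⟨ +-identityˡ _ ⟩
        ((a ∧ true) ∧ C ∧ not O ▹ sign (n xor (d xor P)))
          ≈⟨ ▹-sign-≡ (trans (sym (Bool.∧-assoc (a ∧ true) C (not O))) (cong (_∧ not O) (Bool.∧-assoc a true C))) (xor-exchange n d P) ⟩
        ((a ∧ C) ∧ not O ▹ sign (d xor (n xor P))) ∎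
      step d false true a b n C O P m⇒a rewrite m⇒a refl = last C O
        where
        last : ∀ C O → (C ∧ true ▹ sign (d xor (n xor P))) + (sign (not n) * (C ∧ not O ▹ sign (d xor P)))
                     ≈ C ∧ not (not O) ▹ sign (d xor (n xor P))
        last false O     = ≈-trans (+-identityˡ _) (zeroʳ _)
        last true  true  = ≈-trans (+-congˡ (zeroʳ _)) (+-identityʳ _)
        -- The place directly before y and the place that survives behind y have opposite signs,
        -- because y is inverted with X only in the second.
        last true  false = begin
          sign (d xor (n xor P)) + sign (not n) * sign (d xor P)   ≈⟨ +-congˡ (sign-xor (not n) (d xor P)) ⟨
          sign (d xor (n xor P)) + sign (not n xor (d xor P))
            ≡⟨ cong (λ s → sign (d xor (n xor P)) + sign s)
                 (trans (sym (Bool.not-distribˡ-xor n (d xor P))) (cong not (xor-exchange n d P))) ⟩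
          sign (d xor (n xor P)) + sign (not (d xor (n xor P)))    ≈⟨ sign-cancel (d xor (n xor P)) ⟩
          0# ∎

    -- The admissible places are the end and those before an undecorated letter below X + N, and
    -- consecutive ones differ in sign. The foremost of them has the sign of X put at the front,
    -- where X causes no inversion. So an even number of such letters leaves one term with that
    -- sign, and an odd number leaves nothing.
    ∑-insertLowest : ∀ X d p v → X < p → All ((X <_) ∘ proj₁) v →
      ∑ (insertions (X , d) v) (λ u → continues p u ▹ sign (dinvParity u))
        ≈ continues p v ∧ not (parity (undecoratedBelow (X ℕ.+ N)) v) ▹ sign (d xor dinvParity v)
    ∑-insertLowest X d p [] X<p [] = ≈-trans (+-identityʳ _) (▹-sign-≡
      (cong₂ _∧_ (<ᵇ-true (ℕ.<-≤-trans X<p (ℕ.m≤m+n p N)))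
                 (cong (_∧ true) (trans (cong (not d ∨_) (<ᵇ-true X<p)) (Bool.∨-zeroʳ (not d)))))
      (parity-[X] d))
      where
      parity-[X] : ∀ d → (if d then true else false) xor false ≡ d xor false
      parity-[X] true  = refl
      parity-[X] false = refl
    ∑-insertLowest X d p ((y , e) ∷ v) X<p (X<y ∷ X<v) = begin
      ∑ (insertions (X , d) ((y , e) ∷ v)) (λ u → continues p u ▹ sign (dinvParity u))
        ≈⟨ ∑-insertions-∷ (X , d) (y , e) v _ ⟩
      (continues p ((X , d) ∷ (y , e) ∷ v) ▹ sign (dinvParity ((X , d) ∷ (y , e) ∷ v)))
        + ∑ (insertions (X , d) v) (λ u → continues p ((y , e) ∷ u) ▹ sign (dinvParity ((y , e) ∷ u)))
        ≈⟨ +-cong (▹-sign-≡ X-continues X-parity) (∑-cong-All (All.map y-step (insertions-↭ (X , d) v))) ⟩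
      (C ∧ (not e ∧ m) ▹ sign (d xor dinvParity ((y , e) ∷ v)))
        + ∑ (insertions (X , d) v) (λ u → a ∧ (not e ∨ b) ▹ σ * (continues y u ▹ sign (dinvParity u)))
        ≈⟨ +-congˡ (≈-trans (▹-congʳ (a ∧ (not e ∨ b)) (*-∑ σ (insertions (X , d) v) _)) (▹-∑ (a ∧ (not e ∨ b)) (insertions (X , d) v) _)) ⟨
      (C ∧ (not e ∧ m) ▹ sign (d xor dinvParity ((y , e) ∷ v)))
        + (a ∧ (not e ∨ b) ▹ σ * ∑ (insertions (X , d) v) (λ u → continues y u ▹ sign (dinvParity u)))
        ≈⟨ +-congˡ (▹-congʳ (a ∧ (not e ∨ b)) (*-congˡ (∑-insertLowest X d y v X<y X<v))) ⟩
      (C ∧ (not e ∧ m) ▹ sign (d xor dinvParity ((y , e) ∷ v)))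
        + (a ∧ (not e ∨ b) ▹ σ * (C ∧ not O ▹ sign (d xor dinvParity v)))
        ≈⟨ step d e m a b n C O (dinvParity v) m⇒a ⟩
      continues p ((y , e) ∷ v) ∧ not (parity (undecoratedBelow (X ℕ.+ N)) ((y , e) ∷ v)) ▹ sign (d xor dinvParity ((y , e) ∷ v)) ∎
      where
      m = y <ᵇ X ℕ.+ N
      a = y <ᵇ p ℕ.+ N
      b = y <ᵇ p
      n = parity (inverted y) v
      C = continues y v
      O = parity (undecoratedBelow (X ℕ.+ N)) v
      σ = sign (if e then true else (m xor n))
      -- As X < p, an undecorated y that may follow X may also follow p: deleting X from before it
      -- never breaks the word.
      m⇒a : m ≡ true → a ≡ true
      m⇒a eq = <ᵇ-true (ℕ.<-trans (<ᵇ-true⁻ y (X ℕ.+ N) eq) (ℕ.+-monoˡ-< N X<p))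
      X-continues : continues p ((X , d) ∷ (y , e) ∷ v) ≡ C ∧ (not e ∧ m)
      X-continues = trans (cong₂ (λ s u → s ∧ u ∧ continues X ((y , e) ∷ v))
          (<ᵇ-true (ℕ.<-≤-trans X<p (ℕ.m≤m+n p N)))
          (trans (cong (not d ∨_) (<ᵇ-true X<p)) (Bool.∨-zeroʳ (not d))))
        (trans (cong (λ s → m ∧ (not e ∨ s) ∧ C) (<ᵇ-false (ℕ.<⇒≤ X<y))) (reorder m (not e) C))
        where
        reorder : ∀ m e C → m ∧ (e ∨ false) ∧ C ≡ C ∧ (e ∧ m)
        reorder true  true  C = sym (Bool.∧-identityʳ C)
        reorder true  false C = sym (Bool.∧-zeroʳ C)
        reorder false true  C = sym (Bool.∧-zeroʳ C)
        reorder false false C = sym (Bool.∧-zeroʳ C)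
      X-parity : dinvParity ((X , d) ∷ (y , e) ∷ v) ≡ d xor dinvParity ((y , e) ∷ v)
      X-parity = dinvParity-lowest X d ((y , e) ∷ v) (X<y ∷ X<v)
      y-step : ∀ {u} → u ↭ (X , d) ∷ v → continues p ((y , e) ∷ u) ▹ sign (dinvParity ((y , e) ∷ u))
                 ≈ a ∧ (not e ∨ b) ▹ σ * (continues y u ▹ sign (dinvParity u))
      y-step {u} u↭ = ≈-trans
        (▹-sign-≡ (sym (Bool.∧-assoc a (not e ∨ b) (continues y u))) (dinvParity-∷ X d y e v X<y u↭))
        (≈-sym (▹-sign (a ∧ (not e ∨ b)) _ (continues y u) (dinvParity u)))

    private
      -- The first summand has X in front. In the second, X stands behind the first letter y, which
      -- is undecorated and satisfies y < B ≤ X + N. So y is one of the counted letters, which turns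
      -- the even number of `∑-insertLowest` into an odd one, and its inversion with X accounts for
      -- the additional sign.
      ∑-insertLowest-starts : ∀ X d B v → B ≤ X ℕ.+ N → All ((X <_) ∘ proj₁) v →
        ∑ (insertions (X , d) v) (λ u → starts B u ▹ sign (dinvParity u))
          ≈ (not d ∧ (X <ᵇ B) ▹ starts (X ℕ.+ N) v ▹ sign (dinvParity v))
            + (starts B v ∧ parity (undecoratedBelow (X ℕ.+ N)) v ▹ sign (not (d xor dinvParity v)))
      ∑-insertLowest-starts X true  B [] B≤ [] = ≈-refl
      ∑-insertLowest-starts X false B [] B≤ [] = +-congʳ (▹-congˡ (Bool.∧-identityʳ (X <ᵇ B)) _)
      ∑-insertLowest-starts X d B ((y , e) ∷ v) B≤ (X<y ∷ X<v) = begin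
        ∑ (insertions (X , d) ((y , e) ∷ v)) (λ u → starts B u ▹ sign (dinvParity u))
          ≈⟨ ∑-insertions-∷ (X , d) (y , e) v _ ⟩
        (starts B ((X , d) ∷ (y , e) ∷ v) ▹ sign (dinvParity ((X , d) ∷ (y , e) ∷ v)))
          + ∑ (insertions (X , d) v) (λ u → starts B ((y , e) ∷ u) ▹ sign (dinvParity ((y , e) ∷ u)))
          ≈⟨ +-cong (X-first d) (≈-trans (∑-cong-All (All.map y-first (insertions-↭ (X , d) v)))
               (≈-trans (≈-sym (≈-trans (▹-congʳ (not e ∧ (y <ᵇ B)) (*-∑ σ (insertions (X , d) v) _))
                                        (▹-∑ (not e ∧ (y <ᵇ B)) (insertions (X , d) v) _)))
                        (▹-congʳ (not e ∧ (y <ᵇ B)) (*-congˡ (∑-insertLowest X d y v X<y X<v))))) ⟩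
        (not d ∧ (X <ᵇ B) ▹ starts (X ℕ.+ N) ((y , e) ∷ v) ▹ sign (dinvParity ((y , e) ∷ v)))
          + (not e ∧ (y <ᵇ B) ▹ σ * (C ∧ not O ▹ sign (d xor dinvParity v)))
          ≈⟨ +-congˡ (combine e (y <ᵇ B) m (λ eq → <ᵇ-true (ℕ.<-≤-trans (<ᵇ-true⁻ y B eq) B≤))) ⟩
        (not d ∧ (X <ᵇ B) ▹ starts (X ℕ.+ N) ((y , e) ∷ v) ▹ sign (dinvParity ((y , e) ∷ v)))
          + (starts B ((y , e) ∷ v) ∧ parity (undecoratedBelow (X ℕ.+ N)) ((y , e) ∷ v)
               ▹ sign (not (d xor dinvParity ((y , e) ∷ v)))) ∎
        where
        m = y <ᵇ X ℕ.+ N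
        n = parity (inverted y) v
        C = continues y v
        O = parity (undecoratedBelow (X ℕ.+ N)) v
        σ = sign (if e then true else (m xor n))
        y-first : ∀ {u} → u ↭ (X , d) ∷ v → starts B ((y , e) ∷ u) ▹ sign (dinvParity ((y , e) ∷ u))
                    ≈ not e ∧ (y <ᵇ B) ▹ σ * (continues y u ▹ sign (dinvParity u))
        y-first {u} u↭ = ≈-trans
          (▹-sign-≡ (sym (Bool.∧-assoc (not e) (y <ᵇ B) (continues y u))) (dinvParity-∷ X d y e v X<y u↭))
          (≈-sym (▹-sign (not e ∧ (y <ᵇ B)) _ (continues y u) (dinvParity u)))
        X-first : ∀ d → starts B ((X , d) ∷ (y , e) ∷ v) ▹ sign (dinvParity ((X , d) ∷ (y , e) ∷ v))
                    ≈ not d ∧ (X <ᵇ B) ▹ starts (X ℕ.+ N) ((y , e) ∷ v) ▹ sign (dinvParity ((y , e) ∷ v))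
        X-first true  = ≈-refl
        X-first false = ≈-trans
          (▹-sign-≡ (cong ((X <ᵇ B) ∧_) (trans (cong (λ s → m ∧ (not e ∨ s) ∧ C) (<ᵇ-false (ℕ.<⇒≤ X<y))) (reorder m (not e) C)))
                    (dinvParity-lowest X false ((y , e) ∷ v) (X<y ∷ X<v)))
          (▹-∧ (X <ᵇ B) (starts (X ℕ.+ N) ((y , e) ∷ v)) (sign (dinvParity ((y , e) ∷ v))))
          where
          reorder : ∀ m e C → m ∧ (e ∨ false) ∧ C ≡ e ∧ m ∧ C
          reorder m true  C = refl
          reorder m false C = Bool.∧-zeroʳ m
        combine : ∀ e b m → (b ≡ true → m ≡ true) →
          (not e ∧ b ▹ sign (if e then true else (m xor n)) * (C ∧ not O ▹ sign (d xor dinvParity v)))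
            ≈ (not e ∧ b ∧ C) ∧ ((not e ∧ m) xor O) ▹ sign (not (d xor ((if e then true else n) xor dinvParity v)))
        combine true  b     m b⇒m = ≈-refl
        combine false false m b⇒m = ≈-refl
        combine false true  m b⇒m rewrite b⇒m refl = ≈-trans
          (▹-sign true (not n) (C ∧ not O) (d xor dinvParity v))
          (▹-sign-≡ {a = C ∧ not O} refl (trans (sym (Bool.not-distribˡ-xor n (d xor dinvParity v)))
                                (cong not (xor-exchange n d (dinvParity v)))))

    signedCount-[] : ∀ B → signedCount [] B ≈ 1#
    signedCount-[] B = +-identityʳ _

    signedCount-≥ : ∀ x c B → All ((B ≤_) ∘ proj₁) (x ∷ c) → signedCount (x ∷ c) B ≈ 0#
    signedCount-≥ x c B B≤ = ≈-trans
      (∑-cong-All (All.map (λ {v} p → ▹-congˡ (late v p) _) (arrangements-↭ (x ∷ c)))) (∑-0 (arrangements (x ∷ c)))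
      where
      late : ∀ v → v ↭ x ∷ c → starts B v ≡ false
      late []            p = contradiction (↭-sym p) ¬x∷xs↭[]
      late ((y , e) ∷ v) p with B≤y ∷ _ ← All-resp-↭ (↭-sym p) B≤ =
        trans (cong (λ s → not e ∧ s ∧ continues y v) (<ᵇ-false B≤y)) (Bool.∧-zeroʳ (not e))

    private
      ∑-arrangements-lowest : ∀ X d c B → B ≤ X ℕ.+ N → All ((X <_) ∘ proj₁) c →
        signedCount ((X , d) ∷ c) B ≈ (not d ∧ (X <ᵇ B) ▹ signedCount c (X ℕ.+ N))
          + (parity (undecoratedBelow (X ℕ.+ N)) c ▹ sign (not d) * signedCount c B)
      ∑-arrangements-lowest X d c B B≤ X<c = begin
        signedCount ((X , d) ∷ c) B
          ≈⟨ ∑-arrangements-∷ (X , d) c _ ⟩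
        ∑ (arrangements c) (λ v → ∑ (insertions (X , d) v) (λ u → starts B u ▹ sign (dinvParity u)))
          ≈⟨ ∑-cong-All (All.map (λ {v} v↭c → ≈-trans
               (∑-insertLowest-starts X d B v B≤ (All-resp-↭ (↭-sym v↭c) X<c))
               (+-congˡ (regroup v v↭c))) (arrangements-↭ c)) ⟩
        ∑ (arrangements c) (λ v → (not d ∧ (X <ᵇ B) ▹ starts (X ℕ.+ N) v ▹ sign (dinvParity v))
                                + (O ▹ sign (not d) * (starts B v ▹ sign (dinvParity v))))
          ≈⟨ ∑-+ (arrangements c) _ _ ⟩
        ∑ (arrangements c) (λ v → not d ∧ (X <ᵇ B) ▹ starts (X ℕ.+ N) v ▹ sign (dinvParity v))
          + ∑ (arrangements c) (λ v → O ▹ sign (not d) * (starts B v ▹ sign (dinvParity v)))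
          ≈⟨ +-cong (▹-∑ (not d ∧ (X <ᵇ B)) (arrangements c) _)
                    (≈-trans (▹-congʳ O (*-∑ (sign (not d)) (arrangements c) _)) (▹-∑ O (arrangements c) _)) ⟨
        (not d ∧ (X <ᵇ B) ▹ signedCount c (X ℕ.+ N)) + (O ▹ sign (not d) * signedCount c B) ∎
        where
        O = parity (undecoratedBelow (X ℕ.+ N)) c
        regroup : ∀ v → v ↭ c → starts B v ∧ parity (undecoratedBelow (X ℕ.+ N)) v ▹ sign (not (d xor dinvParity v))
                    ≈ O ▹ sign (not d) * (starts B v ▹ sign (dinvParity v))
        regroup v v↭c = ≈-trans
          (▹-sign-≡ (trans (Bool.∧-comm (starts B v) _) (cong (_∧ starts B v) (parity-↭ (undecoratedBelow (X ℕ.+ N)) v↭c)))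
                    (Bool.not-distribˡ-xor d (dinvParity v)))
          (≈-sym (▹-sign O (not d) (starts B v) (dinvParity v)))

    -- X cannot be first, and the sign of its decoration cancels that of the inversion between the
    -- first letter and X.
    signedCount-decorated : ∀ X c B → B ≤ X ℕ.+ N → All ((X <_) ∘ proj₁) c →
      signedCount ((X , true) ∷ c) B ≈ parity (undecoratedBelow (X ℕ.+ N)) c ▹ signedCount c B
    signedCount-decorated X c B B≤ X<c = ≈-trans (∑-arrangements-lowest X true c B B≤ X<c)
      (≈-trans (+-identityˡ _) (▹-congʳ (parity (undecoratedBelow (X ℕ.+ N)) c) (*-identityˡ _)))

    -- The two terms correspond to X in front and X behind the first letter. The second is negative
    -- because the first letter is inverted with X.
    signedCount-undecorated : ∀ X c B → X < B → B ≤ X ℕ.+ N → All ((X <_) ∘ proj₁) c →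
      signedCount ((X , false) ∷ c) B
        ≈ signedCount c (X ℕ.+ N) + - (parity (undecoratedBelow (X ℕ.+ N)) c ▹ signedCount c B)
    signedCount-undecorated X c B X<B B≤ X<c = ≈-trans (∑-arrangements-lowest X false c B B≤ X<c)
      (+-cong (▹-congˡ (<ᵇ-true X<B) _)
              (≈-trans (≈-sym (*-▹ (- 1#) (parity (undecoratedBelow (X ℕ.+ N)) c) _)) (-1*x≈-x _)))

-- Removal of the lowest letter

-- An area and a decoration, as for `Letter`.  Configurations are lists of
-- entries, one for each label, the largest label first.
Entry : Set
Entry = ℕ × Bool

grounded : Entry → Bool
grounded (zero  , e) = not e
grounded (suc a , e) = false

#grounded : List Entry → ℕ
#grounded []      = 0
#grounded (x ∷ f) = (if grounded x then 1 else 0) ℕ.+ #grounded f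

anyGrounded : List Entry → Bool
anyGrounded f = 0 <ᵇ #grounded f

-- Whether the signed count of a set of letters is 1, by repeated removal of the
-- lowest letter.  The bound on the first letter separates the labels of the
-- front from those of the back; the first argument is the number of letters.
good : ℕ → List Entry → List Entry → Bool
good n       []                  k = null k
good n       ((suc a , e) ∷ f)   k = good n f (k ++ [ a , e ])
-- A default, not reached when the first argument is the number of letters. The value `false` lets
-- the lemmas below hold for all lengths.
good zero    ((zero , e) ∷ f)    k = false
good (suc n) ((zero , true) ∷ f) k = parity grounded (f ++ k) ∧ good n f k
-- The removed letter becomes the new origin, so the back joins the front. The first factor is what
-- the subtraction in `signedCount-undecorated` leaves, by `good-merge`.
good (suc n) ((zero , false) ∷ f) k = not (anyGrounded f) ∧ good n (f ++ k) []

#grounded-++ : ∀ f k → #grounded (f ++ k) ≡ #grounded f ℕ.+ #grounded k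
#grounded-++ []      k = refl
#grounded-++ (x ∷ f) k = trans (cong (_ ℕ.+_) (#grounded-++ f k)) (sym (ℕ.+-assoc (if grounded x then 1 else 0) _ _))

odd : ℕ → Bool
odd zero    = false
odd (suc n) = not (odd n)

parity-grounded : ∀ f → parity grounded f ≡ odd (#grounded f)
parity-grounded []      = refl
parity-grounded (x ∷ f) with grounded x
... | true  = cong not (parity-grounded f)
... | false = parity-grounded f

private
  null-∷ʳ : (k : List A) (x : A) → null (k ++ [ x ]) ≡ false
  null-∷ʳ []      x = refl
  null-∷ʳ (_ ∷ _) x = refl

  null-++-∷ʳ : (f k : List A) (x : A) → null (f ++ k ++ [ x ]) ≡ false
  null-++-∷ʳ f k x = trans (cong null (sym (List.++-assoc f k [ x ]))) (null-∷ʳ (f ++ k) x)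

  parity-∧-null : ∀ f → parity grounded f ∧ null f ≡ false
  parity-∧-null []      = refl
  parity-∧-null (x ∷ f) = Bool.∧-zeroʳ (parity grounded (x ∷ f))

-- Without a grounded front entry no letter may be first: those of the front are decorated or lie at
-- least N above their label's base, hence not below the bound. Only the empty word remains.
good-ungrounded : ∀ n f k → #grounded f ≡ 0 → good n f k ≡ null (f ++ k)
good-ungrounded n       []                   k eq = refl
good-ungrounded n       ((suc a , e) ∷ f)    k eq = trans (good-ungrounded n f (k ++ [ a , e ]) eq) (null-++-∷ʳ f k _)
good-ungrounded zero    ((zero , true) ∷ f)  k eq = refl
good-ungrounded (suc n) ((zero , true) ∷ f)  k eq =
  trans (cong (parity grounded (f ++ k) ∧_) (good-ungrounded n f k eq)) (parity-∧-null (f ++ k))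

-- Rotations of ungrounded entries and decorated removals leave both grounded entries in the front,
-- and when the first of them comes up, the other one makes `anyGrounded` reject it.
good-front : ∀ n f k → 2 ≤ #grounded f → good n f k ≡ false
good-front n       ((suc a , e) ∷ f)     k 2≤ = good-front n f (k ++ [ a , e ]) 2≤
good-front zero    ((zero , e) ∷ f)      k 2≤ = refl
good-front (suc n) ((zero , true) ∷ f)   k 2≤ =
  trans (cong (parity grounded (f ++ k) ∧_) (good-front n f k 2≤)) (Bool.∧-zeroʳ _)
good-front (suc n) ((zero , false) ∷ f)  k (s≤s 1≤) = cong (λ b → not b ∧ good n (f ++ k) []) (<ᵇ-true 1≤)

-- The back returns to the front when a grounded front entry is removed, and then `good-front`
-- applies. If this never happens, the non-empty back fails the final test `null`.
good-back : ∀ n f k → 2 ≤ #grounded k → good n f k ≡ false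
good-back n       []                   (x ∷ k) 2≤ = refl
good-back n       ((suc a , e) ∷ f)    k       2≤ = good-back n f (k ++ [ a , e ])
  (subst (2 ≤_) (sym (#grounded-++ k _)) (ℕ.≤-trans 2≤ (ℕ.m≤m+n _ _)))
good-back zero    ((zero , e) ∷ f)     k       2≤ = refl
good-back (suc n) ((zero , true) ∷ f)  k       2≤ =
  trans (cong (parity grounded (f ++ k) ∧_) (good-back n f k 2≤)) (Bool.∧-zeroʳ _)
good-back (suc n) ((zero , false) ∷ f) k       2≤ =
  trans (cong (not (anyGrounded f) ∧_) (good-front n (f ++ k) []
    (subst (2 ≤_) (sym (#grounded-++ f k)) (ℕ.≤-trans 2≤ (ℕ.m≤n+m _ _))))) (Bool.∧-zeroʳ _)

-- Removing a grounded entry of f concatenates everything, wherever h was counted. If f has none,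
-- both sides merely test for emptiness.
good-move : ∀ n f h k → #grounded h ≡ 0 → good n (f ++ h) k ≡ good n f (h ++ k)
good-move n       []                   h k eq = good-ungrounded n h k eq
good-move n       ((suc a , e) ∷ f)    h k eq =
  trans (good-move n f h (k ++ [ a , e ]) eq) (cong (good n f) (sym (List.++-assoc h k _)))
good-move zero    ((zero , e) ∷ f)     h k eq = refl
good-move (suc n) ((zero , true) ∷ f)  h k eq =
  cong₂ _∧_ (cong (parity grounded) (List.++-assoc f h k)) (good-move n f h k eq)
good-move (suc n) ((zero , false) ∷ f) h k eq =
  cong₂ (λ b l → not b ∧ good n l [])
    (cong (0 <ᵇ_) (trans (#grounded-++ f h) (trans (cong (#grounded f ℕ.+_) eq) (ℕ.+-identityʳ _))))
    (List.++-assoc f h k)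

-- Let i and j be the numbers of grounded entries of f and k. For i = 1 and j = 0, the ungrounded k
-- may be counted with the front. Otherwise both sides are false: for i = 0 by `good-ungrounded`,
-- for i = j = 1 by the even parity on the left, and in the remaining cases by `good-front` and
-- `good-back`.
good-merge : ∀ n f k → parity grounded (f ++ k) ∧ good n f k ≡ anyGrounded f ∧ good n (f ++ k) []
good-merge n f k = trans (cong (_∧ good n f k) (trans (parity-grounded (f ++ k)) (cong odd (#grounded-++ f k))))
  (go (#grounded f) (#grounded k) refl refl)
  where
  both-false : ∀ {p} → good n f k ≡ false → 2 ≤ #grounded f ℕ.+ #grounded k → p ∧ good n f k ≡ good n (f ++ k) []
  both-false {p} e 2≤ = trans (trans (cong (p ∧_) e) (Bool.∧-zeroʳ p))
    (sym (good-front n (f ++ k) [] (subst (2 ≤_) (sym (#grounded-++ f k)) 2≤)))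
  go : ∀ i j → #grounded f ≡ i → #grounded k ≡ j →
       odd (i ℕ.+ j) ∧ good n f k ≡ (0 <ᵇ i) ∧ good n (f ++ k) []
  go zero          j             f≡ k≡ = trans (cong (odd j ∧_) (good-ungrounded n f k f≡))
    (trans (cong (_∧ null (f ++ k)) (sym (trans (parity-grounded (f ++ k)) (cong odd (trans (#grounded-++ f k) (cong₂ ℕ._+_ f≡ k≡))))))
           (parity-∧-null (f ++ k)))
  go (suc zero)    zero          f≡ k≡ =
    trans (cong (good n f) (sym (List.++-identityʳ k))) (sym (good-move n f k [] k≡))
  go (suc zero)    (suc zero)    f≡ k≡ = sym (good-front n (f ++ k) []
    (ℕ.≤-reflexive (sym (trans (#grounded-++ f k) (cong₂ ℕ._+_ f≡ k≡)))))
  go (suc zero)    (suc (suc j)) f≡ k≡ = both-false (good-back n f k (subst (2 ≤_) (sym k≡) (s≤s (s≤s z≤n))))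
    (ℕ.≤-trans (subst (2 ≤_) (sym k≡) (s≤s (s≤s z≤n))) (ℕ.m≤n+m _ _))
  go (suc (suc i)) j             f≡ k≡ = both-false (good-front n f k (subst (2 ≤_) (sym f≡) (s≤s (s≤s z≤n))))
    (ℕ.≤-trans (subst (2 ≤_) (sym f≡) (s≤s (s≤s z≤n))) (ℕ.m≤m+n _ _))

parity-map : (f : B → Bool) (g : A → B) (h : D → Bool) (k : A → D) {xs : List A} →
             All (λ x → f (g x) ≡ h (k x)) xs → parity f (map g xs) ≡ parity h (map k xs)
parity-map f g h k []       = refl
parity-map f g h k (e ∷ es) = cong₂ _xor_ e (parity-map f g h k es)

-- Signed counts of configurations

module Positions (N : ℕ) (K : CommutativeRing 0ℓ 0ℓ) where
  open CommutativeRing K hiding (zero)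
    renaming (refl to ≈-refl; sym to ≈-sym; trans to ≈-trans; reflexive to ≈-reflexive)
  open RingProperties ring using (-0#≈0#)
  open Sums K
  open Words N
  open SignedCount K
  open SetoidReasoning setoid

  position : ℕ × Entry → Letter
  position (v , a , e) = v ℕ.+ a ℕ.* N , e

  -- With all bases in one window of length N, the first letter is the lowest as soon as its area is
  -- 0, and a letter lies within N above it exactly when that letter has area 0.
  Window : ℕ × Entry → ℕ × Entry → Set
  Window (v , _) (v′ , _) = v < v′ × v′ < v ℕ.+ N

  private
    good-fallback : ∀ n f k → (good n (f ++ k) [] ▹ 1#) + - (parity grounded (f ++ k) ▹ good n f k ▹ 1#)
                    ≈ not (anyGrounded f) ∧ good n (f ++ k) [] ▹ 1#
    good-fallback n f k = ≈-trans
      (+-congˡ (-‿cong (≈-trans (≈-sym (▹-∧ (parity grounded (f ++ k)) (good n f k) 1#)) (▹-congˡ (good-merge n f k) 1#))))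
      (go (anyGrounded f) (good n (f ++ k) []))
      where
      go : ∀ b c → (c ▹ 1#) + - (b ∧ c ▹ 1#) ≈ not b ∧ c ▹ 1#
      go true  c = -‿inverseʳ _
      go false c = ≈-trans (+-congˡ -0#≈0#) (+-identityʳ _)

    position-≤ : ∀ x → proj₁ x ≤ proj₁ (position x)
    position-≤ (v , a , e) = ℕ.m≤m+n v _

    undecoratedBelow-position : ∀ X x → X < proj₁ x → proj₁ x < X ℕ.+ N →
                                undecoratedBelow (X ℕ.+ N) (position x) ≡ grounded (proj₂ x)
    undecoratedBelow-position X (v , zero  , e) X<v v< =
      trans (cong (not e ∧_) (<ᵇ-true (subst (_< X ℕ.+ N) (sym (ℕ.+-identityʳ v)) v<))) (Bool.∧-identityʳ _)
    undecoratedBelow-position X (v , suc a , e) X<v v< =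
      trans (cong (not e ∧_) (<ᵇ-false (ℕ.+-mono-≤ (ℕ.<⇒≤ X<v) (ℕ.m≤m+n N (a ℕ.* N))))) (Bool.∧-zeroʳ _)

  -- F and G hold the bases below and above the bound. A letter of positive area keeps its position
  -- when v, a + 1 is rewritten as v + N, a; the hypothesis B ≤ v + N places the new base in the
  -- back. Once the first base has area 0, its letter is the lowest and the removal lemmas apply.
  signedCount-good : ∀ n F G B → length F ℕ.+ length G ≡ n → AllPairs Window (F ++ G) →
    All ((_< B) ∘ proj₁) F → All ((B ≤_) ∘ proj₁) G → All ((λ v → B ≤ v ℕ.+ N) ∘ proj₁) F →
    signedCount (map position (F ++ G)) B ≈ good n (map proj₂ F) (map proj₂ G) ▹ 1#
  signedCount-good n [] []      B len W F<B B≤G B≤F = signedCount-[] B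
  signedCount-good n [] (x ∷ G) B len W F<B B≤G B≤F = signedCount-≥ (position x) (map position G) B
    (All.map⁺ {xs = x ∷ G} (All.map (λ {y} B≤y → ℕ.≤-trans B≤y (position-≤ y)) B≤G))
  signedCount-good n ((v , suc a , e) ∷ F) G B len (vW ∷ W) (v<B ∷ F<B) B≤G (B≤v ∷ B≤F) = begin
    signedCount (map position ((v , suc a , e) ∷ F ++ G)) B
      ≈⟨ signedCount-↭ (↭-trans (∷↭∷ʳ (position (v , suc a , e)) (map position (F ++ G))) (↭-reflexive
           (trans (cong (λ p → map position (F ++ G) ++ [ p , e ]) (sym (ℕ.+-assoc v N (a ℕ.* N))))
             (trans (sym (List.map-++ position (F ++ G) [ v′ ])) (cong (map position) (List.++-assoc F G _)))))) B ⟩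
    signedCount (map position (F ++ G ++ [ v′ ])) B
      ≈⟨ signedCount-good n F (G ++ [ v′ ]) B
           (trans (cong (length F ℕ.+_) (trans (List.length-++ G) (ℕ.+-comm _ 1))) (trans (ℕ.+-suc _ _) len))
           (subst (AllPairs Window) (List.++-assoc F G _) (AllPairs.++⁺ W ([] ∷ [])
             -- The new base v + N lies above every other base y because y < v + N, and less than N
             -- above it because v < y.
             (All.map (λ (v<y , y<v+N) → (y<v+N , ℕ.+-monoˡ-< N v<y) ∷ []) vW)))
           F<B (All.++⁺ B≤G (B≤v ∷ [])) B≤F ⟩
    good n (map proj₂ F) (map proj₂ (G ++ [ v′ ])) ▹ 1#
      ≈⟨ ▹-congˡ (cong (good n (map proj₂ F)) (List.map-++ proj₂ G _)) 1# ⟩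
    good n (map proj₂ F) (map proj₂ G ++ [ a , e ]) ▹ 1# ∎
    where v′ = v ℕ.+ N , a , e
  signedCount-good (suc n) ((v , zero , e) ∷ F) G B len (vW ∷ W) (v<B ∷ F<B) B≤G (B≤v ∷ B≤F) = lowest e
    where
    f = map proj₂ F
    k = map proj₂ G
    v≡ : v ℕ.+ 0 ≡ v
    v≡ = ℕ.+-identityʳ v
    above : All ((v ℕ.+ 0 <_) ∘ proj₁) (map position (F ++ G))
    above = All.map⁺ (All.map (λ {y} (v<y , _) → subst (_< _) (sym v≡) (ℕ.<-≤-trans v<y (position-≤ y))) vW)
    B≤v′ : B ≤ v ℕ.+ 0 ℕ.+ N
    B≤v′ = subst (λ m → B ≤ m ℕ.+ N) (sym v≡) B≤v
    shapes : map proj₂ (F ++ G) ≡ f ++ k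
    shapes = List.map-++ proj₂ F G
    parity≡ : parity (undecoratedBelow (v ℕ.+ 0 ℕ.+ N)) (map position (F ++ G)) ≡ parity grounded (f ++ k)
    parity≡ = trans (cong (λ m → parity (undecoratedBelow (m ℕ.+ N)) (map position (F ++ G))) v≡)
      (trans (parity-map (undecoratedBelow (v ℕ.+ N)) position grounded proj₂ (All.map (λ {y} (v<y , y<) → undecoratedBelow-position v y v<y y<) vW))
             (cong (parity grounded) shapes))
    len′ : length F ℕ.+ length G ≡ n
    len′ = ℕ.suc-injective len
    rest : signedCount (map position (F ++ G)) B ≈ good n f k ▹ 1#
    rest = signedCount-good n F G B len′ W F<B B≤G B≤F
    -- The bound v + N exceeds all remaining bases, so the new back is empty.
    restart : signedCount (map position (F ++ G)) (v ℕ.+ 0 ℕ.+ N) ≈ good n (f ++ k) [] ▹ 1#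
    restart = begin
      signedCount (map position (F ++ G)) (v ℕ.+ 0 ℕ.+ N)
        ≡⟨ cong₂ (λ l m → signedCount (map position l) (m ℕ.+ N)) (sym (List.++-identityʳ (F ++ G))) v≡ ⟩
      signedCount (map position ((F ++ G) ++ [])) (v ℕ.+ N)
        ≈⟨ signedCount-good n (F ++ G) [] (v ℕ.+ N) (trans (ℕ.+-identityʳ _) (trans (List.length-++ F) len′))
             (subst (AllPairs Window) (sym (List.++-identityʳ (F ++ G))) W)
             (All.map proj₂ vW) [] (All.map (λ (v<y , _) → ℕ.+-monoˡ-≤ N (ℕ.<⇒≤ v<y)) vW) ⟩
      good n (map proj₂ (F ++ G)) [] ▹ 1#
        ≡⟨ cong (λ l → good n l [] ▹ 1#) shapes ⟩
      good n (f ++ k) [] ▹ 1# ∎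
    lowest : ∀ e → signedCount ((v ℕ.+ 0 , e) ∷ map position (F ++ G)) B ≈ good (suc n) ((zero , e) ∷ f) k ▹ 1#
    lowest true  = begin
      signedCount ((v ℕ.+ 0 , true) ∷ map position (F ++ G)) B
        ≈⟨ signedCount-decorated (v ℕ.+ 0) _ B B≤v′ above ⟩
      (parity (undecoratedBelow (v ℕ.+ 0 ℕ.+ N)) (map position (F ++ G)) ▹ signedCount (map position (F ++ G)) B)
        ≈⟨ ≈-trans (▹-congˡ parity≡ _) (▹-congʳ (parity grounded (f ++ k)) rest) ⟩
      (parity grounded (f ++ k) ▹ good n f k ▹ 1#)
        ≈⟨ ▹-∧ (parity grounded (f ++ k)) (good n f k) 1# ⟨
      (parity grounded (f ++ k) ∧ good n f k ▹ 1#) ∎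
    lowest false = begin
      signedCount ((v ℕ.+ 0 , false) ∷ map position (F ++ G)) B
        ≈⟨ signedCount-undecorated (v ℕ.+ 0) _ B (subst (_< B) (sym v≡) v<B) B≤v′ above ⟩
      signedCount (map position (F ++ G)) (v ℕ.+ 0 ℕ.+ N)
        + - (parity (undecoratedBelow (v ℕ.+ 0 ℕ.+ N)) (map position (F ++ G)) ▹ signedCount (map position (F ++ G)) B)
        ≈⟨ +-cong restart (-‿cong (≈-trans (▹-congˡ parity≡ _) (▹-congʳ (parity grounded (f ++ k)) rest))) ⟩
      (good n (f ++ k) [] ▹ 1#) + - (parity grounded (f ++ k) ▹ good n f k ▹ 1#)
        ≈⟨ good-fallback n f k ⟩
      (not (anyGrounded f) ∧ good n (f ++ k) [] ▹ 1#) ∎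

-- An entry is rotated at most once before a removal brings the back to the front again, so the
-- number of removals bounds its area. Consequently sums over areas below a fixed L miss no good
-- configuration.
good-bound : ∀ n f k → good n f k ≡ true → All ((_< n) ∘ proj₁) f × All ((λ a → suc a < n) ∘ proj₁) k
good-bound n       []                   []  _  = [] , []
good-bound n       ((suc a , e) ∷ f)    k   gd with f< , k< ← good-bound n f (k ++ [ a , e ]) gd
  with a< ∷ [] ← All.++⁻ʳ k k< = a< ∷ f< , All.++⁻ˡ k k<
good-bound (suc n) ((zero , true) ∷ f)  k   gd with parity grounded (f ++ k)
... | true with f< , k< ← good-bound n f k gd = s≤s z≤n ∷ All.map ℕ.m<n⇒m<1+n f< , All.map ℕ.m<n⇒m<1+n k<
good-bound (suc n) ((zero , false) ∷ f) k   gd with anyGrounded f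
... | false with fk< , _ ← good-bound n (f ++ k) [] gd =
  s≤s z≤n ∷ All.map ℕ.m<n⇒m<1+n (All.++⁻ˡ f fk<) , All.map s≤s (All.++⁻ʳ f fk<)

-- The recursion on configurations

tuples-length : (xs : List A) (m : ℕ) → All ((_≡ m) ∘ length) (tuples xs m)
tuples-length xs zero    = refl ∷ []
tuples-length xs (suc m) = go xs
  where
  go : ∀ ys → All ((_≡ suc m) ∘ length) (cartesianProductWith _∷_ ys (tuples xs m))
  go []       = []
  go (y ∷ ys) = All.++⁺ (All.map⁺ (All.map (cong suc) (tuples-length xs m))) (go ys)

entries : ℕ → List Entry
entries L = cartesianProduct (upTo L) (true ∷ false ∷ [])

-- The label of the first grounded entry, or 0 if there is none.
groundLabel : List Entry → ℕ
groundLabel []      = 0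
groundLabel (x ∷ q) = if grounded x then suc (length q) else groundLabel q

groundLabel-≤ : ∀ q → groundLabel q ≤ length q
groundLabel-≤ []      = z≤n
groundLabel-≤ (x ∷ q) with grounded x
... | true  = ℕ.≤-refl
... | false = ℕ.m≤n⇒m≤1+n (groundLabel-≤ q)

-- In the concatenation the entries of k carry the labels up to `length k`. This is the origin of
-- the condition c < r in `transfer`, c being the length of the back.
anyGrounded-groundLabel : ∀ f k → anyGrounded f ≡ (length k <ᵇ groundLabel (f ++ k))
anyGrounded-groundLabel []      k = sym (<ᵇ-false (groundLabel-≤ k))
anyGrounded-groundLabel (x ∷ f) k with grounded x
... | true  = sym (<ᵇ-true {length k} {suc (length (f ++ k))}
  (s≤s (subst (length k ≤_) (sym (List.length-++ f)) (ℕ.m≤n+m (length k) (length f)))))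
... | false = anyGrounded-groundLabel f k

groundLabel-++ : ∀ f k → anyGrounded f ≡ true → groundLabel (f ++ k) ∸ length k ≡ groundLabel f
groundLabel-++ (x ∷ f) k eq with grounded x
... | true  = trans (cong (λ m → suc m ∸ length k) (List.length-++ f)) (ℕ.m+n∸n≡m (suc (length f)) (length k))
... | false = groundLabel-++ f k eq

All-upTo : ∀ n → All (_< n) (upTo n)
All-upTo n = All.applyUpTo⁺₁ id n id

module UpTo (K : CommutativeRing 0ℓ 0ℓ) where
  open CommutativeRing K hiding (zero)
    renaming (refl to ≈-refl; sym to ≈-sym; trans to ≈-trans; reflexive to ≈-reflexive)
  open Sums K
  open SetoidReasoning setoid

  ∑-upTo-suc : ∀ n (f : ℕ → Carrier) → ∑ (upTo (suc n)) f ≈ f 0 + ∑ (upTo n) (f ∘ suc)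
  ∑-upTo-suc n f = +-congˡ (≈-trans (≈-reflexive (cong (λ l → ∑ l f) (sym (List.map-upTo suc n)))) (∑-map suc (upTo n) f))

  ∑-upTo-last : ∀ n (f : ℕ → Carrier) → ∑ (upTo (suc n)) f ≈ ∑ (upTo n) f + f n
  ∑-upTo-last n f = ≈-trans (≈-reflexive (cong (λ l → ∑ l f) (sym (List.upTo-∷ʳ n))))
    (≈-trans (∑-++ (upTo n) [ n ] f) (+-congˡ (+-identityʳ _)))

  ∑-cong-upTo : ∀ n {f g : ℕ → Carrier} → (∀ x → x < n → f x ≈ g x) → ∑ (upTo n) f ≈ ∑ (upTo n) g
  ∑-cong-upTo n e = ∑-cong-All (All.map (λ {x} → e x) (All-upTo n))

  ∑-upTo-split : ∀ a m (f g : ℕ → Carrier) → a ≤ m →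
    ∑ (upTo m) (λ x → if x <ᵇ a then f x else g x) ≈ ∑ (upTo a) f + ∑ (upTo (m ∸ a)) (λ i → g (a ℕ.+ i))
  ∑-upTo-split zero    m       f g a≤m       = ≈-sym (+-identityˡ _)
  ∑-upTo-split (suc a) (suc m) f g (s≤s a≤m) = begin
    ∑ (upTo (suc m)) (λ x → if x <ᵇ suc a then f x else g x)
      ≈⟨ ∑-upTo-suc m _ ⟩
    f 0 + ∑ (upTo m) (λ x → if x <ᵇ a then f (suc x) else g (suc x))
      ≈⟨ +-congˡ (∑-upTo-split a m (f ∘ suc) (g ∘ suc) a≤m) ⟩
    f 0 + (∑ (upTo a) (f ∘ suc) + ∑ (upTo (m ∸ a)) (λ i → g (suc a ℕ.+ i)))
      ≈⟨ +-assoc _ _ _ ⟨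
    (f 0 + ∑ (upTo a) (f ∘ suc)) + ∑ (upTo (m ∸ a)) (λ i → g (suc a ℕ.+ i))
      ≈⟨ +-congʳ (∑-upTo-suc a f) ⟨
    ∑ (upTo (suc a)) f + ∑ (upTo (m ∸ a)) (λ i → g (suc a ℕ.+ i)) ∎

  ∑-upTo-reverse : ∀ n (f : ℕ → Carrier) → ∑ (upTo n) f ≈ ∑ (upTo n) (λ i → f (n ∸ suc i))
  ∑-upTo-reverse zero    f = ≈-refl
  ∑-upTo-reverse (suc n) f = begin
    ∑ (upTo (suc n)) f                              ≈⟨ ∑-upTo-last n f ⟩
    ∑ (upTo n) f + f n                              ≈⟨ +-comm _ _ ⟩
    f n + ∑ (upTo n) f                              ≈⟨ +-congˡ (∑-upTo-reverse n f) ⟩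
    f n + ∑ (upTo n) (λ i → f (n ∸ suc i))          ≈⟨ ∑-upTo-suc n (λ i → f (n ∸ i)) ⟨
    ∑ (upTo (suc n)) (λ i → f (n ∸ i))              ∎

  ∑-tuples-++ : (xs : List A) (m l : ℕ) (f : List A → Carrier) →
                ∑ (tuples xs (m ℕ.+ l)) f ≈ ∑ (tuples xs m) (λ u → ∑ (tuples xs l) (λ v → f (u ++ v)))
  ∑-tuples-++ xs zero    l f = ≈-sym (+-identityʳ _)
  ∑-tuples-++ xs (suc m) l f = ≈-trans (∑-product _∷_ xs (tuples xs (m ℕ.+ l)) f)
    (≈-trans (∑-cong xs λ x → ∑-tuples-++ xs m l (f ∘ (x ∷_))) (≈-sym (∑-product _∷_ xs (tuples xs m) _)))

  ∑-tuples-∷ʳ : (xs : List A) (m : ℕ) (f : List A → Carrier) →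
                ∑ (tuples xs (suc m)) f ≈ ∑ (tuples xs m) (λ u → ∑ xs (λ x → f (u ++ [ x ])))
  ∑-tuples-∷ʳ xs m f = ≈-trans (≈-reflexive (cong (λ j → ∑ (tuples xs j) f) (ℕ.+-comm 1 m)))
    (≈-trans (∑-tuples-++ xs m 1 f) (∑-cong (tuples xs m) λ u →
      ≈-trans (∑-product _∷_ xs [ [] ] _) (∑-cong xs λ x → +-identityʳ _)))

-- Summation over good configurations

module Transfer (K : CommutativeRing 0ℓ 0ℓ) (t z : CommutativeRing.Carrier K) where
  open CommutativeRing K hiding (zero)
    renaming (refl to ≈-refl; sym to ≈-sym; trans to ≈-trans; reflexive to ≈-reflexive)
  open CommutativeSemigroupProperties *-commutativeSemigroup using (x∙yz≈y∙xz)
  open SemiringExp semiring using (_^_)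
  open Sums K
  open UpTo K
  open SetoidReasoning setoid

  -- c counts the times that the front entry is moved to the back before an
  -- entry is removed, and r is the label of the undecorated letter of area 0.
  transfer : ℕ → (ℕ → Carrier) → ℕ → Carrier
  transfer n F r = ∑ (upTo (suc n)) (λ c → t ^ c * (if c <ᵇ r then z * F (r ∸ c) else F (suc n ∸ c)))

  -- `F` is a function of the state at size n and is pulled back to smaller sizes. The empty
  -- configuration and the empty word both have state 0.
  total : ℕ → (ℕ → Carrier) → Carrier
  total zero    F = F 0
  total (suc n) F = total n (transfer n F)

  decorationWeight : Bool → Carrier
  decorationWeight e = if e then z else 1#

  weight : List Entry → Carrier
  weight []            = 1#
  weight ((a , e) ∷ q) = t ^ a * (decorationWeight e * weight q)

  weight-++ : ∀ f k → weight (f ++ k) ≈ weight f * weight k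
  weight-++ []            k = ≈-sym (*-identityˡ _)
  weight-++ ((a , e) ∷ f) k = ≈-trans (*-congˡ (≈-trans (*-congˡ (weight-++ f k)) (≈-sym (*-assoc _ _ _)))) (≈-sym (*-assoc _ _ _))

  weight-rotate : ∀ a e f k → weight ((suc a , e) ∷ f ++ k) ≈ t * weight (f ++ k ++ [ a , e ])
  weight-rotate a e f k = begin
    (t * t ^ a) * (decorationWeight e * weight (f ++ k))      ≈⟨ *-assoc _ _ _ ⟩
    t * (t ^ a * (decorationWeight e * weight (f ++ k)))      ≈⟨ *-congˡ (*-congˡ (*-congʳ (*-identityʳ _))) ⟨
    t * (t ^ a * ((decorationWeight e * 1#) * weight (f ++ k)))      ≈⟨ *-congˡ (*-assoc _ _ _) ⟨
    t * (weight [ a , e ] * weight (f ++ k))                  ≈⟨ *-congˡ (*-comm _ _) ⟩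
    t * (weight (f ++ k) * weight [ a , e ])                  ≈⟨ *-congˡ (weight-++ (f ++ k) [ a , e ]) ⟨
    t * weight ((f ++ k) ++ [ a , e ])                        ≡⟨ cong (λ l → t * weight l) (List.++-assoc f k _) ⟩
    t * weight (f ++ k ++ [ a , e ])                          ∎

  module _ (L : ℕ) where
    private
      E : List Entry
      E = entries L

    goodSum : ℕ → (ℕ → Carrier) → Carrier
    goodSum n F = ∑ (tuples E n) (λ q → good n q [] ▹ weight q * F (groundLabel q))

    private
      -- Only f enters the argument of `F`: an entry in the back had positive area before its
      -- rotation and is not the grounded one of the original configuration. As f is a suffix of
      -- that configuration, its labels are unchanged.
      splitSum : ℕ → ℕ → ℕ → (ℕ → Carrier) → Carrier
      splitSum n m l F = ∑ (tuples E m) (λ f → ∑ (tuples E l) (λ k →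
        good n f k ▹ weight (f ++ k) * F (groundLabel f)))

      -- One summand of `transfer` without its power of t: l counts the rotations and m is the label
      -- of the removed entry.
      removed : ℕ → ℕ → (ℕ → Carrier) → ℕ → Carrier
      removed l m F r = if l <ᵇ r then z * F (r ∸ l) else F m

      ∑-entries : ∀ f → ∑ E f ≈ ∑ (upTo L) (λ a → f (a , true) + f (a , false))
      ∑-entries f = ≈-trans (∑-product _,_ (upTo L) _ f) (∑-cong (upTo L) λ a → +-congˡ (+-identityʳ _))

      headSum : ℕ → ℕ → ℕ → (ℕ → Carrier) → ℕ → Bool → Carrier
      headSum n m l F a e = ∑ (tuples E m) (λ f → ∑ (tuples E l) (λ k →
        good n ((a , e) ∷ f) k ▹ weight ((a , e) ∷ f ++ k) * F (groundLabel ((a , e) ∷ f))))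

      splitSum-head : ∀ n m l F →
        splitSum n (suc m) l F ≈ ∑ (upTo L) (λ a → headSum n m l F a true + headSum n m l F a false)
      splitSum-head n m l F = ≈-trans (∑-product _∷_ E (tuples E m) _) (∑-entries _)

      headSum-rotated : ∀ n m l F a e → headSum n m l F (suc a) e ≈ t * ∑ (tuples E m) (λ f →
        ∑ (tuples E l) (λ k → good n f (k ++ [ a , e ]) ▹ weight (f ++ k ++ [ a , e ]) * F (groundLabel f)))
      headSum-rotated n m l F a e = ≈-sym (≈-trans (*-∑ t (tuples E m) _) (∑-cong (tuples E m) λ f →
        ≈-trans (*-∑ t (tuples E l) _) (∑-cong (tuples E l) λ k →
        ≈-trans (*-▹ t (good n f (k ++ [ a , e ])) _) (▹-congʳ (good n f (k ++ [ a , e ]))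
          (≈-trans (≈-sym (*-assoc _ _ _)) (*-congʳ (≈-sym (weight-rotate a e f k))))))))

      ∑-headSum-rotated : ∀ n m l F →
        ∑ (upTo L) (λ a → headSum n m l F (suc a) true + headSum n m l F (suc a) false) ≈ t * splitSum n m (suc l) F
      ∑-headSum-rotated n m l F = begin
        ∑ (upTo L) (λ a → headSum n m l F (suc a) true + headSum n m l F (suc a) false)
          ≈⟨ ∑-entries (λ (a , e) → headSum n m l F (suc a) e) ⟨
        ∑ E (λ (a , e) → headSum n m l F (suc a) e)
          ≈⟨ ∑-cong E (λ (a , e) → headSum-rotated n m l F a e) ⟩
        ∑ E (λ x → t * ∑ (tuples E m) (λ f → ∑ (tuples E l) (λ k → term f (k ++ [ x ]))))
          ≈⟨ *-∑ t E _ ⟨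
        t * ∑ E (λ x → ∑ (tuples E m) (λ f → ∑ (tuples E l) (λ k → term f (k ++ [ x ]))))
          ≈⟨ *-congˡ (≈-trans (∑-swap E (tuples E m) _) (∑-cong (tuples E m) λ f →
               ≈-trans (∑-swap E (tuples E l) _) (≈-sym (∑-tuples-∷ʳ E l (term f))))) ⟩
        t * splitSum n m (suc l) F ∎
        where
        term : List Entry → List Entry → Carrier
        term f k = good n f k ▹ weight (f ++ k) * F (groundLabel f)

      headSum-high : ∀ n m l F a e → n ≤ suc a → headSum n m l F (suc a) e ≈ 0#
      headSum-high n m l F a e n≤a = ∑-zero (tuples E m) λ f → ∑-zero (tuples E l) λ k →
        ▹-congˡ (none f k) _
        where
        none : ∀ f k → good n f (k ++ [ a , e ]) ≡ false
        none f k with good n f (k ++ [ a , e ]) in eq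
        ... | false = refl
        ... | true with a< ∷ [] ← All.++⁻ʳ k (proj₂ (good-bound n f (k ++ [ a , e ]) eq)) = contradiction a< (ℕ.≤⇒≯ n≤a)

      -- Every good q = f ++ k arises from exactly one decoration of the removed head. By
      -- `good-merge` a decorated head needs the grounded entry of q in f, and an undecorated head
      -- needs f without one. In the first case the old grounded label is that of q lowered by the
      -- length of k, in the second it is the label of the head.
      headSum-ground : ∀ m l F →
        headSum (suc (m ℕ.+ l)) m l F 0 true + headSum (suc (m ℕ.+ l)) m l F 0 false
          ≈ goodSum (m ℕ.+ l) (removed l (suc m) F)
      headSum-ground m l F = begin
        headSum (suc n) m l F 0 true + headSum (suc n) m l F 0 false
          ≈⟨ ≈-trans (∑-cong (tuples E m) λ f → ∑-+ (tuples E l) _ _) (∑-+ (tuples E m) _ _) ⟨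
        ∑ (tuples E m) (λ f → ∑ (tuples E l) (λ k →
          (parity grounded (f ++ k) ∧ good n f k ▹ (1# * (z * weight (f ++ k))) * F (groundLabel f))
          + (not (anyGrounded f) ∧ good n (f ++ k) [] ▹ (1# * (1# * weight (f ++ k))) * F (suc (length f)))))
          ≈⟨ ∑-cong-All (All.map (λ {f} len-f → ∑-cong-All (All.map (λ {k} len-k → merge f k len-f len-k)
               (tuples-length E l))) (tuples-length E m)) ⟩
        ∑ (tuples E m) (λ f → ∑ (tuples E l) (λ k →
          good n (f ++ k) [] ▹ weight (f ++ k) * removed l (suc m) F (groundLabel (f ++ k))))
          ≈⟨ ∑-tuples-++ E m l (λ q → good n q [] ▹ weight q * removed l (suc m) F (groundLabel q)) ⟨
        goodSum n (removed l (suc m) F) ∎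
        where
        n = m ℕ.+ l
        merge : ∀ f k → length f ≡ m → length k ≡ l →
          (parity grounded (f ++ k) ∧ good n f k ▹ (1# * (z * weight (f ++ k))) * F (groundLabel f))
          + (not (anyGrounded f) ∧ good n (f ++ k) [] ▹ (1# * (1# * weight (f ++ k))) * F (suc (length f)))
          ≈ good n (f ++ k) [] ▹ weight (f ++ k) * removed l (suc m) F (groundLabel (f ++ k))
        merge f k refl refl = ≈-trans (+-congʳ (▹-congˡ (good-merge n f k) _))
          (≈-trans (cases (anyGrounded f) (good n (f ++ k) []) (groundLabel-++ f k))
            (▹-congʳ (good n (f ++ k) []) (*-congˡ (≈-reflexive
              (cong (λ b → if b then z * F (groundLabel (f ++ k) ∸ length k) else F (suc (length f)))
                    (anyGrounded-groundLabel f k))))))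
          where
          cases : ∀ b g → (b ≡ true → groundLabel (f ++ k) ∸ length k ≡ groundLabel f) →
            (b ∧ g ▹ (1# * (z * weight (f ++ k))) * F (groundLabel f))
            + (not b ∧ g ▹ (1# * (1# * weight (f ++ k))) * F (suc (length f)))
            ≈ g ▹ weight (f ++ k) * (if b then z * F (groundLabel (f ++ k) ∸ length k) else F (suc (length f)))
          cases b     false h = ≈-trans (+-cong (▹-congˡ (Bool.∧-zeroʳ b) _) (▹-congˡ (Bool.∧-zeroʳ (not b)) _)) (+-identityˡ _)
          cases true  true  h rewrite h refl = ≈-trans (+-identityʳ _)
            (≈-trans (*-congʳ (≈-trans (*-identityˡ _) (*-comm _ _))) (*-assoc _ _ _))
          cases false true  h = ≈-trans (+-identityˡ _) (*-congʳ (≈-trans (*-identityˡ _) (*-identityˡ _)))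

    splitSum-step : ∀ m l F → suc (m ℕ.+ l) ≤ L →
      splitSum (suc (m ℕ.+ l)) (suc m) l F ≈ goodSum (m ℕ.+ l) (removed l (suc m) F) + t * splitSum (suc (m ℕ.+ l)) m (suc l) F
    splitSum-step m l F n<L = begin
      splitSum n (suc m) l F                ≈⟨ splitSum-head n m l F ⟩
      ∑ (upTo L) H                          ≈⟨ shift L n<L ⟩
      H 0 + ∑ (upTo L) (H ∘ suc)            ≈⟨ +-cong (headSum-ground m l F) (∑-headSum-rotated n m l F) ⟩
      goodSum (m ℕ.+ l) (removed l (suc m) F) + t * splitSum n m (suc l) F ∎
      where
      n = suc (m ℕ.+ l)
      H : ℕ → Carrier
      H a = headSum n m l F a true + headSum n m l F a false
      -- The range of areas may be shifted by one because the additional top area is too large for a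
      -- good configuration.
      shift : ∀ M → n ≤ M → ∑ (upTo M) H ≈ H 0 + ∑ (upTo M) (H ∘ suc)
      shift (suc M) n≤ = ≈-trans (∑-upTo-suc M H) (+-congˡ (≈-sym (≈-trans (∑-upTo-last M (H ∘ suc))
        (≈-trans (+-congˡ (≈-trans (+-cong (headSum-high n m l F M true n≤) (headSum-high n m l F M false n≤)) (+-identityˡ _)))
                 (+-identityʳ _)))))

    splitSum-unroll : ∀ n m l F → m ℕ.+ l ≡ suc n → suc n ≤ L →
      splitSum (suc n) m l F ≈ ∑ (upTo m) (λ c → t ^ c * goodSum n (removed (l ℕ.+ c) (m ∸ c) F))
    -- An empty front with a non-empty back is never good, so the rotations stop before the front is
    -- used up.
    splitSum-unroll n zero    l F refl n≤L = ≈-trans (+-identityʳ _)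
      (≈-trans (∑-product _∷_ E (tuples E n) _)
        (∑-zero E λ x → ∑-0 (tuples E n)))
    splitSum-unroll n (suc m) l F refl n≤L = begin
      splitSum (suc n) (suc m) l F
        ≈⟨ splitSum-step m l F n≤L ⟩
      goodSum n (removed l (suc m) F) + t * splitSum (suc n) m (suc l) F
        ≈⟨ +-cong (≈-trans (≈-sym (*-identityˡ _)) (*-congˡ (≈-reflexive (cong (λ j → goodSum n (removed j (suc m) F)) (sym (ℕ.+-identityʳ l))))))
             (≈-trans (*-congˡ (splitSum-unroll n m (suc l) F (ℕ.+-suc m l) n≤L))
               (≈-trans (*-∑ t (upTo m) _) (∑-cong (upTo m) λ c → ≈-trans (≈-sym (*-assoc _ _ _))
                 (*-congˡ (≈-reflexive (cong (λ j → goodSum n (removed j (m ∸ c) F)) (sym (ℕ.+-suc l c)))))))) ⟩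
      U 0 + ∑ (upTo m) (U ∘ suc)
        ≈⟨ ∑-upTo-suc m U ⟨
      ∑ (upTo (suc m)) U ∎
      where
      U : ℕ → Carrier
      U c = t ^ c * goodSum n (removed (l ℕ.+ c) (suc m ∸ c) F)

    goodSum-suc : ∀ n F → suc n ≤ L → goodSum (suc n) F ≈ goodSum n (transfer n F)
    goodSum-suc n F n<L = begin
      goodSum (suc n) F
        ≈⟨ ∑-cong (tuples E (suc n)) (λ q → ≈-sym (≈-trans (+-identityʳ _)
             (≈-reflexive (cong (λ l → good (suc n) q [] ▹ weight l * F (groundLabel q)) (List.++-identityʳ q))))) ⟩
      splitSum (suc n) (suc n) 0 F
        ≈⟨ splitSum-unroll n (suc n) 0 F (ℕ.+-identityʳ _) n<L ⟩
      ∑ (upTo (suc n)) (λ c → t ^ c * goodSum n (removed c (suc n ∸ c) F))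
        ≈⟨ ∑-cong (upTo (suc n)) (λ c → *-∑ (t ^ c) (tuples E n) _) ⟩
      ∑ (upTo (suc n)) (λ c → ∑ (tuples E n) (λ q →
        t ^ c * (good n q [] ▹ weight q * removed c (suc n ∸ c) F (groundLabel q))))
        ≈⟨ ∑-swap (upTo (suc n)) (tuples E n) _ ⟩
      ∑ (tuples E n) (λ q → ∑ (upTo (suc n)) (λ c →
        t ^ c * (good n q [] ▹ weight q * removed c (suc n ∸ c) F (groundLabel q))))
        ≈⟨ ∑-cong (tuples E n) (λ q → ≈-trans
             (∑-cong (upTo (suc n)) λ c → ≈-trans (*-▹ (t ^ c) (good n q []) _) (▹-congʳ (good n q []) (x∙yz≈y∙xz _ _ _)))
             (≈-trans (≈-sym (▹-∑ (good n q []) (upTo (suc n)) _))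
                      (▹-congʳ (good n q []) (≈-sym (*-∑ (weight q) (upTo (suc n)) _))))) ⟩
      goodSum n (transfer n F) ∎

    goodSum-total : ∀ n F → n ≤ L → goodSum n F ≈ total n F
    goodSum-total zero    F n≤L = ≈-trans (+-identityʳ _) (*-identityˡ _)
    goodSum-total (suc n) F n≤L = ≈-trans (goodSum-suc n F n≤L) (goodSum-total n (transfer n F) (ℕ.<⇒≤ n≤L))

-- Permutations

allFin-suc : ∀ n → allFin (suc n) ≡ Fin.zero ∷ map Fin.suc (allFin n)
allFin-suc n = cong (Fin.zero ∷_) (sym (List.map-tabulate id Fin.suc))

select-map : (f : A → B) (xs : List A) → select (map f xs) ≡ map (λ (y , r) → f y , map f r) (select xs)
select-map f []       = refl
select-map f (x ∷ xs) = cong ((f x , map f xs) ∷_) (trans (cong (map _) (select-map f xs))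
  (trans (sym (List.map-∘ (select xs))) (List.map-∘ (select xs))))

-- Writing the remaining letters as an image of `punchIn x` standardises them, so the recursions
-- stay on arrangements of `allFin n`.
select-allFin : ∀ n → select (allFin (suc n)) ≡ map (λ x → x , map (punchIn x) (allFin n)) (allFin (suc n))
select-allFin zero    = refl
select-allFin (suc n) = begin
  select (allFin (suc (suc n)))
    ≡⟨ cong select (allFin-suc (suc n)) ⟩
  first ∷ map keep (select (map Fin.suc (allFin (suc n))))
    ≡⟨ cong (λ l → first ∷ map keep l) (trans (select-map Fin.suc (allFin (suc n))) (cong (map raise) (select-allFin n))) ⟩
  first ∷ map keep
    (map raise (map (λ x → x , map (punchIn x) (allFin n)) (allFin (suc n))))
    ≡⟨ cong (first ∷_) (trans (sym (List.map-∘ (map (λ x → x , map (punchIn x) (allFin n)) (allFin (suc n)))))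
                              (sym (List.map-∘ (allFin (suc n))))) ⟩
  first
    ∷ map (λ x → Fin.suc x , Fin.zero ∷ map Fin.suc (map (punchIn x) (allFin n))) (allFin (suc n))
    ≡⟨ cong (first ∷_) (trans (List.map-cong (λ x → cong (Fin.suc x ,_) (shift x)) (allFin (suc n))) (List.map-∘ (allFin (suc n)))) ⟩
  map (λ x → x , map (punchIn x) (allFin (suc n))) (Fin.zero ∷ map Fin.suc (allFin (suc n)))
    ≡⟨ cong (map (λ x → x , map (punchIn x) (allFin (suc n)))) (allFin-suc (suc n)) ⟨
  map (λ x → x , map (punchIn x) (allFin (suc n))) (allFin (suc (suc n))) ∎
  where
  open ≡-Reasoning
  first : Fin (suc (suc n)) × List (Fin (suc (suc n)))
  first = Fin.zero , map Fin.suc (allFin (suc n))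
  keep : Fin (suc (suc n)) × List (Fin (suc (suc n))) → Fin (suc (suc n)) × List (Fin (suc (suc n)))
  keep (y , r) = y , Fin.zero ∷ r
  raise : Fin (suc n) × List (Fin (suc n)) → Fin (suc (suc n)) × List (Fin (suc (suc n)))
  raise (y , r) = Fin.suc y , map Fin.suc r
  shift : ∀ x → Fin.zero ∷ map Fin.suc (map (punchIn x) (allFin n)) ≡ map (punchIn (Fin.suc x)) (allFin (suc n))
  shift x = trans (cong (Fin.zero ∷_) (trans (sym (List.map-∘ (allFin n))) (List.map-∘ (allFin n))))
                  (cong (map (punchIn (Fin.suc x))) (sym (allFin-suc n)))

distinct? : ∀ {n} (x y : Fin n) → Dec _
distinct? x y = ¬? (x Fin.≟ y)

fresh : ∀ {n m} → Fin n → Vec (Fin n) m → Bool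
fresh x w = does (VecAll.all? (distinct? x) w)

unique : ∀ {n m} → Vec (Fin n) m → Bool
unique w = does (VecAllPairs.allPairs? distinct? w)

fresh-punchIn : ∀ {n m} (x : Fin (suc n)) (y : Fin n) (w : Vec (Fin n) m) →
                fresh (punchIn x y) (Vec.map (punchIn x) w) ≡ fresh y w
fresh-punchIn x y []      = refl
fresh-punchIn x y (a ∷ w) = cong₂ (λ b c → not b ∧ c)
  (does-⇔ (mk⇔ (Fin.punchIn-injective x y a) (cong (punchIn x))) (punchIn x y Fin.≟ punchIn x a) (y Fin.≟ a))
  (fresh-punchIn x y w)

unique-punchIn : ∀ {n m} (x : Fin (suc n)) (w : Vec (Fin n) m) → unique (Vec.map (punchIn x) w) ≡ unique w
unique-punchIn x []      = refl
unique-punchIn x (y ∷ w) = cong₂ _∧_ (fresh-punchIn x y w) (unique-punchIn x w)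

module PermutationSums (K : CommutativeRing 0ℓ 0ℓ) where
  open CommutativeRing K hiding (zero)
    renaming (refl to ≈-refl; sym to ≈-sym; trans to ≈-trans; reflexive to ≈-reflexive)
  open Sums K
  open SetoidReasoning setoid

  ∑-allFin-suc : ∀ n (f : Fin (suc n) → Carrier) → ∑ (allFin (suc n)) f ≈ f Fin.zero + ∑ (allFin n) (f ∘ Fin.suc)
  ∑-allFin-suc n f = ≈-trans (≈-reflexive (cong (λ l → ∑ l f) (allFin-suc n))) (+-congˡ (∑-map Fin.suc (allFin n) f))

  ∑-allFin-distinct : ∀ {n} (x : Fin (suc n)) (f : Fin (suc n) → Carrier) →
    ∑ (allFin (suc n)) (λ y → does (distinct? x y) ▹ f y) ≈ ∑ (allFin n) (f ∘ punchIn x)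
  ∑-allFin-distinct {n}     Fin.zero    f = ≈-trans (∑-allFin-suc n _) (+-identityˡ _)
  ∑-allFin-distinct {suc n} (Fin.suc x) f = begin
    ∑ (allFin (suc (suc n))) (λ y → does (distinct? (Fin.suc x) y) ▹ f y)
      ≈⟨ ∑-allFin-suc (suc n) _ ⟩
    f Fin.zero + ∑ (allFin (suc n)) (λ y → does (distinct? x y) ▹ f (Fin.suc y))
      ≈⟨ +-congˡ (∑-allFin-distinct x (f ∘ Fin.suc)) ⟩
    f Fin.zero + ∑ (allFin n) (f ∘ Fin.suc ∘ punchIn x)
      ≈⟨ ∑-allFin-suc n (f ∘ punchIn (Fin.suc x)) ⟨
    ∑ (allFin (suc n)) (f ∘ punchIn (Fin.suc x)) ∎

  ∑-words-fresh : ∀ {n} (x : Fin (suc n)) m (f : Vec (Fin (suc n)) m → Carrier) →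
    ∑ (words (suc n) m) (λ w → fresh x w ▹ f w) ≈ ∑ (words n m) (f ∘ Vec.map (punchIn x))
  ∑-words-fresh {n} x zero    f = ≈-refl
  ∑-words-fresh {n} x (suc m) f = begin
    ∑ (words (suc n) (suc m)) (λ w → fresh x w ▹ f w)
      ≈⟨ ∑-product _∷_ (allFin (suc n)) (words (suc n) m) _ ⟩
    ∑ (allFin (suc n)) (λ y → ∑ (words (suc n) m) (λ w → does (distinct? x y) ∧ fresh x w ▹ f (y ∷ w)))
      ≈⟨ ∑-cong (allFin (suc n)) (λ y → ≈-trans
           (≈-trans (∑-cong (words (suc n) m) λ w → ▹-∧ (does (distinct? x y)) (fresh x w) _)
                    (≈-sym (▹-∑ (does (distinct? x y)) (words (suc n) m) _)))
           (▹-congʳ (does (distinct? x y)) (∑-words-fresh x m (f ∘ (y ∷_))))) ⟩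
    ∑ (allFin (suc n)) (λ y → does (distinct? x y) ▹ ∑ (words n m) (λ w → f (y ∷ Vec.map (punchIn x) w)))
      ≈⟨ ∑-allFin-distinct x _ ⟩
    ∑ (allFin n) (λ y → ∑ (words n m) (λ w → f (punchIn x y ∷ Vec.map (punchIn x) w)))
      ≈⟨ ∑-product _∷_ (allFin n) (words n m) _ ⟨
    ∑ (words n (suc m)) (f ∘ Vec.map (punchIn x)) ∎

  ∑-select-allFin : ∀ n (g : Fin (suc n) → List (Fin (suc n)) → Carrier) →
    ∑ (select (allFin (suc n))) (λ (x , r) → ∑ (arrangements r) (g x))
      ≈ ∑ (allFin (suc n)) (λ x → ∑ (arrangements (allFin n)) (g x ∘ map (punchIn x)))
  ∑-select-allFin n g = begin
    ∑ (select (allFin (suc n))) summand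
      ≡⟨ cong (λ l → ∑ l summand) (select-allFin n) ⟩
    ∑ (map (λ x → x , map (punchIn x) (allFin n)) (allFin (suc n))) summand
      ≈⟨ ∑-map (λ x → x , map (punchIn x) (allFin n)) (allFin (suc n)) summand ⟩
    ∑ (allFin (suc n)) (λ x → ∑ (arrangements (map (punchIn x) (allFin n))) (g x))
      ≈⟨ ∑-cong (allFin (suc n)) (λ x → ≈-trans
           (≈-reflexive (cong (λ l → ∑ l (g x)) (arrangements-map (punchIn x) (allFin n))))
           (∑-map (map (punchIn x)) (arrangements (allFin n)) (g x))) ⟩
    ∑ (allFin (suc n)) (λ x → ∑ (arrangements (allFin n)) (g x ∘ map (punchIn x))) ∎
    where
    summand : Fin (suc n) × List (Fin (suc n)) → Carrier
    summand (x , r) = ∑ (arrangements r) (g x)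

  ∑-arrangements-allFin-first : ∀ n (f : List (Fin (suc n)) → Carrier) →
    ∑ (arrangements (allFin (suc n))) f
      ≈ ∑ (allFin (suc n)) (λ x → ∑ (arrangements (allFin n)) (λ v → f (x ∷ map (punchIn x) v)))
  ∑-arrangements-allFin-first n f =
    ≈-trans (∑-arrangements-first Fin.zero (tabulate Fin.suc) f) (∑-select-allFin n (λ x v → f (x ∷ v)))

  ∑-arrangements-allFin-last : ∀ n (f : List (Fin (suc n)) → Carrier) →
    ∑ (arrangements (allFin (suc n))) f
      ≈ ∑ (allFin (suc n)) (λ x → ∑ (arrangements (allFin n)) (λ v → f (map (punchIn x) v ++ [ x ])))
  ∑-arrangements-allFin-last n f =
    ≈-trans (∑-arrangements-last Fin.zero (tabulate Fin.suc) f) (∑-select-allFin n (λ x v → f (v ++ [ x ])))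

  ∑-unique-words : ∀ n (f : List (Fin n) → Carrier) →
    ∑ (words n n) (λ w → unique w ▹ f (toList w)) ≈ ∑ (arrangements (allFin n)) f
  ∑-unique-words zero    f = ≈-refl
  ∑-unique-words (suc n) f = begin
    ∑ (words (suc n) (suc n)) (λ w → unique w ▹ f (toList w))
      ≈⟨ ∑-product _∷_ (allFin (suc n)) (words (suc n) n) _ ⟩
    ∑ (allFin (suc n)) (λ x → ∑ (words (suc n) n) (λ w → fresh x w ∧ unique w ▹ f (x ∷ toList w)))
      ≈⟨ ∑-cong (allFin (suc n)) (λ x → begin
           ∑ (words (suc n) n) (λ w → fresh x w ∧ unique w ▹ f (x ∷ toList w))
             ≈⟨ ∑-cong (words (suc n) n) (λ w → ▹-∧ (fresh x w) (unique w) _) ⟩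
           ∑ (words (suc n) n) (λ w → fresh x w ▹ unique w ▹ f (x ∷ toList w))
             ≈⟨ ∑-words-fresh x n _ ⟩
           ∑ (words n n) (λ w → unique (Vec.map (punchIn x) w) ▹ f (x ∷ toList (Vec.map (punchIn x) w)))
             ≈⟨ ∑-cong (words n n) (λ w → ≈-reflexive (cong₂ (λ b l → b ▹ f (x ∷ l))
                  (unique-punchIn x w) (Vec.toList-map (punchIn x) w))) ⟩
           ∑ (words n n) (λ w → unique w ▹ f (x ∷ map (punchIn x) (toList w)))
             ≈⟨ ∑-unique-words n _ ⟩
           ∑ (arrangements (allFin n)) (λ v → f (x ∷ map (punchIn x) v)) ∎) ⟩
    ∑ (allFin (suc n)) (λ x → ∑ (arrangements (allFin n)) (λ v → f (x ∷ map (punchIn x) v)))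
      ≈⟨ ∑-arrangements-allFin-first n f ⟨
    ∑ (arrangements (allFin (suc n))) f ∎

  ∑-permutations : ∀ n (f : List (Fin n) → Carrier) → ∑ (permutations n) (f ∘ toList) ≈ ∑ (arrangements (allFin n)) f
  ∑-permutations n f = ≈-trans (∑-filter (VecAllPairs.allPairs? distinct?) (words n n) _) (∑-unique-words n f)

-- Monotone letters and 3-inversions of words

countᵇ : (A → Bool) → List A → ℕ
countᵇ f []       = 0
countᵇ f (x ∷ xs) = (if f x then 1 else 0) ℕ.+ countᵇ f xs

count-does : {P : A → Set} (P? : Decidable P) (xs : List A) → count P? xs ≡ countᵇ (does ∘ P?) xs
count-does P? []       = refl
count-does P? (x ∷ xs) with does (P? x)
... | true  = cong suc (count-does P? xs)
... | false = count-does P? xs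

countᵇ-cong : {f g : A → Bool} {xs : List A} → All (λ x → f x ≡ g x) xs → countᵇ f xs ≡ countᵇ g xs
countᵇ-cong []       = refl
countᵇ-cong (e ∷ es) = cong₂ ℕ._+_ (cong (if_then 1 else 0) e) (countᵇ-cong es)

countᵇ-none : {f : A → Bool} {xs : List A} → All (λ x → f x ≡ false) xs → countᵇ f xs ≡ 0
countᵇ-none []       = refl
countᵇ-none (e ∷ es) = cong₂ ℕ._+_ (cong (if_then 1 else 0) e) (countᵇ-none es)

countᵇ-++ : (f : A → Bool) (xs ys : List A) → countᵇ f (xs ++ ys) ≡ countᵇ f xs ℕ.+ countᵇ f ys
countᵇ-++ f []       ys = refl
countᵇ-++ f (x ∷ xs) ys = trans (cong (_ ℕ.+_) (countᵇ-++ f xs ys)) (sym (ℕ.+-assoc (if f x then 1 else 0) _ _))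

countᵇ-map : (f : B → Bool) (g : A → B) (xs : List A) → countᵇ f (map g xs) ≡ countᵇ (f ∘ g) xs
countᵇ-map f g []       = refl
countᵇ-map f g (x ∷ xs) = cong (_ ℕ.+_) (countᵇ-map f g xs)

countᵇ-↭ : (f : A → Bool) {xs ys : List A} → xs ↭ ys → countᵇ f xs ≡ countᵇ f ys
countᵇ-↭ f {xs} {ys} p = trans (as-sum xs) (trans (sum-↭ (Perm.map⁺ _ p)) (sym (as-sum ys)))
  where
  as-sum : ∀ zs → countᵇ f zs ≡ sum (map (λ x → if f x then 1 else 0) zs)
  as-sum []       = refl
  as-sum (z ∷ zs) = cong (_ ℕ.+_) (as-sum zs)

countᵇ-product-∷ʳ : (f : A × B → Bool) (xs : List A) (ys : List B) (y : B) →
  countᵇ f (cartesianProduct xs (ys ++ [ y ])) ≡ countᵇ f (cartesianProduct xs ys) ℕ.+ countᵇ (λ x → f (x , y)) xs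
countᵇ-product-∷ʳ f []       ys y = refl
countᵇ-product-∷ʳ f (x ∷ xs) ys y = begin
  countᵇ f (map (x ,_) (ys ++ [ y ]) ++ cartesianProduct xs (ys ++ [ y ]))
    ≡⟨ countᵇ-++ f (map (x ,_) (ys ++ [ y ])) _ ⟩
  countᵇ f (map (x ,_) (ys ++ [ y ])) ℕ.+ countᵇ f (cartesianProduct xs (ys ++ [ y ]))
    ≡⟨ cong₂ ℕ._+_ (trans (cong (countᵇ f) (List.map-++ (x ,_) ys [ y ]))
                     (trans (countᵇ-++ f (map (x ,_) ys) _) (cong (countᵇ f (map (x ,_) ys) ℕ.+_) (ℕ.+-identityʳ _))))
                   (countᵇ-product-∷ʳ f xs ys y) ⟩
  (countᵇ f (map (x ,_) ys) ℕ.+ bit) ℕ.+ (countᵇ f (cartesianProduct xs ys) ℕ.+ countᵇ (λ x → f (x , y)) xs)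
    ≡⟨ interchange (countᵇ f (map (x ,_) ys)) bit _ _ ⟩
  (countᵇ f (map (x ,_) ys) ℕ.+ countᵇ f (cartesianProduct xs ys)) ℕ.+ (bit ℕ.+ countᵇ (λ x → f (x , y)) xs)
    ≡⟨ cong (ℕ._+ (bit ℕ.+ countᵇ (λ x → f (x , y)) xs)) (countᵇ-++ f (map (x ,_) ys) _) ⟨
  countᵇ f (map (x ,_) ys ++ cartesianProduct xs ys) ℕ.+ (bit ℕ.+ countᵇ (λ x → f (x , y)) xs) ∎
  where
  open ≡-Reasoning
  open CommutativeSemigroupProperties ℕ.+-commutativeSemigroup using (interchange)
  bit : ℕ
  bit = if f (x , y) then 1 else 0

upTo-suc : ∀ n → upTo (suc n) ≡ 0 ∷ map suc (upTo n)
upTo-suc n = cong (0 ∷_) (sym (List.map-upTo suc n))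

countᵇ-upTo-suc : ∀ (f : ℕ → Bool) n → countᵇ f (upTo (suc n)) ≡ (if f 0 then 1 else 0) ℕ.+ countᵇ (f ∘ suc) (upTo n)
countᵇ-upTo-suc f n = trans (cong (countᵇ f) (upTo-suc n)) (cong (_ ℕ.+_) (countᵇ-map f suc (upTo n)))

count-≥ : ∀ n x → countᵇ (λ k → not (k <ᵇ x)) (upTo n) ≡ n ∸ x
count-≥ zero    zero    = refl
count-≥ zero    (suc x) = refl
count-≥ (suc n) zero    = trans (countᵇ-upTo-suc (λ k → not (k <ᵇ 0)) n) (cong suc (count-≥ n zero))
count-≥ (suc n) (suc x) = trans (countᵇ-upTo-suc (λ k → not (k <ᵇ suc x)) n) (count-≥ n x)

count-interval : ∀ n lo hi → hi ≤ n → countᵇ (λ k → not (k <ᵇ lo) ∧ (k <ᵇ hi)) (upTo n) ≡ hi ∸ lo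
count-interval zero    zero     zero     z≤n = refl
count-interval zero    (suc lo) zero     z≤n = refl
count-interval (suc n) lo       zero     z≤n = trans
  (countᵇ-none {xs = upTo (suc n)} (All.tabulate (λ {k} _ → Bool.∧-zeroʳ (not (k <ᵇ lo))))) (sym (ℕ.0∸n≡0 lo))
count-interval (suc n) zero     (suc hi) (s≤s hi≤n) =
  trans (countᵇ-upTo-suc (λ k → not (k <ᵇ 0) ∧ (k <ᵇ suc hi)) n) (cong suc (count-interval n zero hi hi≤n))
count-interval (suc n) (suc lo) (suc hi) (s≤s hi≤n) =
  trans (countᵇ-upTo-suc (λ k → not (k <ᵇ suc lo) ∧ (k <ᵇ suc hi)) n) (count-interval n lo hi hi≤n)

-- As for `letter`, the word is preceded by 0.
letterOf : List ℕ → ℕ → ℕ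
letterOf u       zero          = 0
letterOf []      (suc i)       = 0
letterOf (x ∷ u) (suc zero)    = x
letterOf (x ∷ u) (suc (suc i)) = letterOf u (suc i)

oneLine : ∀ {n} → List (Fin n) → List ℕ
oneLine = map (suc ∘ toℕ)

letter-oneLine : ∀ {n m} (w : Vec (Fin n) m) i → letter w i ≡ letterOf (oneLine (toList w)) i
letter-oneLine w       zero          = refl
letter-oneLine []      (suc i)       = refl
letter-oneLine (x ∷ w) (suc zero)    = refl
letter-oneLine (x ∷ w) (suc (suc i)) = letter-oneLine w (suc i)

letterOf-map : ∀ (f : ℕ → ℕ) u i → f 0 ≡ 0 → letterOf (map f u) i ≡ f (letterOf u i)
letterOf-map f u       zero          f0 = sym f0
letterOf-map f []      (suc i)       f0 = sym f0
letterOf-map f (x ∷ u) (suc zero)    f0 = refl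
letterOf-map f (x ∷ u) (suc (suc i)) f0 = letterOf-map f u (suc i) f0

letterOf-∷ʳ : ∀ u x i → i ≤ length u → letterOf (u ++ [ x ]) i ≡ letterOf u i
letterOf-∷ʳ u       x zero          i≤       = refl
letterOf-∷ʳ (y ∷ u) x (suc zero)    i≤       = refl
letterOf-∷ʳ (y ∷ u) x (suc (suc i)) (s≤s i≤) = letterOf-∷ʳ u x (suc i) i≤

letterOf-last : ∀ u x → letterOf (u ++ [ x ]) (suc (length u)) ≡ x
letterOf-last []      x = refl
letterOf-last (y ∷ u) x = letterOf-last u x

positions : ℕ → List ℕ
positions n = map suc (upTo n)

positions-suc : ∀ n → positions (suc n) ≡ positions n ++ [ suc n ]
positions-suc n = trans (cong (map suc) (sym (List.upTo-∷ʳ n))) (List.map-++ suc (upTo n) [ n ])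

All-positions : ∀ n → All (_≤ n) (positions n)
All-positions n = All.map⁺ (All-upTo n)

letterOf-positions : ∀ u → map (letterOf u) (positions (length u)) ≡ u
letterOf-positions []      = refl
letterOf-positions (x ∷ u) = cong (x ∷_) (begin
  map (letterOf (x ∷ u)) (map suc (applyUpTo suc (length u)))
    ≡⟨ cong (map (letterOf (x ∷ u)) ∘ map suc) (List.map-upTo suc (length u)) ⟨
  map (letterOf (x ∷ u)) (map suc (positions (length u)))
    ≡⟨ trans (sym (List.map-∘ (positions (length u)))) (trans (sym (List.map-∘ (upTo (length u)))) (List.map-∘ (upTo (length u)))) ⟩
  map (letterOf u) (positions (length u))
    ≡⟨ letterOf-positions u ⟩
  u ∎)
  where open ≡-Reasoning

-- Allowing any function s lets words be compared through the order of their letters alone: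
-- standardisation preserves the statistics because it preserves all comparisons.
module Statistics (s : ℕ → ℕ) where
  ascending : ℕ → Bool
  ascending j = s (j ∸ 1) <ᵇ s j

  doubleAscent doubleDescent peak valley monotone : ℕ → Bool
  doubleAscent  j = (1 <ᵇ j) ∧ (s (j ∸ 2) <ᵇ s (j ∸ 1)) ∧ (s (j ∸ 1) <ᵇ s j)
  doubleDescent j = (1 <ᵇ j) ∧ (s (j ∸ 1) <ᵇ s (j ∸ 2)) ∧ (s j <ᵇ s (j ∸ 1))
  peak          j = (1 <ᵇ j) ∧ (s (j ∸ 2) <ᵇ s (j ∸ 1)) ∧ (s j <ᵇ s (j ∸ 1))
  valley        j = (1 <ᵇ j) ∧ (s (j ∸ 1) <ᵇ s (j ∸ 2)) ∧ (s (j ∸ 1) <ᵇ s j)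
  monotone      j = doubleAscent j ∨ doubleDescent j

  inversion : ℕ → ℕ → Bool
  inversion i j = (doubleAscent j ∧ (s (j ∸ 1) <ᵇ s i) ∧ (s i <ᵇ s j))
                ∨ (doubleDescent j ∧ (s i <ᵇ s (j ∸ 1)) ∧ (s j <ᵇ s i))
                ∨ (peak j ∧ (s j <ᵇ s i))
                ∨ (valley j ∧ (s i <ᵇ s j))

  monotones inversions : ℕ → ℕ
  monotones  n = countᵇ monotone (positions n)
  inversions n = countᵇ (λ (i , j) → (i <ᵇ j) ∧ inversion i j) (cartesianProduct (positions n) (positions n))

  -- This is the r of `transfer`.
  state : ℕ → ℕ
  state n = if ascending n then suc n ∸ s n else s n

open Statistics

module _ {s s′ : ℕ → ℕ} {n : ℕ} (same : ∀ i j → i ≤ n → j ≤ n → (s′ i <ᵇ s′ j) ≡ (s i <ᵇ s j)) where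

  private
    pred≤ : ∀ {j} k → j ≤ n → j ∸ k ≤ n
    pred≤ {j} k j≤n = ℕ.≤-trans (ℕ.m∸n≤m j k) j≤n

    both : ∀ j i k i′ k′ → i ≤ n → k ≤ n → i′ ≤ n → k′ ≤ n →
           (1 <ᵇ j) ∧ (s′ i <ᵇ s′ k) ∧ (s′ i′ <ᵇ s′ k′) ≡ (1 <ᵇ j) ∧ (s i <ᵇ s k) ∧ (s i′ <ᵇ s k′)
    both j i k i′ k′ i≤ k≤ i′≤ k′≤ = cong₂ (λ a b → (1 <ᵇ j) ∧ a ∧ b) (same i k i≤ k≤) (same i′ k′ i′≤ k′≤)

  doubleAscent-cong : ∀ j → j ≤ n → doubleAscent s′ j ≡ doubleAscent s j
  doubleAscent-cong j j≤ = both j (j ∸ 2) (j ∸ 1) (j ∸ 1) j (pred≤ 2 j≤) (pred≤ 1 j≤) (pred≤ 1 j≤) j≤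

  doubleDescent-cong : ∀ j → j ≤ n → doubleDescent s′ j ≡ doubleDescent s j
  doubleDescent-cong j j≤ = both j (j ∸ 1) (j ∸ 2) j (j ∸ 1) (pred≤ 1 j≤) (pred≤ 2 j≤) j≤ (pred≤ 1 j≤)

  inversion-cong : ∀ i j → i ≤ n → j ≤ n → inversion s′ i j ≡ inversion s i j
  inversion-cong i j i≤ j≤ = cong₂ _∨_
    (cong₂ _∧_ (doubleAscent-cong j j≤) (cong₂ _∧_ (same (j ∸ 1) i (pred≤ 1 j≤) i≤) (same i j i≤ j≤)))
    (cong₂ _∨_
      (cong₂ _∧_ (doubleDescent-cong j j≤) (cong₂ _∧_ (same i (j ∸ 1) i≤ (pred≤ 1 j≤)) (same j i j≤ i≤)))
      (cong₂ _∨_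
        (cong₂ _∧_ (both j (j ∸ 2) (j ∸ 1) j (j ∸ 1) (pred≤ 2 j≤) (pred≤ 1 j≤) j≤ (pred≤ 1 j≤)) (same j i j≤ i≤))
        (cong₂ _∧_ (both j (j ∸ 1) (j ∸ 2) (j ∸ 1) j (pred≤ 1 j≤) (pred≤ 2 j≤) (pred≤ 1 j≤) j≤) (same i j i≤ j≤))))

  monotones-suc : monotones s′ (suc n) ≡ monotones s n ℕ.+ (if monotone s′ (suc n) then 1 else 0)
  monotones-suc = trans (cong (countᵇ (monotone s′)) (positions-suc n)) (trans (countᵇ-++ (monotone s′) (positions n) _)
    (cong₂ ℕ._+_ (countᵇ-cong (All.map (λ {j} j≤ → cong₂ _∨_ (doubleAscent-cong j j≤) (doubleDescent-cong j j≤)) (All-positions n)))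
                 (ℕ.+-identityʳ _)))

  -- Whether (i, j) is a 3-inversion depends on s at i, j, j - 1 and j - 2 only, so the new position
  -- adds just the pairs in which it is the larger index.
  inversions-suc : inversions s′ (suc n) ≡ inversions s n ℕ.+ countᵇ (λ i → inversion s′ i (suc n)) (positions n)
  inversions-suc = begin
    countᵇ f (cartesianProduct (positions (suc n)) (positions (suc n)))
      ≡⟨ cong (λ l → countᵇ f (cartesianProduct l l)) (positions-suc n) ⟩
    countᵇ f (cartesianProduct (positions n ++ [ suc n ]) (positions n ++ [ suc n ]))
      ≡⟨ countᵇ-product-∷ʳ f (positions n ++ [ suc n ]) (positions n) (suc n) ⟩
    countᵇ f (cartesianProduct (positions n ++ [ suc n ]) (positions n))
      ℕ.+ countᵇ (λ i → f (i , suc n)) (positions n ++ [ suc n ])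
      ≡⟨ cong₂ ℕ._+_ left right ⟩
    inversions s n ℕ.+ countᵇ (λ i → inversion s′ i (suc n)) (positions n) ∎
    where
    open ≡-Reasoning
    f : ℕ × ℕ → Bool
    f (i , j) = (i <ᵇ j) ∧ inversion s′ i j
    left : countᵇ f (cartesianProduct (positions n ++ [ suc n ]) (positions n)) ≡ inversions s n
    left = begin
      countᵇ f (cartesianProduct (positions n ++ [ suc n ]) (positions n))
        ≡⟨ cong (countᵇ f) (List.cartesianProductWith-distribʳ-++ _,_ (positions n) [ suc n ] (positions n)) ⟩
      countᵇ f (cartesianProduct (positions n) (positions n) ++ cartesianProduct [ suc n ] (positions n))
        ≡⟨ countᵇ-++ f (cartesianProduct (positions n) (positions n)) _ ⟩
      countᵇ f (cartesianProduct (positions n) (positions n)) ℕ.+ countᵇ f (cartesianProduct [ suc n ] (positions n))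
        ≡⟨ cong₂ ℕ._+_
             (countᵇ-cong (All.cartesianProduct⁺ (≡-setoid ℕ) (≡-setoid ℕ) (positions n) (positions n) λ {i} {j} i∈ j∈ →
               cong ((i <ᵇ j) ∧_) (inversion-cong i j (All.lookup (All-positions n) i∈) (All.lookup (All-positions n) j∈))))
             (countᵇ-none (All.++⁺ (All.map⁺ (All.map (λ {j} j≤ → cong (_∧ inversion s′ (suc n) j)
               (<ᵇ-false (ℕ.m≤n⇒m≤1+n j≤))) (All-positions n))) [])) ⟩
      inversions s n ℕ.+ 0
        ≡⟨ ℕ.+-identityʳ _ ⟩
      inversions s n ∎
    right : countᵇ (λ i → f (i , suc n)) (positions n ++ [ suc n ]) ≡ countᵇ (λ i → inversion s′ i (suc n)) (positions n)
    right = begin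
      countᵇ (λ i → f (i , suc n)) (positions n ++ [ suc n ])
        ≡⟨ countᵇ-++ (λ i → f (i , suc n)) (positions n) _ ⟩
      countᵇ (λ i → f (i , suc n)) (positions n) ℕ.+ ((if f (suc n , suc n) then 1 else 0) ℕ.+ 0)
        ≡⟨ cong₂ (λ a b → a ℕ.+ ((if b then 1 else 0) ℕ.+ 0))
             (countᵇ-cong (All.map (λ {i} i≤ → cong (_∧ inversion s′ i (suc n)) (<ᵇ-true (s≤s i≤))) (All-positions n)))
             (cong (_∧ inversion s′ (suc n) (suc n)) (<ᵇ-false {suc n} ℕ.≤-refl)) ⟩
      countᵇ (λ i → inversion s′ i (suc n)) (positions n) ℕ.+ 0
        ≡⟨ ℕ.+-identityʳ _ ⟩
      countᵇ (λ i → inversion s′ i (suc n)) (positions n) ∎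

-- The counterpart of `punchIn` on one-line words, undoing standardisation to make room for the
-- letter X. It fixes the initial 0 because X is positive where it is used.
raise : ℕ → ℕ → ℕ
raise X a = if a <ᵇ X then a else suc a

module _ (X : ℕ) where
  raise-<ˡ : ∀ a → (raise X a <ᵇ X) ≡ (a <ᵇ X)
  raise-<ˡ a with a <ᵇ X in eq
  ... | true  = eq
  ... | false = <ᵇ-false (ℕ.m≤n⇒m≤1+n (<ᵇ-false⁻ a X eq))

  raise-<ʳ : ∀ a → (X <ᵇ raise X a) ≡ not (a <ᵇ X)
  raise-<ʳ a with a <ᵇ X in eq
  ... | true  = <ᵇ-false (ℕ.<⇒≤ (<ᵇ-true⁻ a X eq))
  ... | false = <ᵇ-true (s≤s (<ᵇ-false⁻ a X eq))

  raise-< : ∀ a b → (raise X a <ᵇ raise X b) ≡ (a <ᵇ b)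
  raise-< a b with a <ᵇ X in eqᵃ | b <ᵇ X in eqᵇ
  ... | true  | true  = refl
  ... | true  | false = trans (<ᵇ-true (ℕ.m<n⇒m<1+n a<b)) (sym (<ᵇ-true a<b))
    where a<b = ℕ.<-≤-trans (<ᵇ-true⁻ a X eqᵃ) (<ᵇ-false⁻ b X eqᵇ)
  ... | false | true  = trans (<ᵇ-false (ℕ.m≤n⇒m≤1+n b≤a)) (sym (<ᵇ-false b≤a))
    where b≤a = ℕ.<⇒≤ (ℕ.<-≤-trans (<ᵇ-true⁻ b X eqᵇ) (<ᵇ-false⁻ a X eqᵃ))
  ... | false | false = refl

oneLine-punchIn : ∀ {n} (x : Fin (suc n)) (v : List (Fin n)) →
  oneLine (map (punchIn x) v ++ [ x ]) ≡ map (raise (suc (toℕ x))) (oneLine v) ++ [ suc (toℕ x) ]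
oneLine-punchIn x v = trans (List.map-++ (suc ∘ toℕ) (map (punchIn x) v) [ x ])
  (cong (_++ [ suc (toℕ x) ]) (trans (sym (List.map-∘ v)) (trans (List.map-cong (raise-punchIn x) v) (List.map-∘ v))))
  where
  raise-punchIn : ∀ {n} (x : Fin (suc n)) y → suc (toℕ (punchIn x y)) ≡ raise (suc (toℕ x)) (suc (toℕ y))
  raise-punchIn Fin.zero    y           = refl
  raise-punchIn (Fin.suc x) Fin.zero    = refl
  raise-punchIn (Fin.suc x) (Fin.suc y) with toℕ y <ᵇ toℕ x | raise-punchIn x y
  ... | true  | e = cong suc e
  ... | false | e = cong suc e

Unique-∷ʳ : ∀ {w : List ℕ} {y} → Unique (w ++ [ y ]) → All (_≢ y) w
Unique-∷ʳ {[]}    _         = []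
Unique-∷ʳ {x ∷ w} (x≢ ∷ uq) with x≢y ∷ [] ← All.++⁻ʳ w x≢ = x≢y ∷ Unique-∷ʳ uq

-- This ensures that a letter which is not an ascent is a descent. A word of one letter is compared
-- with the initial 0, whence the hypothesis `0 < y`.
penultimate-≢ : ∀ w y → Unique (w ++ [ y ]) → 0 < y → letterOf (w ++ [ y ]) (length w) ≢ y
penultimate-≢ w y uq 0<y with initLast w
... | []       = ℕ.<⇒≢ 0<y
... | w′ ∷ʳ′ z with z≢y ∷ [] ← All.++⁻ʳ w′ (Unique-∷ʳ {w′ ++ [ z ]} uq) = λ eq → z≢y (begin
  z                                                                   ≡⟨ letterOf-last w′ z ⟨
  letterOf (w′ ++ [ z ]) (suc (length w′))                            ≡⟨ cong (letterOf (w′ ++ [ z ])) (length-∷ʳ w′ z) ⟨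
  letterOf (w′ ++ [ z ]) (length (w′ ++ [ z ]))                       ≡⟨ letterOf-∷ʳ (w′ ++ [ z ]) y _ ℕ.≤-refl ⟨
  letterOf ((w′ ++ [ z ]) ++ [ y ]) (length (w′ ++ [ z ]))            ≡⟨ eq ⟩
  y                                                                   ∎)
  where
  open ≡-Reasoning
  length-∷ʳ : ∀ (v : List ℕ) a → length (v ++ [ a ]) ≡ suc (length v)
  length-∷ʳ v a = trans (List.length-++ v) (ℕ.+-comm (length v) 1)

<ᵇ-suc : ∀ m k → (m <ᵇ suc k) ≡ not (k <ᵇ m)
<ᵇ-suc zero    k       = refl
<ᵇ-suc (suc m) zero    = <ᵇ-suc′ m
  where
  <ᵇ-suc′ : ∀ m → (m <ᵇ 0) ≡ false
  <ᵇ-suc′ zero    = refl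
  <ᵇ-suc′ (suc m) = refl
<ᵇ-suc (suc m) (suc k) = <ᵇ-suc m k

-- Whether a letter k makes a 3-inversion with a new last letter X preceded
-- by y, where up and below tell that y is an ascent and that y < X.
newInversion : Bool → Bool → ℕ → ℕ → ℕ → Bool
newInversion up below y X k =
    ((up ∧ below) ∧ (y <ᵇ k) ∧ (k <ᵇ X))
  ∨ ((not up ∧ not below) ∧ (k <ᵇ y) ∧ not (k <ᵇ X))
  ∨ ((up ∧ not below) ∧ not (k <ᵇ X))
  ∨ ((not up ∧ below) ∧ (k <ᵇ X))

-- The new letter is x + 1. The values are the numbers of letters k with y < k ≤ x (double ascent),
-- x < k ≤ n (peak), 1 ≤ k ≤ x (valley) and x < k < y (double descent).
newInversions : ℕ → Bool → Bool → ℕ → ℕ → ℕ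
newInversions n true  true  y x = x ∸ y
newInversions n true  false y x = n ∸ x
newInversions n false true  y x = x
newInversions n false false y x = y ∸ suc x

count-newInversion : ∀ n up below y x → x ≤ n → 0 < y → y ≤ n →
  countᵇ (newInversion up below y (suc x)) (positions n) ≡ newInversions n up below y x
count-newInversion n up below y x x≤n 0<y y≤n =
  trans (countᵇ-map (newInversion up below y (suc x)) suc (upTo n)) (go up below y 0<y y≤n)
  where
  pointwise : ∀ {f g : ℕ → Bool} → (∀ k → f k ≡ g k) → countᵇ f (upTo n) ≡ countᵇ g (upTo n)
  pointwise e = countᵇ-cong {xs = upTo n} (All.tabulate λ {k} _ → e k)
  go : ∀ up below y → 0 < y → y ≤ n →
       countᵇ (λ k → newInversion up below y (suc x) (suc k)) (upTo n) ≡ newInversions n up below y x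
  go true  true  y       0<y y≤n = trans
    (pointwise λ k → trans (Bool.∨-identityʳ _) (cong (_∧ (k <ᵇ x)) (<ᵇ-suc y k))) (count-interval n y x x≤n)
  go true  false y       0<y y≤n = trans (pointwise λ k → Bool.∨-identityʳ _) (count-≥ n x)
  go false true  y       0<y y≤n = count-interval n 0 x x≤n
  go false false (suc y) 0<y y<n = trans
    (pointwise λ k → trans (Bool.∨-identityʳ _) (Bool.∧-comm (k <ᵇ y) (not (k <ᵇ x))))
    (count-interval n x y (ℕ.<⇒≤ y<n))

module _ (u : List ℕ) (X : ℕ) where
  private
    n = length u
    s = letterOf u
    s⁺ = letterOf (map (raise (suc X)) u ++ [ suc X ])

  letterOf-raise : ∀ i → i ≤ n → s⁺ i ≡ raise (suc X) (s i)
  letterOf-raise i i≤n = trans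
    (letterOf-∷ʳ (map (raise (suc X)) u) (suc X) i (subst (i ≤_) (sym (List.length-map _ u)) i≤n))
    (letterOf-map (raise (suc X)) u i refl)

  letterOf-new : s⁺ (suc n) ≡ suc X
  letterOf-new = trans (cong (λ m → s⁺ (suc m)) (sym (List.length-map (raise (suc X)) u)))
                       (letterOf-last (map (raise (suc X)) u) (suc X))

  private
    same : ∀ i j → i ≤ n → j ≤ n → (s⁺ i <ᵇ s⁺ j) ≡ (s i <ᵇ s j)
    same i j i≤ j≤ = trans (cong₂ _<ᵇ_ (letterOf-raise i i≤) (letterOf-raise j j≤)) (raise-< (suc X) (s i) (s j))

    below : ∀ i → i ≤ n → (s⁺ i <ᵇ s⁺ (suc n)) ≡ (s i <ᵇ suc X)
    below i i≤ = trans (cong₂ _<ᵇ_ (letterOf-raise i i≤) letterOf-new) (raise-<ˡ (suc X) (s i))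

    above : ∀ i → i ≤ n → (s⁺ (suc n) <ᵇ s⁺ i) ≡ not (s i <ᵇ suc X)
    above i i≤ = trans (cong₂ _<ᵇ_ letterOf-new (letterOf-raise i i≤)) (raise-<ʳ (suc X) (s i))

  state-raise : state s⁺ (suc n) ≡ (if s n <ᵇ suc X then suc n ∸ X else suc X)
  state-raise = cong₂ (λ b a → if b then suc (suc n) ∸ a else a) (below n ℕ.≤-refl) letterOf-new

  module _ (m : ℕ) (n≡ : n ≡ suc m) (u↭ : u ↭ positions n) (dir : (s n <ᵇ s (n ∸ 1)) ≡ not (s (n ∸ 1) <ᵇ s n))
           (X≤n : X ≤ n) where
    private
      up = s (n ∸ 1) <ᵇ s n
      b = s n <ᵇ suc X
      2≤ : (1 <ᵇ suc n) ≡ true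
      2≤ = cong (λ l → 1 <ᵇ suc l) n≡
      n-1≤ : n ∸ 1 ≤ n
      n-1≤ = ℕ.m∸n≤m n 1
      1≤n : 1 ≤ n
      1≤n = subst (1 ≤_) (sym n≡) (s≤s z≤n)
      last∈ : 0 < s n × s n ≤ n
      last∈ = All.lookup (All-resp-↭ {P = λ k → 0 < k × k ≤ n} (↭-sym u↭) (All.zip (All.map⁺ (All.tabulate (λ _ → s≤s z≤n)) , All-positions n)))
                (subst (s n ∈_) (letterOf-positions u) (∈-map⁺ s (subst (_∈ positions n) (suc-pred n 1≤n)
                  (∈-map⁺ suc (∈-upTo⁺ (subst (_≤ n) (sym (suc-pred n 1≤n)) ℕ.≤-refl))))))
        where
        suc-pred : ∀ n → 1 ≤ n → suc (n ∸ 1) ≡ n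
        suc-pred (suc n) _ = refl
      up⁺ : (s⁺ (suc n ∸ 2) <ᵇ s⁺ (suc n ∸ 1)) ≡ up
      up⁺ = same (n ∸ 1) n n-1≤ ℕ.≤-refl
      down⁺ : (s⁺ (suc n ∸ 1) <ᵇ s⁺ (suc n ∸ 2)) ≡ not up
      down⁺ = trans (same n (n ∸ 1) ℕ.≤-refl n-1≤) dir

      case : ∀ {p q p′ q′} → p ≡ p′ → q ≡ q′ → (1 <ᵇ suc n) ∧ p ∧ q ≡ p′ ∧ q′
      case {p} {q} refl refl = cong (_∧ p ∧ q) 2≤

    monotone-raise : monotone s⁺ (suc n) ≡ (up ∧ b) ∨ (not up ∧ not b)
    monotone-raise = cong₂ _∨_ (case up⁺ (below n ℕ.≤-refl)) (case down⁺ (above n ℕ.≤-refl))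

    monotones-raise : monotones s⁺ (suc n) ≡ monotones s n ℕ.+ (if (up ∧ b) ∨ (not up ∧ not b) then 1 else 0)
    monotones-raise = trans (monotones-suc {s} {s⁺} {n} same) (cong (λ c → monotones s n ℕ.+ (if c then 1 else 0)) monotone-raise)

    -- For the new last letter only the values of the earlier letters matter, not their order, and
    -- these values run through 1, ..., n. So the count over positions becomes the size of an
    -- interval.
    inversions-raise : inversions s⁺ (suc n) ≡ inversions s n ℕ.+ newInversions n up b (s n) X
    inversions-raise = trans (inversions-suc {s} {s⁺} {n} same) (cong (inversions s n ℕ.+_) (begin
      countᵇ (λ i → inversion s⁺ i (suc n)) (positions n)
        ≡⟨ countᵇ-cong (All.map (λ {i} i≤ → cong₂ _∨_
             (cong₂ _∧_ (case up⁺ (below n ℕ.≤-refl)) (cong₂ _∧_ (same n i ℕ.≤-refl i≤) (below i i≤)))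
             (cong₂ _∨_
               (cong₂ _∧_ (case down⁺ (above n ℕ.≤-refl)) (cong₂ _∧_ (same i n i≤ ℕ.≤-refl) (above i i≤)))
               (cong₂ _∨_
                 (cong₂ _∧_ (case up⁺ (above n ℕ.≤-refl)) (above i i≤))
                 (cong₂ _∧_ (case down⁺ (below n ℕ.≤-refl)) (below i i≤))))) (All-positions n)) ⟩
      countᵇ (newInversion up b (s n) (suc X) ∘ s) (positions n)
        ≡⟨ countᵇ-map (newInversion up b (s n) (suc X)) s (positions n) ⟨
      countᵇ (newInversion up b (s n) (suc X)) (map s (positions n))
        ≡⟨ cong (countᵇ (newInversion up b (s n) (suc X))) (letterOf-positions u) ⟩
      countᵇ (newInversion up b (s n) (suc X)) u
        ≡⟨ countᵇ-↭ (newInversion up b (s n) (suc X)) u↭ ⟩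
      countᵇ (newInversion up b (s n) (suc X)) (positions n)
        ≡⟨ count-newInversion n up b (s n) X X≤n (proj₁ last∈) (proj₂ last∈) ⟩
      newInversions n up b (s n) X ∎))
      where open ≡-Reasoning

-- The recursion on permutations

module PermutationTransfer (K : CommutativeRing 0ℓ 0ℓ) (t z : CommutativeRing.Carrier K) where
  open CommutativeRing K hiding (zero)
    renaming (refl to ≈-refl; sym to ≈-sym; trans to ≈-trans; reflexive to ≈-reflexive)
  open CommutativeSemigroupProperties *-commutativeSemigroup using (x∙yz≈y∙xz)
  open SemiringExp semiring using (_^_; ^-homo-*; ^-congʳ)
  open Sums K
  open UpTo K
  open PermutationSums K
  open Transfer K t z
  open SetoidReasoning setoid

  private
    lastLetterTerm : (ℕ → Carrier) → ℕ → Bool → ℕ → Bool → ℕ → Carrier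
    lastLetterTerm F n up y below x = t ^ newInversions n up below y x
      * ((if (up ∧ below) ∨ (not up ∧ not below) then z else 1#) * F (if below then suc n ∸ x else suc x))

    -- Sending x to the number c of new 3-inversions is a bijection of 0, ..., n. After a descent, r
    -- = y: a double descent x < y has c = y - x - 1, and a valley x ≥ y has c = x. After an ascent,
    -- r = n + 1 - y: a double ascent x ≥ y has c = x - y, and a peak x < y has c = n - x. In both
    -- cases c < r says that the new letter is monotone, and the new state is r - c or n + 1 - c as
    -- in `transfer`.
    ∑-lastLetterTerm : ∀ F n up y → y ≤ n →
      ∑ (upTo (suc n)) (λ x → lastLetterTerm F n up y (y <ᵇ suc x) x) ≈ transfer n F (if up then suc n ∸ y else y)
    ∑-lastLetterTerm F n false y y≤n = begin
      ∑ (upTo (suc n)) (λ x → lastLetterTerm F n false y (y <ᵇ suc x) x)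
        ≈⟨ ∑-cong (upTo (suc n)) (λ x → ≈-trans (≈-reflexive (cong (λ b → lastLetterTerm F n false y b x) (<ᵇ-suc y x))) (split x (x <ᵇ y))) ⟩
      ∑ (upTo (suc n)) (λ x → if x <ᵇ y then t ^ (y ∸ suc x) * (z * F (suc x)) else t ^ x * F (suc n ∸ x))
        ≈⟨ ∑-upTo-split y (suc n) _ _ y≤ ⟩
      ∑ (upTo y) (λ x → t ^ (y ∸ suc x) * (z * F (suc x))) + ∑ (upTo (suc n ∸ y)) (λ i → t ^ (y ℕ.+ i) * F (suc n ∸ (y ℕ.+ i)))
        ≈⟨ +-congʳ (≈-sym (≈-trans (∑-upTo-reverse y _) (∑-cong-upTo y λ x x<y →
             ≈-reflexive (cong (λ k → t ^ (y ∸ suc x) * (z * F k)) (ℕ.m∸[m∸n]≡n x<y))))) ⟩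
      ∑ (upTo y) (λ c → t ^ c * (z * F (y ∸ c))) + ∑ (upTo (suc n ∸ y)) (λ i → t ^ (y ℕ.+ i) * F (suc n ∸ (y ℕ.+ i)))
        ≈⟨ ∑-upTo-split y (suc n) _ _ y≤ ⟨
      ∑ (upTo (suc n)) (λ c → if c <ᵇ y then t ^ c * (z * F (y ∸ c)) else t ^ c * F (suc n ∸ c))
        ≈⟨ ∑-cong (upTo (suc n)) (λ c → ≈-reflexive (sym (Bool.if-float (t ^ c *_) (c <ᵇ y)))) ⟩
      transfer n F y ∎
      where
      y≤ : y ≤ suc n
      y≤ = ℕ.m≤n⇒m≤1+n y≤n
      split : ∀ x c → lastLetterTerm F n false y (not c) x ≈ (if c then t ^ (y ∸ suc x) * (z * F (suc x)) else t ^ x * F (suc n ∸ x))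
      split x true  = ≈-refl
      split x false = *-congˡ (*-identityˡ _)
    ∑-lastLetterTerm F n true y y≤n = begin
      ∑ (upTo (suc n)) (λ x → lastLetterTerm F n true y (y <ᵇ suc x) x)
        ≈⟨ ∑-cong (upTo (suc n)) (λ x → ≈-trans (≈-reflexive (cong (λ b → lastLetterTerm F n true y b x) (<ᵇ-suc y x))) (split x (x <ᵇ y))) ⟩
      ∑ (upTo (suc n)) (λ x → if x <ᵇ y then t ^ (n ∸ x) * F (suc x) else t ^ (x ∸ y) * (z * F (suc n ∸ x)))
        ≈⟨ ∑-upTo-split y (suc n) _ _ y≤ ⟩
      ∑ (upTo y) (λ x → t ^ (n ∸ x) * F (suc x)) + ∑ (upTo r) (λ i → t ^ (y ℕ.+ i ∸ y) * (z * F (suc n ∸ (y ℕ.+ i))))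
        ≈⟨ +-cong low (∑-cong (upTo r) λ i → ≈-reflexive
             (cong₂ (λ a k → t ^ a * (z * F k)) (ℕ.m+n∸m≡n y i) (sym (ℕ.∸-+-assoc (suc n) y i)))) ⟩
      ∑ (upTo y) (λ i → t ^ (r ℕ.+ i) * F (suc n ∸ (r ℕ.+ i))) + ∑ (upTo r) (λ c → t ^ c * (z * F (r ∸ c)))
        ≈⟨ +-comm _ _ ⟩
      ∑ (upTo r) (λ c → t ^ c * (z * F (r ∸ c))) + ∑ (upTo y) (λ i → t ^ (r ℕ.+ i) * F (suc n ∸ (r ℕ.+ i)))
        ≡⟨ cong (λ k → ∑ (upTo r) (λ c → t ^ c * (z * F (r ∸ c))) + ∑ (upTo k) (λ i → t ^ (r ℕ.+ i) * F (suc n ∸ (r ℕ.+ i))))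
             (ℕ.m∸[m∸n]≡n y≤) ⟨
      ∑ (upTo r) (λ c → t ^ c * (z * F (r ∸ c))) + ∑ (upTo (suc n ∸ r)) (λ i → t ^ (r ℕ.+ i) * F (suc n ∸ (r ℕ.+ i)))
        ≈⟨ ∑-upTo-split r (suc n) _ _ (ℕ.m∸n≤m (suc n) y) ⟨
      ∑ (upTo (suc n)) (λ c → if c <ᵇ r then t ^ c * (z * F (r ∸ c)) else t ^ c * F (suc n ∸ c))
        ≈⟨ ∑-cong (upTo (suc n)) (λ c → ≈-reflexive (sym (Bool.if-float (t ^ c *_) (c <ᵇ r)))) ⟩
      transfer n F r ∎
      where
      r = suc n ∸ y
      y≤ : y ≤ suc n
      y≤ = ℕ.m≤n⇒m≤1+n y≤n
      split : ∀ x c → lastLetterTerm F n true y (not c) x ≈ (if c then t ^ (n ∸ x) * F (suc x) else t ^ (x ∸ y) * (z * F (suc n ∸ x)))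
      split x true  = *-congˡ (*-identityˡ _)
      split x false = ≈-refl
      reflected : ∀ x → x < y → r ℕ.+ (y ∸ suc x) ≡ n ∸ x
      reflected x x<y = trans (sym (ℕ.+-∸-assoc r x<y)) (cong (_∸ suc x) (ℕ.m∸n+n≡m y≤))
      low : ∑ (upTo y) (λ x → t ^ (n ∸ x) * F (suc x)) ≈ ∑ (upTo y) (λ i → t ^ (r ℕ.+ i) * F (suc n ∸ (r ℕ.+ i)))
      low = ≈-sym (≈-trans (∑-upTo-reverse y _) (∑-cong-upTo y λ x x<y → ≈-reflexive (cong₂ (λ a k → t ^ a * F k)
        (reflected x x<y) (trans (cong (suc n ∸_) (reflected x x<y)) (ℕ.m∸[m∸n]≡n {suc n} {suc x} (ℕ.≤-trans x<y y≤))))))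

  wordWeight : (ℕ → Carrier) → ℕ → (ℕ → ℕ) → Carrier
  wordWeight F n s = t ^ inversions s n * (z ^ monotones s n * F (state s n))

  private
    extended : List ℕ → ℕ → ℕ → ℕ
    extended u x = letterOf (map (raise (suc x)) u ++ [ suc x ])

    pow-if : ∀ m c → z ^ (m ℕ.+ (if c then 1 else 0)) ≈ z ^ m * (if c then z else 1#)
    pow-if m true  = ≈-trans (^-homo-* z m 1) (*-congˡ (*-identityʳ z))
    pow-if m false = ≈-trans (^-homo-* z m 0) ≈-refl

    ∑-extended : ∀ F u → u ↭ positions (length u) →
      ∑ (upTo (suc (length u))) (λ x → wordWeight F (suc (length u)) (extended u x))
        ≈ wordWeight (transfer (length u) F) (length u) (letterOf u)
    ∑-extended F u u↭ with initLast u
    -- The first letter of a permutation is neither an ascent nor a descent in the sense of the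
    -- statistics. Both sides reduce to `F 1`.
    ... | []       = ≈-trans (+-identityʳ _) (*-congˡ (*-congˡ (≈-sym (≈-trans (+-identityʳ _) (*-identityˡ _)))))
    ... | w ∷ʳ′ y = begin
      ∑ (upTo (suc n)) (λ x → wordWeight F (suc n) (extended (w ++ [ y ]) x))
        ≈⟨ ∑-cong-upTo (suc n) (λ x x<n → extend x (ℕ.≤-pred x<n)) ⟩
      ∑ (upTo (suc n)) (λ x → t ^ inversions s n * (z ^ monotones s n * lastLetterTerm F n up (s n) (s n <ᵇ suc x) x))
        ≈⟨ ≈-trans (*-congˡ (*-∑ (z ^ monotones s n) (upTo (suc n)) _)) (*-∑ (t ^ inversions s n) (upTo (suc n)) _) ⟨
      t ^ inversions s n * (z ^ monotones s n * ∑ (upTo (suc n)) (λ x → lastLetterTerm F n up (s n) (s n <ᵇ suc x) x))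
        ≈⟨ *-congˡ (*-congˡ (∑-lastLetterTerm F n up (s n) sn≤n)) ⟩
      wordWeight (transfer n F) n s ∎
      where
      n = length (w ++ [ y ])
      s = letterOf (w ++ [ y ])
      up = s (n ∸ 1) <ᵇ s n
      n≡ : n ≡ suc (length w)
      n≡ = trans (List.length-++ w) (ℕ.+-comm (length w) 1)
      sn≡y : s n ≡ y
      sn≡y = trans (cong s n≡) (letterOf-last w y)
      y∈ : 0 < y × y ≤ n
      y∈ with b ∷ [] ← All.++⁻ʳ w (All-resp-↭ {P = λ k → 0 < k × k ≤ n} (↭-sym u↭)
                         (All.zip (All.map⁺ (All.tabulate (λ _ → s≤s z≤n)) , All-positions n))) = b
      sn≤n : s n ≤ n
      sn≤n = subst (_≤ n) (sym sn≡y) (proj₂ y∈)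
      distinctLetters : Unique (w ++ [ y ])
      distinctLetters = SetoidPerm.Unique-resp-↭ (≡-setoid ℕ) (↭⇒↭ₛ (↭-sym u↭)) (Unique.map⁺ ℕ.suc-injective (Unique.upTo⁺ n))
      dir : (s n <ᵇ s (n ∸ 1)) ≡ not (s (n ∸ 1) <ᵇ s n)
      dir with ℕ.<-cmp (s (n ∸ 1)) (s n)
      ... | tri< a<b _ _ = trans (<ᵇ-false (ℕ.<⇒≤ a<b)) (cong not (sym (<ᵇ-true a<b)))
      ... | tri≈ _ a≡b _ = contradiction (trans (cong (λ k → s (k ∸ 1)) (sym n≡)) (trans a≡b sn≡y)) (penultimate-≢ w y distinctLetters (proj₁ y∈))
      ... | tri> _ _ b<a = trans (<ᵇ-true b<a) (cong not (sym (<ᵇ-false (ℕ.<⇒≤ b<a))))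
      extend : ∀ x → x ≤ n → wordWeight F (suc n) (extended (w ++ [ y ]) x)
               ≈ t ^ inversions s n * (z ^ monotones s n * lastLetterTerm F n up (s n) (s n <ᵇ suc x) x)
      extend x x≤n = begin
        wordWeight F (suc n) (extended (w ++ [ y ]) x)
          ≈⟨ *-cong (≈-trans (^-congʳ t (inversions-raise (w ++ [ y ]) x (length w) n≡ u↭ dir x≤n)) (^-homo-* t (inversions s n) Δ))
               (*-cong (≈-trans (^-congʳ z (monotones-raise (w ++ [ y ]) x (length w) n≡ u↭ dir x≤n)) (pow-if (monotones s n) c))
                 (≈-reflexive (cong F (state-raise (w ++ [ y ]) x)))) ⟩
        (t ^ inversions s n * t ^ Δ) * ((z ^ monotones s n * (if c then z else 1#)) * F r)
          ≈⟨ *-assoc _ _ _ ⟩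
        t ^ inversions s n * (t ^ Δ * ((z ^ monotones s n * (if c then z else 1#)) * F r))
          ≈⟨ *-congˡ (≈-trans (*-congˡ (*-assoc _ _ _)) (x∙yz≈y∙xz _ _ _)) ⟩
        t ^ inversions s n * (z ^ monotones s n * (t ^ Δ * ((if c then z else 1#) * F r))) ∎
        where
        b = s n <ᵇ suc x
        Δ = newInversions n up b (s n) x
        c = (up ∧ b) ∨ (not up ∧ not b)
        r = if b then suc n ∸ x else suc x

  ∑-allFin-toℕ : ∀ n (f : ℕ → Carrier) → ∑ (allFin n) (f ∘ toℕ) ≈ ∑ (upTo n) f
  ∑-allFin-toℕ zero    f = ≈-refl
  ∑-allFin-toℕ (suc n) f = ≈-trans (∑-allFin-suc n (f ∘ toℕ))
    (≈-trans (+-congˡ (∑-allFin-toℕ n (f ∘ suc))) (≈-sym (∑-upTo-suc n f)))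

  oneLine-allFin : ∀ n → oneLine (allFin n) ≡ positions n
  oneLine-allFin zero    = refl
  oneLine-allFin (suc n) = trans (cong oneLine (allFin-suc n)) (cong (1 ∷_) (trans
    (trans (sym (List.map-∘ (allFin n))) (trans (List.map-∘ (allFin n)) (cong (map suc) (oneLine-allFin n))))
    (cong (map suc) (List.map-upTo suc n))))

  ∑-arrangements-total : ∀ n F → ∑ (arrangements (allFin n)) (λ v → wordWeight F n (letterOf (oneLine v))) ≈ total n F
  ∑-arrangements-total zero    F = ≈-trans (+-identityʳ _) (≈-trans (*-identityˡ _) (*-identityˡ _))
  ∑-arrangements-total (suc n) F = begin
    ∑ (arrangements (allFin (suc n))) (λ v → wordWeight F (suc n) (letterOf (oneLine v)))
      ≈⟨ ∑-arrangements-allFin-last n _ ⟩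
    ∑ (allFin (suc n)) (λ x → ∑ (arrangements (allFin n)) (λ v →
      wordWeight F (suc n) (letterOf (oneLine (map (punchIn x) v ++ [ x ])))))
      ≈⟨ ∑-swap (allFin (suc n)) (arrangements (allFin n)) _ ⟩
    ∑ (arrangements (allFin n)) (λ v → ∑ (allFin (suc n)) (λ x →
      wordWeight F (suc n) (letterOf (oneLine (map (punchIn x) v ++ [ x ])))))
      ≈⟨ ∑-cong-All (All.map (λ {v} v↭ → lastLetters v v↭) (arrangements-↭ (allFin n))) ⟩
    ∑ (arrangements (allFin n)) (λ v → wordWeight (transfer n F) n (letterOf (oneLine v)))
      ≈⟨ ∑-arrangements-total n (transfer n F) ⟩
    total n (transfer n F) ∎
    where
    lastLetters : ∀ v → v ↭ allFin n →
      ∑ (allFin (suc n)) (λ x → wordWeight F (suc n) (letterOf (oneLine (map (punchIn x) v ++ [ x ]))))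
        ≈ wordWeight (transfer n F) n (letterOf (oneLine v))
    lastLetters v v↭ = begin
      ∑ (allFin (suc n)) (λ x → wordWeight F (suc n) (letterOf (oneLine (map (punchIn x) v ++ [ x ]))))
        ≈⟨ ∑-cong (allFin (suc n)) (λ x → ≈-reflexive (cong (λ l → wordWeight F (suc n) (letterOf l)) (oneLine-punchIn x v))) ⟩
      ∑ (allFin (suc n)) (λ x → wordWeight F (suc n) (extended (oneLine v) (toℕ x)))
        ≈⟨ ∑-allFin-toℕ (suc n) (λ x → wordWeight F (suc n) (extended (oneLine v) x)) ⟩
      ∑ (upTo (suc n)) (λ x → wordWeight F (suc n) (extended (oneLine v) x))
        ≡⟨ cong (λ m → ∑ (upTo (suc m)) (λ x → wordWeight F (suc m) (extended (oneLine v) x))) length≡ ⟨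
      ∑ (upTo (suc (length (oneLine v)))) (λ x → wordWeight F (suc (length (oneLine v))) (extended (oneLine v) x))
        ≈⟨ ∑-extended F (oneLine v) (subst (λ m → oneLine v ↭ positions m) (sym length≡) oneLine↭) ⟩
      wordWeight (transfer (length (oneLine v)) F) (length (oneLine v)) (letterOf (oneLine v))
        ≡⟨ cong (λ m → wordWeight (transfer m F) m (letterOf (oneLine v))) length≡ ⟩
      wordWeight (transfer n F) n (letterOf (oneLine v)) ∎
      where
      oneLine↭ : oneLine v ↭ positions n
      oneLine↭ = subst (oneLine v ↭_) (oneLine-allFin n) (Perm.map⁺ (suc ∘ toℕ) v↭)
      length≡ : length (oneLine v) ≡ n
      length≡ = trans (Perm.↭-length oneLine↭) (trans (List.length-map suc (upTo n)) (List.length-upTo n))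

  ∑-permutations-total : ∀ n → ∑ (permutations n) (λ σ → t ^ inv₃ σ * z ^ monot σ) ≈ total n (λ _ → 1#)
  ∑-permutations-total n = begin
    ∑ (permutations n) (λ σ → t ^ inv₃ σ * z ^ monot σ)
      ≈⟨ ∑-cong (permutations n) (λ σ → ≈-trans (*-congˡ (≈-sym (*-identityʳ _)))
           (≈-reflexive (cong₂ (λ a b → t ^ a * (z ^ b * 1#)) (inv₃-oneLine σ) (monot-oneLine σ)))) ⟩
    ∑ (permutations n) (λ σ → wordWeight (λ _ → 1#) n (letterOf (oneLine (toList σ))))
      ≈⟨ ∑-permutations n (λ v → wordWeight (λ _ → 1#) n (letterOf (oneLine v))) ⟩
    ∑ (arrangements (allFin n)) (λ v → wordWeight (λ _ → 1#) n (letterOf (oneLine v)))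
      ≈⟨ ∑-arrangements-total n (λ _ → 1#) ⟩
    total n (λ _ → 1#) ∎
    where
    module _ (σ : Vec (Fin n) n) where
      private
        same : ∀ i j → (letter σ i <ᵇ letter σ j) ≡ (letterOf (oneLine (toList σ)) i <ᵇ letterOf (oneLine (toList σ)) j)
        same i j = cong₂ _<ᵇ_ (letter-oneLine σ i) (letter-oneLine σ j)

      inv₃-oneLine : inv₃ σ ≡ inversions (letterOf (oneLine (toList σ))) n
      inv₃-oneLine = trans (count-does _ (cartesianProduct (positions n) (positions n)))
        (countᵇ-cong {xs = cartesianProduct (positions n) (positions n)} (All.tabulate λ {(i , j)} _ →
          cong ((i <ᵇ j) ∧_) (inversion-cong {letterOf (oneLine (toList σ))} {letter σ} {i ℕ.+ j} (λ i j _ _ → same i j) i j (ℕ.m≤m+n i j) (ℕ.m≤n+m j i))))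

      monot-oneLine : monot σ ≡ monotones (letterOf (oneLine (toList σ))) n
      monot-oneLine = trans (count-does _ (positions n))
        (countᵇ-cong {xs = positions n} (All.tabulate λ {j} _ →
          cong₂ _∨_ (doubleAscent-cong {letterOf (oneLine (toList σ))} {letter σ} {j} (λ i j _ _ → same i j) j ℕ.≤-refl)
                    (doubleDescent-cong {letterOf (oneLine (toList σ))} {letter σ} {j} (λ i j _ _ → same i j) j ℕ.≤-refl)))

-- Decorated labelled Dyck paths

module LetterOrder (n : ℕ) where
  N = suc n
  open Words N

  place : Fin n → ℕ → ℕ
  place x a = (n ∸ toℕ x) ℕ.+ a ℕ.* N

  private
    lower : ∀ {v a v′ a′} → v ≤ n → a < a′ → v ℕ.+ a ℕ.* N < v′ ℕ.+ a′ ℕ.* N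
    lower {v} {a} {v′} {a′} v≤n a<a′ =
      ℕ.<-≤-trans (ℕ.+-monoˡ-< (a ℕ.* N) (s≤s v≤n)) (ℕ.≤-trans (ℕ.*-monoˡ-≤ N a<a′) (ℕ.m≤n+m _ v′))

    reversed : ∀ {x y : Fin n} → x Fin.< y → n ∸ toℕ y < n ∸ toℕ x
    reversed {x} {y} x<y = ℕ.∸-monoʳ-< x<y (ℕ.<⇒≤ (Fin.toℕ<n y))

    reversed⁻ : ∀ {x y : Fin n} → n ∸ toℕ y < n ∸ toℕ x → x Fin.< y
    reversed⁻ {x} {y} lt with ℕ.<-cmp (toℕ x) (toℕ y)
    ... | tri< x<y _ _ = x<y
    ... | tri≈ _ x≡y _ = contradiction lt (ℕ.<-irrefl (cong (n ∸_) (sym x≡y)))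
    ... | tri> _ _ y<x = contradiction lt (ℕ.<⇒≯ (reversed y<x))

  place-< : ∀ {x a y b} → a < b ⊎ a ≡ b × y Fin.< x → place x a < place y b
  place-< {x} (inj₁ a<b)              = lower (ℕ.m∸n≤m n (toℕ x)) a<b
  place-< {x} {a} (inj₂ (refl , y<x)) = ℕ.+-monoˡ-< (a ℕ.* N) (reversed y<x)

  place-<⁻ : ∀ {x a y b} → place x a < place y b → a < b ⊎ a ≡ b × y Fin.< x
  place-<⁻ {x} {a} {y} {b} lt with ℕ.<-cmp a b
  ... | tri< a<b _ _  = inj₁ a<b
  ... | tri≈ _ refl _ = inj₂ (refl , reversed⁻ (ℕ.+-cancelʳ-< (a ℕ.* N) _ _ lt))
  ... | tri> _ _ b<a  = contradiction lt (ℕ.<⇒≯ (lower (ℕ.m∸n≤m n (toℕ y)) b<a))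

  place-+N : ∀ x a → place x a ℕ.+ N ≡ place x (suc a)
  place-+N x a = trans (ℕ.+-assoc (n ∸ toℕ x) (a ℕ.* N) N) (cong ((n ∸ toℕ x) ℕ.+_) (ℕ.+-comm (a ℕ.* N) N))

  place-<N : ∀ x → place x 0 < N
  place-<N x = s≤s (ℕ.≤-trans (ℕ.≤-reflexive (ℕ.+-identityʳ _)) (ℕ.m∸n≤m n (toℕ x)))

  letters : ∀ {m} → Vec ℕ m → Vec (Fin n) m → Vec Bool m → List Letter
  letters []       []       []       = []
  letters (a ∷ as) (x ∷ xs) (e ∷ es) = (place x a , e) ∷ letters as xs es

  Falls : ℕ → Fin n → ℕ → Fin n → Set
  Falls a x b y = a > b ⊎ a ≡ b × x Fin.< y

  -- The preceding step has area a and label x.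
  Legal : ∀ {m} → ℕ → Fin n → Vec ℕ m → Vec (Fin n) m → Vec Bool m → Set
  Legal a x []       []       []       = ⊤
  Legal a x (b ∷ bs) (y ∷ ys) (e ∷ es) =
    (b ≤ suc a × (b ≡ suc a → x Fin.< y)) × (e ≡ true → Falls a x b y) × Legal b y bs ys es

  private
    not-∨⁺ : ∀ e {b} → (e ≡ true → b ≡ true) → not e ∨ b ≡ true
    not-∨⁺ true  f = f refl
    not-∨⁺ false f = refl

    not-∨⁻ : ∀ e {b} → not e ∨ b ≡ true → e ≡ true → b ≡ true
    not-∨⁻ true eq _ = eq

    ∧⁺ : ∀ {b c} → b ≡ true → c ≡ true → b ∧ c ≡ true
    ∧⁺ refl refl = refl

    ∧⁻ : ∀ b {c} → b ∧ c ≡ true → b ≡ true × c ≡ true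
    ∧⁻ true eq = refl , eq

    flip-≡ : ∀ {a b : ℕ} {P Q : Set} → Q ⊎ a ≡ b × P → Q ⊎ b ≡ a × P
    flip-≡ (inj₁ q)        = inj₁ q
    flip-≡ (inj₂ (eq , p)) = inj₂ (sym eq , p)

  Legal⇒continues : ∀ {m} a x (bs : Vec ℕ m) ys es → Legal a x bs ys es → continues (place x a) (letters bs ys es) ≡ true
  Legal⇒continues a x []       []       []       _                     = refl
  Legal⇒continues a x (b ∷ bs) (y ∷ ys) (e ∷ es) ((b≤ , up) , fall , l) = ∧⁺
    (<ᵇ-true (subst (place y b <_) (sym (place-+N x a)) (place-< near)))
    (∧⁺ (not-∨⁺ e λ e≡ → <ᵇ-true (place-< (flip-≡ (fall e≡)))) (Legal⇒continues b y bs ys es l))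
    where
    near : b < suc a ⊎ b ≡ suc a × x Fin.< y
    near with ℕ.m≤n⇒m<n∨m≡n b≤
    ... | inj₁ b< = inj₁ b<
    ... | inj₂ b≡ = inj₂ (b≡ , up b≡)

  continues⇒Legal : ∀ {m} a x (bs : Vec ℕ m) ys es → continues (place x a) (letters bs ys es) ≡ true → Legal a x bs ys es
  continues⇒Legal a x []       []       []       _  = tt
  continues⇒Legal a x (b ∷ bs) (y ∷ ys) (e ∷ es) eq
    with near , eq′ ← ∧⁻ (place y b <ᵇ place x a ℕ.+ N) eq
    with fall , eq″ ← ∧⁻ (not e ∨ (place y b <ᵇ place x a)) eq′ =
      close (place-<⁻ (subst (place y b <_) (place-+N x a) (<ᵇ-true⁻ _ _ near)))
    , (λ e≡ → flip-≡ (place-<⁻ {y} {b} {x} {a} (<ᵇ-true⁻ (place y b) (place x a) (not-∨⁻ e fall e≡))))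
    , continues⇒Legal b y bs ys es eq″
    where
    close : b < suc a ⊎ b ≡ suc a × x Fin.< y → b ≤ suc a × (b ≡ suc a → x Fin.< y)
    close (inj₁ b<)         = ℕ.<⇒≤ b< , λ b≡ → contradiction b< (ℕ.<-irrefl b≡)
    close (inj₂ (b≡ , x<y)) = ℕ.≤-reflexive b≡ , λ _ → x<y

  private
    Increasing : ∀ {m} → Vec ℕ m → Vec (Fin n) m → Set
    Increasing cs w = ∀ i j → i Fin.< j → lookup cs i ≡ lookup cs j → lookup w i Fin.< lookup w j

    Rises : ∀ {m} → ℕ → Fin n → Vec ℕ m → Vec (Fin n) m → Set
    Rises a x []       []       = ⊤
    Rises a x (b ∷ bs) (y ∷ ys) = (b ≤ suc a × (b ≡ suc a → x Fin.< y)) × Rises b y bs ys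

    columns-≥ : ∀ {m d} c (π : Dyck m d) j → c ≤ lookup (columns c π) j
    columns-≥ c (north π) Fin.zero    = ℕ.≤-refl
    columns-≥ c (north π) (Fin.suc j) = columns-≥ c π j
    columns-≥ c (east π)  j           = ℕ.≤-trans (ℕ.n≤1+n c) (columns-≥ (suc c) π j)

    -- The preceding step is in column c₀ ≤ c, and c₀ = c means that π
    -- continues at its upper end.
    Increasing⇒Rises : ∀ {m d} c₀ a₀ x c (π : Dyck m d) w → c₀ ℕ.+ suc a₀ ≡ c ℕ.+ d → c₀ ≤ c →
      (∀ j → lookup (columns c π) j ≡ c₀ → x Fin.< lookup w j) → Increasing (columns c π) w → Rises a₀ x (areaWord π) w
    Increasing⇒Rises c₀ a₀ x c end               []      e c₀≤c f inc = tt
    Increasing⇒Rises c₀ a₀ x c (east {d = d} π)  w       e c₀≤c f inc =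
      Increasing⇒Rises c₀ a₀ x (suc c) π w (trans e (ℕ.+-suc c d)) (ℕ.m≤n⇒m≤1+n c₀≤c) f inc
    Increasing⇒Rises c₀ a₀ x c (north {d = d} π) (y ∷ w) e c₀≤c f inc =
      -- By `e` the path is still at the height where the preceding step ended. Hence d exceeds a₀
      -- by at most 1, and by exactly 1 if and only if no east step lies between.
      (ℕ.+-cancelˡ-≤ c₀ d (suc a₀) (ℕ.≤-trans (ℕ.+-monoˡ-≤ d c₀≤c) (ℕ.≤-reflexive (sym e)))
        , λ d≡ → f Fin.zero (ℕ.+-cancelʳ-≡ d c c₀ (sym (trans (cong (c₀ ℕ.+_) d≡) e))))
      , Increasing⇒Rises c d y c π w refl ℕ.≤-refl
          (λ j eq → inc Fin.zero (Fin.suc j) (s≤s z≤n) (sym eq))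
          (λ i j i<j eq → inc (Fin.suc i) (Fin.suc j) (s≤s i<j) eq)

    -- The steps of a column are consecutive, so inequalities between neighbours chain to all pairs.
    -- Since columns never decrease, a later step in column c₀ forces every step before it to be
    -- there as well.
    Rises⇒Increasing : ∀ {m d} c₀ a₀ x c (π : Dyck m d) w → c₀ ℕ.+ suc a₀ ≡ c ℕ.+ d → c₀ ≤ c →
      Rises a₀ x (areaWord π) w → (∀ j → lookup (columns c π) j ≡ c₀ → x Fin.< lookup w j) × Increasing (columns c π) w
    Rises⇒Increasing c₀ a₀ x c end               []      e c₀≤c r = (λ ()) , λ ()
    Rises⇒Increasing c₀ a₀ x c (east {d = d} π)  w       e c₀≤c r =
      Rises⇒Increasing c₀ a₀ x (suc c) π w (trans e (ℕ.+-suc c d)) (ℕ.m≤n⇒m≤1+n c₀≤c) r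
    Rises⇒Increasing c₀ a₀ x c (north {d = d} π) (y ∷ w) e c₀≤c ((_ , up) , r)
      with f , inc ← Rises⇒Increasing c d y c π w refl ℕ.≤-refl r = f′ , inc′
      where
      at : c ≡ c₀ → x Fin.< y
      at refl = up (ℕ.+-cancelˡ-≡ c d (suc a₀) (sym e))
      f′ : ∀ j → lookup (c ∷ columns c π) j ≡ c₀ → x Fin.< lookup (y ∷ w) j
      f′ Fin.zero    eq = at eq
      f′ (Fin.suc j) eq = ℕ.<-trans (at c≡) (f j (trans eq (sym c≡)))
        where c≡ = ℕ.≤-antisym (ℕ.≤-trans (columns-≥ c π j) (ℕ.≤-reflexive eq)) c₀≤c
      inc′ : Increasing (c ∷ columns c π) (y ∷ w)
      inc′ Fin.zero    (Fin.suc j) _         eq = f j (sym eq)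
      inc′ (Fin.suc i) (Fin.suc j) (s≤s i<j) eq = inc i j i<j eq

    Contractible : ∀ {m} → Vec ℕ m → Vec (Fin n) m → Fin m → Set
    Contractible as w i = ∃[ i⁻ ] toℕ i ≡ suc (toℕ i⁻) × Falls (lookup as i⁻) (lookup w i⁻) (lookup as i) (lookup w i)

    FallsAt : ∀ {m} → ℕ → Fin n → Vec ℕ m → Vec (Fin n) m → Vec Bool m → Set
    FallsAt a x []       []       []       = ⊤
    FallsAt a x (b ∷ bs) (y ∷ ys) (e ∷ es) = (e ≡ true → Falls a x b y) × FallsAt b y bs ys es

    Contractible⇒FallsAt : ∀ {m} a x (bs : Vec ℕ m) ys es →
      (∀ i → lookup es i ≡ true → Contractible (a ∷ bs) (x ∷ ys) (Fin.suc i)) → FallsAt a x bs ys es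
    Contractible⇒FallsAt a x []       []       []       f = tt
    Contractible⇒FallsAt a x (b ∷ bs) (y ∷ ys) (e ∷ es) f = first , Contractible⇒FallsAt b y bs ys es next
      where
      first : e ≡ true → Falls a x b y
      first e≡ with f Fin.zero e≡
      ... | Fin.zero , _ , fall = fall
      next : ∀ i → lookup es i ≡ true → Contractible (b ∷ bs) (y ∷ ys) (Fin.suc i)
      next i e≡ with f (Fin.suc i) e≡
      ... | Fin.suc i⁻ , eq , fall = i⁻ , ℕ.suc-injective eq , fall

    FallsAt⇒Contractible : ∀ {m} a x (bs : Vec ℕ m) ys es → FallsAt a x bs ys es →
      ∀ i → lookup es i ≡ true → Contractible (a ∷ bs) (x ∷ ys) (Fin.suc i)
    FallsAt⇒Contractible a x (b ∷ bs) (y ∷ ys) (e ∷ es) (fall , r) Fin.zero    e≡ = Fin.zero , refl , fall e≡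
    FallsAt⇒Contractible a x (b ∷ bs) (y ∷ ys) (e ∷ es) (fall , r) (Fin.suc i) e≡
      with i⁻ , eq , fall′ ← FallsAt⇒Contractible b y bs ys es r i e≡ = Fin.suc i⁻ , cong suc eq , fall′

    combine : ∀ {m} a x (bs : Vec ℕ m) ys es → Rises a x bs ys → FallsAt a x bs ys es → Legal a x bs ys es
    combine a x []       []       []       _       _       = tt
    combine a x (b ∷ bs) (y ∷ ys) (e ∷ es) (u , r) (f , l) = u , f , combine b y bs ys es r l

    separate : ∀ {m} a x (bs : Vec ℕ m) ys es → Legal a x bs ys es → Rises a x bs ys × FallsAt a x bs ys es
    separate a x []       []       []       _           = tt , tt
    separate a x (b ∷ bs) (y ∷ ys) (e ∷ es) (u , f , l) with r , l′ ← separate b y bs ys es l = (u , r) , (f , l′)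

  ColumnsIncrease : ∀ {m} → DyckPath m → Vec (Fin n) m → Set
  ColumnsIncrease π w = ∀ i j → i Fin.< j → lookup (columns 0 π) i ≡ lookup (columns 0 π) j → lookup w i Fin.< lookup w j

  ValleysContract : ∀ {m} → DyckPath m → Vec (Fin n) m → Subset m → Set
  ValleysContract π w dv = ∀ i → i ∈ˢ dv → ∃[ i⁻ ] toℕ i ≡ suc (toℕ i⁻)
    × Falls (lookup (areaWord π) i⁻) (lookup w i⁻) (lookup (areaWord π) i) (lookup w i)

  legal⇒starts : ∀ {m} (π : DyckPath m) w dv → ColumnsIncrease π w → ValleysContract π w dv →
                 starts N (letters (areaWord π) w dv) ≡ true
  legal⇒starts end       []      []           inc con = refl
  legal⇒starts (north π) (x ∷ w) (true ∷ dv)  inc con with con Fin.zero here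
  ... | _ , () , _
  legal⇒starts (north π) (x ∷ w) (false ∷ dv) inc con = ∧⁺ (<ᵇ-true (place-<N x))
    (Legal⇒continues 0 x (areaWord π) w dv (combine 0 x (areaWord π) w dv
      (Increasing⇒Rises 0 0 x 0 π w refl z≤n (λ j eq → inc Fin.zero (Fin.suc j) (s≤s z≤n) (sym eq))
        (λ i j i<j → inc (Fin.suc i) (Fin.suc j) (s≤s i<j)))
      (Contractible⇒FallsAt 0 x (areaWord π) w dv λ i e≡ → con (Fin.suc i) (there (Vec.lookup⇒[]= i dv e≡)))))

  starts⇒legal : ∀ {m} (π : DyckPath m) w dv → starts N (letters (areaWord π) w dv) ≡ true →
                 ColumnsIncrease π w × ValleysContract π w dv
  starts⇒legal end       []      []           eq = (λ ()) , λ ()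
  starts⇒legal (north π) (x ∷ w) (false ∷ dv) eq
    with r , f ← separate 0 x (areaWord π) w dv
           (continues⇒Legal 0 x (areaWord π) w dv (proj₂ (∧⁻ (place x 0 <ᵇ N) eq)))
    with below , inc ← Rises⇒Increasing 0 0 x 0 π w refl z≤n r = inc′ , con
    where
    inc′ : ColumnsIncrease (north π) (x ∷ w)
    inc′ Fin.zero    (Fin.suc j) _         eq = below j (sym eq)
    inc′ (Fin.suc i) (Fin.suc j) (s≤s i<j) eq = inc i j i<j eq
    con : ValleysContract (north π) (x ∷ w) (false ∷ dv)
    con (Fin.suc i) (there i∈) = FallsAt⇒Contractible 0 x (areaWord π) w dv f i (Vec.[]=⇒lookup i∈)

-- The parity of `dinv`

odd-+ : ∀ m n → odd (m ℕ.+ n) ≡ odd m xor odd n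
odd-+ zero    n = refl
odd-+ (suc m) n = trans (cong not (odd-+ m n)) (Bool.not-distribˡ-xor (odd m) (odd n))

-- The number of decorations may exceed the number of inversions, so the parity of `dinv` is taken
-- of its absolute value.
odd-∣⊖∣ : ∀ m k → odd ℤ.∣ m ℤ.⊖ k ∣ ≡ odd m xor odd k
odd-∣⊖∣ zero    zero    = refl
odd-∣⊖∣ zero    (suc k) = refl
odd-∣⊖∣ (suc m) zero    = sym (Bool.xor-identityʳ _)
odd-∣⊖∣ (suc m) (suc k) = trans (cong (odd ∘ ℤ.∣_∣) (ℤ.[1+m]⊖[1+n]≡m⊖n m k)) (trans (odd-∣⊖∣ m k) (not-not (odd m) (odd k)))
  where
  not-not : ∀ a b → a xor b ≡ not a xor not b
  not-not true  b = refl
  not-not false b = sym (Bool.not-involutive b)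

odd-countᵇ : (f : A → Bool) (xs : List A) → odd (countᵇ f xs) ≡ parity f xs
odd-countᵇ f []       = refl
odd-countᵇ f (x ∷ xs) with f x
... | true  = cong not (odd-countᵇ f xs)
... | false = odd-countᵇ f xs

parity-cong : {f g : A → Bool} → (∀ x → f x ≡ g x) → ∀ xs → parity f xs ≡ parity g xs
parity-cong e []       = refl
parity-cong e (x ∷ xs) = cong₂ _xor_ (e x) (parity-cong e xs)

parity-∘ : (f : B → Bool) (g : A → B) (xs : List A) → parity f (map g xs) ≡ parity (f ∘ g) xs
parity-∘ f g []       = refl
parity-∘ f g (x ∷ xs) = cong (f (g x) xor_) (parity-∘ f g xs)

parity-++ : (f : A → Bool) (xs ys : List A) → parity f (xs ++ ys) ≡ parity f xs xor parity f ys
parity-++ f []       ys = refl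
parity-++ f (x ∷ xs) ys = trans (cong (f x xor_) (parity-++ f xs ys)) (sym (Bool.xor-assoc (f x) _ _))

xor-interchange : ∀ a b c d → (a xor b) xor (c xor d) ≡ (a xor c) xor (b xor d)
xor-interchange a b c d = trans (Bool.xor-assoc a b _)
  (trans (cong (a xor_) (xor-exchange b c d)) (sym (Bool.xor-assoc a c _)))

parity-xor : (f g : A → Bool) (xs : List A) → parity f xs xor parity g xs ≡ parity (λ x → f x xor g x) xs
parity-xor f g []       = refl
parity-xor f g (x ∷ xs) = trans (xor-interchange (f x) (parity f xs) (g x) (parity g xs)) (cong ((f x xor g x) xor_) (parity-xor f g xs))

parity-product : (f : A × B → Bool) (xs : List A) (ys : List B) →
                 parity f (cartesianProduct xs ys) ≡ parity (λ x → parity (λ y → f (x , y)) ys) xs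
parity-product f []       ys = refl
parity-product f (x ∷ xs) ys = trans (parity-++ f (map (x ,_) ys) _)
  (cong₂ _xor_ (parity-∘ f (x ,_) ys) (parity-product f xs ys))

parity-allFin-suc : ∀ {m} (f : Fin (suc m) → Bool) → parity f (allFin (suc m)) ≡ f Fin.zero xor parity (f ∘ Fin.suc) (allFin m)
parity-allFin-suc {m} f = trans (cong (parity f) (allFin-suc m)) (cong (f Fin.zero xor_) (parity-∘ f Fin.suc (allFin m)))

module DinvParity (n : ℕ) where
  open LetterOrder n
  open Words N

  private
    letterAt : ∀ {m} → Vec ℕ m → Vec (Fin n) m → Vec Bool m → Fin m → Letter
    letterAt as xs es i = place (lookup xs i) (lookup as i) , lookup es i

    invertedAt : ∀ {m} → Vec ℕ m → Vec (Fin n) m → Vec Bool m → Fin m × Fin m → Bool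
    invertedAt as xs es (i , j) = (toℕ i <ᵇ toℕ j) ∧ not (lookup es i) ∧ inverted (proj₁ (letterAt as xs es i)) (letterAt as xs es j)

    parity-letters : ∀ {m} (f : Letter → Bool) (as : Vec ℕ m) xs es →
                     parity (f ∘ letterAt as xs es) (allFin m) ≡ parity f (letters as xs es)
    parity-letters f []       []       []       = refl
    parity-letters f (a ∷ as) (x ∷ xs) (e ∷ es) =
      trans (parity-allFin-suc (f ∘ letterAt (a ∷ as) (x ∷ xs) (e ∷ es))) (cong (f (place x a , e) xor_) (parity-letters f as xs es))

    parity-invertedAt : ∀ {m} (as : Vec ℕ m) xs es →
      parity (invertedAt as xs es) (cartesianProduct (allFin m) (allFin m)) xor odd ∣ es ∣ ≡ dinvParity (letters as xs es)
    parity-invertedAt []       []       []       = refl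
    parity-invertedAt {suc m} (a ∷ as) (x ∷ xs) (e ∷ es) = begin
      parity f (cartesianProduct (allFin (suc m)) (allFin (suc m))) xor odd ∣ e ∷ es ∣
        ≡⟨ cong₂ _xor_ (trans (parity-product f (allFin (suc m)) (allFin (suc m)))
             (parity-allFin-suc (λ i → parity (λ j → f (i , j)) (allFin (suc m))))) (decorations e) ⟩
      (parity (λ j → f (Fin.zero , j)) (allFin (suc m)) xor parity (λ i → parity (λ j → f (Fin.suc i , j)) (allFin (suc m))) (allFin m))
        xor (e xor odd ∣ es ∣)
        ≡⟨ cong₂ (λ b c → (b xor c) xor (e xor odd ∣ es ∣))
             (trans (parity-allFin-suc (λ j → f (Fin.zero , j))) (row e))
             (trans (parity-cong (λ i → parity-allFin-suc (λ j → f (Fin.suc i , j))) (allFin m))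
                    (sym (parity-product (invertedAt as xs es) (allFin m) (allFin m)))) ⟩
      ((not e ∧ near) xor rest) xor (e xor odd ∣ es ∣)
        ≡⟨ regroup e near ⟩
      (if e then true else near) xor (rest xor odd ∣ es ∣)
        ≡⟨ cong ((if e then true else near) xor_) (parity-invertedAt as xs es) ⟩
      dinvParity (letters (a ∷ as) (x ∷ xs) (e ∷ es)) ∎
      where
      open ≡-Reasoning
      f = invertedAt (a ∷ as) (x ∷ xs) (e ∷ es)
      near = parity (inverted (place x a)) (letters as xs es)
      rest = parity (invertedAt as xs es) (cartesianProduct (allFin m) (allFin m))
      decorations : ∀ e → odd ∣ e ∷ es ∣ ≡ e xor odd ∣ es ∣
      decorations true  = refl
      decorations false = refl
      row : ∀ e → parity (λ j → not e ∧ inverted (place x a) (letterAt as xs es j)) (allFin m) ≡ not e ∧ near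
      row true  = parity-false (λ _ → false) {allFin m} (All.tabulate λ _ → refl)
      row false = parity-letters (inverted (place x a)) as xs es
      regroup : ∀ e near → ((not e ∧ near) xor rest) xor (e xor odd ∣ es ∣) ≡ (if e then true else near) xor (rest xor odd ∣ es ∣)
      regroup true  near = sym (Bool.not-distribʳ-xor rest _)
      regroup false near = Bool.xor-assoc near rest _

    -- Primary and secondary inversions exclude each other because the areas differ by 0 and 1. Thus
    -- the sum of their parities is the parity of the pairs that are `inverted`.
    xor-does : {P Q : Set} (P? : Dec P) (Q? : Dec Q) {b : Bool} → (P → ¬ Q) →
               (P ⊎ Q → b ≡ true) → (b ≡ true → P ⊎ Q) → does P? xor does Q? ≡ b
    xor-does (yes p) (yes q) P⇒¬Q to from = contradiction q (P⇒¬Q p)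
    xor-does (yes p) (no _)  P⇒¬Q to from = sym (to (inj₁ p))
    xor-does (no _)  (yes q) P⇒¬Q to from = sym (to (inj₂ q))
    xor-does (no ¬p) (no ¬q) {false} P⇒¬Q to from = refl
    xor-does (no ¬p) (no ¬q) {true}  P⇒¬Q to from with from refl
    ... | inj₁ p = contradiction p ¬p
    ... | inj₂ q = contradiction q ¬q

    inverted⁺ : ∀ {a x b y e} → a ≡ b × x Fin.< y ⊎ a ≡ suc b × y Fin.< x → inverted (place x a) (place y b , e) ≡ true
    inverted⁺ {a} {x} {b} {y} (inj₁ (refl , x<y)) = cong₂ _∧_
      (<ᵇ-true (place-< {y} {a} {x} {a} (inj₂ (refl , x<y))))
      (<ᵇ-true (subst (place x a <_) (sym (place-+N y a)) (place-< {x} {a} {y} {suc a} (inj₁ ℕ.≤-refl))))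
    inverted⁺ {a} {x} {b} {y} (inj₂ (refl , y<x)) = cong₂ _∧_
      (<ᵇ-true (place-< {y} {b} {x} {suc b} (inj₁ ℕ.≤-refl)))
      (<ᵇ-true (subst (place x (suc b) <_) (sym (place-+N y b)) (place-< {x} {suc b} {y} {suc b} (inj₂ (refl , y<x)))))

    inverted⁻ : ∀ {a x b y e} → inverted (place x a) (place y b , e) ≡ true → a ≡ b × x Fin.< y ⊎ a ≡ suc b × y Fin.< x
    inverted⁻ {a} {x} {b} {y} eq with place y b <ᵇ place x a in below
    ... | true = go (place-<⁻ {y} {b} {x} {a} (<ᵇ-true⁻ _ _ below))
                    (place-<⁻ {x} {a} {y} {suc b} (subst (place x a <_) (place-+N y b) (<ᵇ-true⁻ _ _ eq)))
      where
      go : b < a ⊎ b ≡ a × x Fin.< y → a < suc b ⊎ a ≡ suc b × y Fin.< x → a ≡ b × x Fin.< y ⊎ a ≡ suc b × y Fin.< x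
      go (inj₂ (b≡a , x<y)) _          = inj₁ (sym b≡a , x<y)
      go (inj₁ b<a)         (inj₂ q)   = inj₂ q
      go (inj₁ b<a)         (inj₁ a≤b) = contradiction b<a (ℕ.≤⇒≯ (ℕ.≤-pred a≤b))

  odd-dinv : ∀ π w dv → odd ℤ.∣ DecoratedPath.dinv (decorated π w dv) ∣ ≡ dinvParity (letters (areaWord π) w dv)
  odd-dinv π w dv = begin
    odd ℤ.∣ + (c₁ ℕ.+ c₂) ℤ.- + ∣ dv ∣ ∣
      ≡⟨ cong (odd ∘ ℤ.∣_∣) (ℤ.m-n≡m⊖n (c₁ ℕ.+ c₂) ∣ dv ∣) ⟩
    odd ℤ.∣ (c₁ ℕ.+ c₂) ℤ.⊖ ∣ dv ∣ ∣
      ≡⟨ odd-∣⊖∣ (c₁ ℕ.+ c₂) ∣ dv ∣ ⟩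
    odd (c₁ ℕ.+ c₂) xor odd ∣ dv ∣
      ≡⟨ cong (_xor odd ∣ dv ∣) (trans (odd-+ c₁ c₂) (cong₂ _xor_ (odd-count primaryInversion?) (odd-count secondaryInversion?))) ⟩
    (parity (does ∘ primaryInversion?) pairs xor parity (does ∘ secondaryInversion?) pairs) xor odd ∣ dv ∣
      ≡⟨ cong (_xor odd ∣ dv ∣) (trans (parity-xor (does ∘ primaryInversion?) (does ∘ secondaryInversion?) pairs) (parity-cong exclusive pairs)) ⟩
    parity (invertedAt (areaWord π) w dv) pairs xor odd ∣ dv ∣
      ≡⟨ parity-invertedAt (areaWord π) w dv ⟩
    dinvParity (letters (areaWord π) w dv) ∎
    where
    open ≡-Reasoning
    open DecoratedPath (decorated π w dv) using (primaryInversion?; secondaryInversion?; PrimaryInversion; SecondaryInversion)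
    pairs = cartesianProduct (allFin n) (allFin n)
    c₁ = count primaryInversion? pairs
    c₂ = count secondaryInversion? pairs
    odd-count : {P : Fin n × Fin n → Set} (P? : Decidable P) → odd (count P? pairs) ≡ parity (does ∘ P?) pairs
    odd-count P? = trans (cong odd (count-does P? pairs)) (odd-countᵇ _ pairs)
    exclusive : ∀ ij → does (primaryInversion? ij) xor does (secondaryInversion? ij) ≡ invertedAt (areaWord π) w dv ij
    exclusive (i , j) = xor-does (primaryInversion? (i , j)) (secondaryInversion? (i , j))
      (λ (_ , a≡ , _) (_ , a≡suc , _) → contradiction (trans (sym a≡) a≡suc) (ℕ.<⇒≢ ℕ.≤-refl)) to from
      where
      undecorated : i ∉ˢ dv → not (lookup dv i) ≡ true
      undecorated i∉ with lookup dv i in eq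
      ... | true  = contradiction (Vec.lookup⇒[]= i dv eq) i∉
      ... | false = refl
      to : PrimaryInversion (i , j) ⊎ SecondaryInversion (i , j) → invertedAt (areaWord π) w dv (i , j) ≡ true
      to (inj₁ (i<j , a≡ , w< , i∉)) = cong₂ _∧_ (<ᵇ-true i<j) (cong₂ _∧_ (undecorated i∉) (inverted⁺ {e = lookup dv j} (inj₁ (a≡ , w<))))
      to (inj₂ (i<j , a≡ , w> , i∉)) = cong₂ _∧_ (<ᵇ-true i<j) (cong₂ _∧_ (undecorated i∉) (inverted⁺ {e = lookup dv j} (inj₂ (a≡ , w>))))
      from : invertedAt (areaWord π) w dv (i , j) ≡ true → PrimaryInversion (i , j) ⊎ SecondaryInversion (i , j)
      from eq with toℕ i <ᵇ toℕ j in i<j | lookup dv i in eᵢ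
      ... | true | false with inverted⁻ {e = lookup dv j} eq
      ...   | inj₁ (a≡ , w<) = inj₁ (<ᵇ-true⁻ _ _ i<j , a≡ , w< , i∉)
        where i∉ = λ i∈ → contradiction (trans (sym eᵢ) (Vec.[]=⇒lookup i∈)) λ ()
      ...   | inj₂ (a≡ , w>) = inj₂ (<ᵇ-true⁻ _ _ i<j , a≡ , w> , i∉)
        where i∉ = λ i∈ → contradiction (trans (sym eᵢ) (Vec.[]=⇒lookup i∈)) λ ()

-- Sums over paths, labels and decorations

vectors : List A → ∀ m → List (Vec A m)
vectors xs zero    = [ [] ]
vectors xs (suc m) = cartesianProductWith _∷_ xs (vectors xs m)

isDyck : ∀ {m} → ℕ → Vec ℕ m → Bool
isDyck d []       = true
isDyck d (a ∷ as) = (a <ᵇ suc d) ∧ isDyck (suc a) as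

zipEntries : ∀ {m} → Vec ℕ m → Vec Bool m → List Entry
zipEntries as es = toList (Vec.zip as es)

-- Increasing bases are decreasing labels; this reordering is the reason why configurations list the
-- largest label first.
positions-↭ : ∀ n → map (λ x → n ∸ toℕ x) (allFin n) ↭ positions n
positions-↭ zero    = _↭_.refl
positions-↭ (suc n) = ↭-trans (↭-reflexive (cong (suc n ∷_) (trans (cong (map (λ x → suc n ∸ toℕ x)) (sym (List.map-tabulate id Fin.suc)))
  (sym (List.map-∘ (allFin n)))))) (↭-trans (prep (suc n) (positions-↭ n))
  (↭-trans (∷↭∷ʳ (suc n) (positions n)) (↭-reflexive (sym (positions-suc n)))))

module ZipSums (K : CommutativeRing 0ℓ 0ℓ) where
  open CommutativeRing K hiding (zero)
    renaming (refl to ≈-refl; sym to ≈-sym; trans to ≈-trans; reflexive to ≈-reflexive)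
  open Sums K
  open SetoidReasoning setoid

  ∑-tuples-∷ : (E : List B) (m : ℕ) (f : List B → Carrier) →
               ∑ (tuples E (suc m)) f ≈ ∑ E (λ y → ∑ (tuples E m) (λ e → f (y ∷ e)))
  ∑-tuples-∷ E m f = ∑-product _∷_ E (tuples E m) f

  ∑-insertions-zip : (E : List B) (x : A) (v : List A) (f : List (A × B) → Carrier) →
    ∑ (insertions x v) (λ u → ∑ (tuples E (suc (length v))) (λ e → f (zip u e)))
      ≈ ∑ E (λ y → ∑ (tuples E (length v)) (λ e → ∑ (insertions (x , y) (zip v e)) f))
  ∑-insertions-zip E x []      f = ≈-trans (+-identityʳ _)
    (≈-trans (∑-tuples-∷ E 0 _) (∑-cong E λ y → +-congʳ (≈-sym (+-identityʳ _))))
  ∑-insertions-zip E x (w ∷ v) f = begin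
    ∑ (insertions x (w ∷ v)) (λ u → ∑ (tuples E (suc (suc m))) (λ e → f (zip u e)))
      ≈⟨ ∑-insertions-∷ x w v _ ⟩
    ∑ (tuples E (suc (suc m))) (λ e → f (zip (x ∷ w ∷ v) e))
      + ∑ (insertions x v) (λ u → ∑ (tuples E (suc (suc m))) (λ e → f (zip (w ∷ u) e)))
      ≈⟨ +-cong (≈-trans (∑-tuples-∷ E (suc m) _) (∑-cong E λ y → ∑-tuples-∷ E m _))
           (begin
             ∑ (insertions x v) (λ u → ∑ (tuples E (suc (suc m))) (λ e → f (zip (w ∷ u) e)))
               ≈⟨ ≈-trans (∑-cong (insertions x v) λ u → ∑-tuples-∷ E (suc m) _) (∑-swap (insertions x v) E _) ⟩
             ∑ E (λ y′ → ∑ (insertions x v) (λ u → ∑ (tuples E (suc m)) (λ e → f ((w , y′) ∷ zip u e))))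
               ≈⟨ ∑-cong E (λ y′ → ∑-insertions-zip E x v (λ c → f ((w , y′) ∷ c))) ⟩
             ∑ E (λ y′ → ∑ E (λ y → ∑ (tuples E m) (λ e → ∑ (insertions (x , y) (zip v e)) (λ c → f ((w , y′) ∷ c)))))
               ≈⟨ ∑-swap E E _ ⟩
             ∑ E (λ y → ∑ E (λ y′ → ∑ (tuples E m) (λ e → ∑ (insertions (x , y) (zip v e)) (λ c → f ((w , y′) ∷ c))))) ∎) ⟩
    ∑ E (λ y → ∑ E (λ y′ → ∑ (tuples E m) (λ e → f ((x , y) ∷ (w , y′) ∷ zip v e))))
      + ∑ E (λ y → ∑ E (λ y′ → ∑ (tuples E m) (λ e → ∑ (insertions (x , y) (zip v e)) (λ c → f ((w , y′) ∷ c)))))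
      ≈⟨ ∑-+ E _ _ ⟨
    ∑ E (λ y → ∑ E (λ y′ → ∑ (tuples E m) (λ e → f ((x , y) ∷ (w , y′) ∷ zip v e)))
      + ∑ E (λ y′ → ∑ (tuples E m) (λ e → ∑ (insertions (x , y) (zip v e)) (λ c → f ((w , y′) ∷ c)))))
      ≈⟨ ∑-cong E (λ y → ≈-sym (≈-trans (∑-tuples-∷ E m _) (≈-trans
           (∑-cong E λ y′ → ≈-trans (∑-cong (tuples E m) λ e → ∑-insertions-∷ (x , y) (w , y′) (zip v e) f) (∑-+ (tuples E m) _ _))
           (∑-+ E _ _)))) ⟩
    ∑ E (λ y → ∑ (tuples E (suc m)) (λ e → ∑ (insertions (x , y) (zip (w ∷ v) e)) f)) ∎
    where m = length v

  -- A path assigns an entry to each step, whereas a configuration assigns one to each label. Both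
  -- sides enumerate the words of labels with entries: the left one arranges the labels first, the
  -- right one attaches the entries first.
  ∑-arrangements-zip : (E : List B) (xs : List A) (f : List (A × B) → Carrier) →
    ∑ (arrangements xs) (λ v → ∑ (tuples E (length xs)) (λ e → f (zip v e)))
      ≈ ∑ (tuples E (length xs)) (λ q → ∑ (arrangements (zip xs q)) f)
  ∑-arrangements-zip E []       f = ≈-refl
  ∑-arrangements-zip E (x ∷ xs) f = begin
    ∑ (arrangements (x ∷ xs)) (λ v → ∑ (tuples E (suc m)) (λ e → f (zip v e)))
      ≈⟨ ∑-arrangements-∷ x xs _ ⟩
    ∑ (arrangements xs) (λ v → ∑ (insertions x v) (λ u → ∑ (tuples E (suc m)) (λ e → f (zip u e))))
      ≈⟨ ∑-cong-All (All.map (λ {v} p → insert v (Perm.↭-length p)) (arrangements-↭ xs)) ⟩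
    ∑ (arrangements xs) (λ v → ∑ E (λ y → ∑ (tuples E m) (λ e → ∑ (insertions (x , y) (zip v e)) f)))
      ≈⟨ ∑-swap (arrangements xs) E _ ⟩
    ∑ E (λ y → ∑ (arrangements xs) (λ v → ∑ (tuples E m) (λ e → ∑ (insertions (x , y) (zip v e)) f)))
      ≈⟨ ∑-cong E (λ y → ∑-arrangements-zip E xs (λ c → ∑ (insertions (x , y) c) f)) ⟩
    ∑ E (λ y → ∑ (tuples E m) (λ q → ∑ (arrangements (zip xs q)) (λ c → ∑ (insertions (x , y) c) f)))
      ≈⟨ ∑-cong E (λ y → ∑-cong (tuples E m) λ q → ∑-arrangements-∷ (x , y) (zip xs q) f) ⟨
    ∑ E (λ y → ∑ (tuples E m) (λ q → ∑ (arrangements ((x , y) ∷ zip xs q)) f))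
      ≈⟨ ∑-tuples-∷ E m _ ⟨
    ∑ (tuples E (suc m)) (λ q → ∑ (arrangements (zip (x ∷ xs) q)) f) ∎
    where
    m = length xs
    insert : ∀ v → length v ≡ m → ∑ (insertions x v) (λ u → ∑ (tuples E (suc m)) (λ e → f (zip u e)))
             ≈ ∑ E (λ y → ∑ (tuples E m) (λ e → ∑ (insertions (x , y) (zip v e)) f))
    insert v eq = subst (λ m → ∑ (insertions x v) (λ u → ∑ (tuples E (suc m)) (λ e → f (zip u e)))
      ≈ ∑ E (λ y → ∑ (tuples E m) (λ e → ∑ (insertions (x , y) (zip v e)) f))) eq (∑-insertions-zip E x v f)

  ∑-zipEntries : (L m : ℕ) (f : List Entry → Carrier) →
    ∑ (vectors (upTo L) m) (λ as → ∑ (subsets m) (λ es → f (zipEntries as es))) ≈ ∑ (tuples (entries L) m) f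
  ∑-zipEntries L zero    f = +-identityʳ _
  ∑-zipEntries L (suc m) f = begin
    ∑ (vectors (upTo L) (suc m)) (λ as → ∑ (subsets (suc m)) (λ es → f (zipEntries as es)))
      ≈⟨ ∑-product _∷_ (upTo L) (vectors (upTo L) m) _ ⟩
    ∑ (upTo L) (λ a → ∑ (vectors (upTo L) m) (λ as → ∑ (subsets (suc m)) (λ es → f (zipEntries (a ∷ as) es))))
      ≈⟨ ∑-cong (upTo L) (λ a → ≈-trans
           (∑-cong (vectors (upTo L) m) λ as → ∑-product _∷_ decorations (subsets m) _)
           (≈-trans (∑-swap (vectors (upTo L) m) decorations (λ as e → ∑ (subsets m) (λ es → f ((a , e) ∷ zipEntries as es))))
             (∑-cong decorations λ e → ∑-zipEntries L m (λ q → f ((a , e) ∷ q))))) ⟩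
    ∑ (upTo L) (λ a → ∑ decorations (λ e → ∑ (tuples (entries L) m) (λ q → f ((a , e) ∷ q))))
      ≈⟨ ∑-product _,_ (upTo L) decorations _ ⟨
    ∑ (entries L) (λ x → ∑ (tuples (entries L) m) (λ q → f (x ∷ q)))
      ≈⟨ ∑-tuples-∷ (entries L) m f ⟨
    ∑ (tuples (entries L) (suc m)) f ∎
    where decorations = true ∷ false ∷ []

  open UpTo K

  -- A path is determined by its area word: from distance d, the next north step has some area a ≤ d
  -- after d - a east steps, and leaves distance a + 1. No area reaches d + m, so the bound L loses
  -- nothing.
  ∑-dyckPaths : ∀ L m d → d ℕ.+ m ≤ L → (f : Vec ℕ m → Carrier) →
    ∑ (dyckPaths m d) (f ∘ areaWord) ≈ ∑ (vectors (upTo L) m) (λ as → isDyck d as ▹ f as)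
  ∑-dyckPaths L zero    zero    d≤ f = ≈-refl
  ∑-dyckPaths L zero    (suc d) d≤ f = ≈-trans (∑-map east (dyckPaths zero d) _) (∑-dyckPaths L zero d (ℕ.<⇒≤ d≤) f)
  ∑-dyckPaths L (suc m) d       d≤ f = begin
    ∑ (dyckPaths (suc m) d) (f ∘ areaWord)
      ≈⟨ byFirstNorth d ⟩
    ∑ (upTo (suc d)) (λ a → ∑ (dyckPaths m (suc a)) (λ π → f (a ∷ areaWord π)))
      ≈⟨ ∑-cong-upTo (suc d) (λ a a≤d → ∑-dyckPaths L m (suc a)
           (ℕ.≤-trans (ℕ.+-monoˡ-≤ m a≤d) (subst (_≤ L) (ℕ.+-suc d m) d≤)) (f ∘ (a ∷_))) ⟩
    ∑ (upTo (suc d)) S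
      ≈⟨ ≈-trans (∑-upTo-split (suc d) L S (λ _ → 0#) (ℕ.≤-trans (s≤s (ℕ.m≤m+n d m)) (subst (_≤ L) (ℕ.+-suc d m) d≤)))
                 (≈-trans (+-congˡ (∑-0 (upTo (L ∸ suc d)))) (+-identityʳ _)) ⟨
    ∑ (upTo L) (λ a → (a <ᵇ suc d) ▹ S a)
      ≈⟨ ∑-cong (upTo L) (λ a → ≈-trans (▹-∑ (a <ᵇ suc d) (vectors (upTo L) m) _)
           (∑-cong (vectors (upTo L) m) λ as → ≈-sym (▹-∧ (a <ᵇ suc d) (isDyck (suc a) as) (f (a ∷ as))))) ⟩
    ∑ (upTo L) (λ a → ∑ (vectors (upTo L) m) (λ as → (a <ᵇ suc d) ∧ isDyck (suc a) as ▹ f (a ∷ as)))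
      ≈⟨ ∑-product _∷_ (upTo L) (vectors (upTo L) m) _ ⟨
    ∑ (vectors (upTo L) (suc m)) (λ as → isDyck d as ▹ f as) ∎
    where
    S : ℕ → Carrier
    S a = ∑ (vectors (upTo L) m) (λ as → isDyck (suc a) as ▹ f (a ∷ as))
    byFirstNorth : ∀ d → ∑ (dyckPaths (suc m) d) (f ∘ areaWord)
                   ≈ ∑ (upTo (suc d)) (λ a → ∑ (dyckPaths m (suc a)) (λ π → f (a ∷ areaWord π)))
    byFirstNorth zero    = ≈-trans (∑-map north (dyckPaths m 1) _) (≈-sym (+-identityʳ _))
    byFirstNorth (suc d) = ≈-trans (∑-++ (map north (dyckPaths m (suc (suc d)))) _ _) (≈-trans (+-comm _ _)
      (≈-trans (+-cong (≈-trans (∑-map east (dyckPaths (suc m) d) _) (byFirstNorth d)) (∑-map north (dyckPaths m (suc (suc d))) _))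
               (≈-sym (∑-upTo-last (suc d) _))))

  ∑-upTo-≡ᵇ : ∀ n c (f : ℕ → Carrier) → c < n → ∑ (upTo n) (λ k → (c ≡ᵇ k) ▹ f k) ≈ f c
  ∑-upTo-≡ᵇ (suc n) zero    f c<n = ≈-trans (∑-upTo-suc n _) (≈-trans (+-congˡ (∑-0 (upTo n))) (+-identityʳ _))
  ∑-upTo-≡ᵇ (suc n) (suc c) f (s≤s c<n) = ≈-trans (∑-upTo-suc n _) (≈-trans (+-identityˡ _) (∑-upTo-≡ᵇ n c (f ∘ suc) c<n))

-- The recursion on decorated labelled Dyck paths

module PathSums (K : CommutativeRing 0ℓ 0ℓ) (t z : CommutativeRing.Carrier K) (n : ℕ) where
  open CommutativeRing K hiding (zero)
    renaming (refl to ≈-refl; sym to ≈-sym; trans to ≈-trans; reflexive to ≈-reflexive)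
  open CommutativeSemigroupProperties *-commutativeSemigroup using (x∙yz≈y∙xz)
  open SemiringExp semiring using (_^_; ^-homo-*)
  open Sums K
  open UpTo K
  open ZipSums K
  open PermutationSums K
  open Transfer K t z
  open LetterOrder n
  open DinvParity n using (odd-dinv)
  open Words N
  open SignedCount K
  open Positions N K
  open SetoidReasoning setoid

  private
    slot : Fin n → ℕ
    slot x = n ∸ toℕ x

    letters-position : ∀ {m} (as : Vec ℕ m) xs es →
      letters as xs es ≡ map position (zip (map slot (toList xs)) (zipEntries as es))
    letters-position []       []       []       = refl
    letters-position (a ∷ as) (x ∷ xs) (e ∷ es) = cong (_ ∷_) (letters-position as xs es)

    weight-zipEntries : ∀ {m} (as : Vec ℕ m) es → weight (zipEntries as es) ≈ t ^ Vec.sum as * z ^ ∣ es ∣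
    weight-zipEntries []       []       = ≈-sym (*-identityˡ _)
    weight-zipEntries (a ∷ as) (e ∷ es) = begin
      t ^ a * (decorationWeight e * weight (zipEntries as es))         ≈⟨ *-congˡ (*-congˡ (weight-zipEntries as es)) ⟩
      t ^ a * (decorationWeight e * (t ^ Vec.sum as * z ^ ∣ es ∣))     ≈⟨ *-congˡ (x∙yz≈y∙xz _ _ _) ⟩
      t ^ a * (t ^ Vec.sum as * (decorationWeight e * z ^ ∣ es ∣))     ≈⟨ *-assoc _ _ _ ⟨
      (t ^ a * t ^ Vec.sum as) * (decorationWeight e * z ^ ∣ es ∣)     ≈⟨ *-cong (≈-sym (^-homo-* t a (Vec.sum as))) (decoration e) ⟩
      t ^ (a ℕ.+ Vec.sum as) * z ^ ∣ e ∷ es ∣                          ∎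
      where
      decoration : ∀ e → decorationWeight e * z ^ ∣ es ∣ ≈ z ^ ∣ e ∷ es ∣
      decoration true  = ≈-refl
      decoration false = *-identityˡ _

    zip-proj₂ : ∀ (xs : List ℕ) (q : List Entry) → length q ≡ length xs → map proj₂ (zip xs q) ≡ q
    zip-proj₂ []       []      _  = refl
    zip-proj₂ (x ∷ xs) (y ∷ q) eq = cong (y ∷_) (zip-proj₂ xs q (ℕ.suc-injective eq))

    weight-↭ : ∀ {q q′} → q ↭ q′ → weight q ≈ weight q′
    weight-↭ _↭_.refl              = ≈-refl
    weight-↭ (_↭_.prep x p)        = *-congˡ (*-congˡ (weight-↭ p))
    weight-↭ (_↭_.swap {xs = q} {ys = q′} (a , e) (b , d) p) = begin
      t ^ a * (decorationWeight e * (t ^ b * (decorationWeight d * weight q)))    ≈⟨ *-assoc _ _ _ ⟨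
      (t ^ a * decorationWeight e) * (t ^ b * (decorationWeight d * weight q))    ≈⟨ *-congˡ (*-assoc _ _ _) ⟨
      (t ^ a * decorationWeight e) * ((t ^ b * decorationWeight d) * weight q)    ≈⟨ x∙yz≈y∙xz _ _ _ ⟩
      (t ^ b * decorationWeight d) * ((t ^ a * decorationWeight e) * weight q)    ≈⟨ *-congˡ (*-congˡ (weight-↭ p)) ⟩
      (t ^ b * decorationWeight d) * ((t ^ a * decorationWeight e) * weight q′)   ≈⟨ *-congˡ (*-assoc _ _ _) ⟩
      (t ^ b * decorationWeight d) * (t ^ a * (decorationWeight e * weight q′))   ≈⟨ *-assoc _ _ _ ⟩
      t ^ b * (decorationWeight d * (t ^ a * (decorationWeight e * weight q′)))   ∎
    weight-↭ (_↭_.trans p p′)      = ≈-trans (weight-↭ p) (weight-↭ p′)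

    term : List (ℕ × Entry) → Carrier
    term u = starts N (map position u) ▹ sign (dinvParity (map position u)) * weight (map proj₂ u)

    configurations : List (List Entry)
    configurations = tuples (entries n) n

    -- Once each label has its entry, area and number of decorations no longer depend on the
    -- arrangement. The weight factors out, and the remaining signed count is 0 or 1 by
    -- `signedCount-good`.
    ∑-term : ∑ (arrangements (positions n)) (λ v → ∑ configurations (λ e → term (zip v e))) ≈ total n (λ _ → 1#)
    ∑-term = begin
      ∑ (arrangements (positions n)) (λ v → ∑ configurations (λ e → term (zip v e)))
        ≡⟨ cong (λ m → ∑ (arrangements (positions n)) (λ v → ∑ (tuples (entries n) m) (λ e → term (zip v e)))) length≡ ⟨
      ∑ (arrangements (positions n)) (λ v → ∑ (tuples (entries n) (length (positions n))) (λ e → term (zip v e)))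
        ≈⟨ ∑-arrangements-zip (entries n) (positions n) term ⟩
      ∑ (tuples (entries n) (length (positions n))) (λ q → ∑ (arrangements (zip (positions n) q)) term)
        ≡⟨ cong (λ m → ∑ (tuples (entries n) m) (λ q → ∑ (arrangements (zip (positions n) q)) term)) length≡ ⟩
      ∑ configurations (λ q → ∑ (arrangements (zip (positions n) q)) term)
        ≈⟨ ∑-cong-All (All.map (λ {q} → ∑-term-arrangements q) (tuples-length (entries n) n)) ⟩
      goodSum n n (λ _ → 1#)
        ≈⟨ goodSum-total n n (λ _ → 1#) ℕ.≤-refl ⟩
      total n (λ _ → 1#) ∎
      where
      length≡ : length (positions n) ≡ n
      length≡ = trans (List.length-map suc (upTo n)) (List.length-upTo n)
      All-zip : ∀ (vs : List ℕ) (q : List Entry) {P : ℕ → Set} → All P vs → All (P ∘ proj₁) (zip vs q)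
      All-zip []       q       _        = []
      All-zip (v ∷ vs) []      _        = []
      All-zip (v ∷ vs) (y ∷ q) (p ∷ ps) = p ∷ All-zip vs q ps
      AllPairs-zip : ∀ (vs : List ℕ) (q : List Entry) → AllPairs (λ v v′ → v < v′ × v′ < v ℕ.+ N) vs → AllPairs Window (zip vs q)
      AllPairs-zip []       q       _         = []
      AllPairs-zip (v ∷ vs) []      _         = []
      AllPairs-zip (v ∷ vs) (y ∷ q) (rs ∷ ap) = All-zip vs q rs ∷ AllPairs-zip vs q ap
      window : AllPairs (λ v v′ → v < v′ × v′ < v ℕ.+ N) (positions n)
      window = AllPairs.map⁺ (AllPairs.applyUpTo⁺₁ id n λ {i} {j} i<j j<n →
        s≤s i<j , s≤s (ℕ.<-≤-trans j<n (ℕ.≤-trans (ℕ.n≤1+n n) (ℕ.m≤n+m N i))))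
      ∑-term-arrangements : ∀ q → length q ≡ n → ∑ (arrangements (zip (positions n) q)) term ≈ good n q [] ▹ weight q * 1#
      ∑-term-arrangements q len = begin
        ∑ (arrangements c) term
          ≈⟨ ∑-cong-All (All.map (λ {u} p → ≈-trans
               (▹-congʳ (starts N (map position u)) (≈-trans (*-congˡ (≈-trans (weight-↭ (Perm.map⁺ proj₂ p)) (≈-reflexive (cong weight shapes)))) (*-comm _ _)))
               (≈-sym (*-▹ (weight q) (starts N (map position u)) _))) (arrangements-↭ c)) ⟩
        ∑ (arrangements c) (λ u → weight q * (starts N (map position u) ▹ sign (dinvParity (map position u))))
          ≈⟨ *-∑ (weight q) (arrangements c) _ ⟨
        weight q * ∑ (arrangements c) (λ u → starts N (map position u) ▹ sign (dinvParity (map position u)))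
          ≈⟨ *-congˡ (∑-map (map position) (arrangements c) _) ⟨
        weight q * ∑ (map (map position) (arrangements c)) (λ v → starts N v ▹ sign (dinvParity v))
          ≡⟨ cong (λ l → weight q * ∑ l (λ v → starts N v ▹ sign (dinvParity v))) (arrangements-map position c) ⟨
        weight q * signedCount (map position c) N
          ≡⟨ cong (λ l → weight q * signedCount (map position l) N) (List.++-identityʳ c) ⟨
        weight q * signedCount (map position (c ++ [])) N
          ≈⟨ *-congˡ (signedCount-good n c [] N (trans (ℕ.+-identityʳ _) length-c)
               (subst (AllPairs Window) (sym (List.++-identityʳ c)) (AllPairs-zip (positions n) q window))
               (All-zip (positions n) q (All.map s≤s (All-positions n))) []
               (All-zip (positions n) q (All.map (λ {v} _ → ℕ.m≤n+m N v) (All-positions n)))) ⟩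
        weight q * (good n (map proj₂ c) [] ▹ 1#)
          ≡⟨ cong (λ l → weight q * (good n l [] ▹ 1#)) shapes ⟩
        weight q * (good n q [] ▹ 1#)
          ≈⟨ *-▹ (weight q) (good n q []) 1# ⟩
        (good n q [] ▹ weight q * 1#) ∎
        where
        c = zip (positions n) q
        shapes : map proj₂ c ≡ q
        shapes = zip-proj₂ (positions n) q (trans len (sym length≡))
        length-c : length c ≡ n
        length-c = trans (sym (List.length-map proj₂ c)) (trans (cong length shapes) len)

    -- The conditions on positions already force a Dyck area word, so the sum over paths may be
    -- replaced by one over all vectors of areas.
    starts⇒isDyck : ∀ {m} (as : Vec ℕ m) xs es → starts N (letters as xs es) ≡ true → isDyck 0 as ≡ true
    starts⇒isDyck []       []       []           _  = refl
    starts⇒isDyck (a ∷ as) (x ∷ xs) (false ∷ es) eq with place x a <ᵇ N in first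
    ... | true = cong₂ _∧_ (<ᵇ-true (grounded-first a (<ᵇ-true⁻ _ _ first)))
                           (legal a x as xs es (continues⇒Legal a x as xs es eq))
      where
      grounded-first : ∀ a → place x a < N → a < 1
      grounded-first zero    _  = s≤s z≤n
      grounded-first (suc a) lt = contradiction (ℕ.m≤n+m N (place x a))
        (ℕ.<⇒≱ (subst (_< N) (sym (place-+N x a)) lt))
      legal : ∀ {m} a x (bs : Vec ℕ m) ys es → Legal a x bs ys es → isDyck (suc a) bs ≡ true
      legal a x []       []       []       _                  = refl
      legal a x (b ∷ bs) (y ∷ ys) (e ∷ es) ((b≤ , _) , _ , l) = cong₂ _∧_ (<ᵇ-true (s≤s b≤)) (legal b y bs ys es l)

    -- The first step is never decorated; hence the range k < n covers every admissible set of
    -- decorations.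
    few-decorations : ∀ {m} (as : Vec ℕ m) xs es → 1 ≤ m → starts N (letters as xs es) ≡ true → ∣ es ∣ < m
    few-decorations (a ∷ as) (x ∷ xs) (false ∷ es) 1≤m eq = s≤s (∣p∣≤n es)

    does-isStLD : ∀ π w dv k → does (DecoratedPath.isStLD? (decorated π w dv) k)
                  ≡ unique w ∧ starts N (letters (areaWord π) w dv) ∧ (∣ dv ∣ ≡ᵇ k)
    does-isStLD π w dv k = does-⇔ (mk⇔
        (λ ((uq , inc) , con , card) → uq , Equivalence.from Bool.T-≡ (legal⇒starts π w dv inc con) , card)
        (λ (uq , st , card) → let inc , con = starts⇒legal π w dv (Equivalence.to Bool.T-≡ st) in (uq , inc) , con , card))
      (DecoratedPath.isStLD? (decorated π w dv) k)
      (VecAllPairs.allPairs? distinct? w ×-dec T? (starts N (letters (areaWord π) w dv)) ×-dec (∣ dv ∣ ℕ.≟ k))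

  pathTerm : DecoratedPath n → Carrier
  pathTerm P = sign (odd ℤ.∣ DecoratedPath.dinv P ∣) * t ^ DecoratedPath.area P

  private
    ∑-stLD : ∀ k → ∑ (stLD n k) pathTerm ≈ ∑ (dyckPaths n 0) (λ π → ∑ (words n n) (λ w → ∑ (subsets n) (λ dv →
      unique w ∧ starts N (letters (areaWord π) w dv) ∧ (∣ dv ∣ ≡ᵇ k) ▹ pathTerm (decorated π w dv))))
    ∑-stLD k = ≈-trans
      (∑-filter (λ P → DecoratedPath.isStLD? P k) (cartesianProductWith decorate (dyckPaths n 0) (cartesianProduct (words n n) (subsets n))) pathTerm)
      (≈-trans (∑-product decorate (dyckPaths n 0) (cartesianProduct (words n n) (subsets n)) valid)
        (∑-cong (dyckPaths n 0) λ π → ≈-trans (∑-product _,_ (words n n) (subsets n) (valid ∘ decorate π))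
          (∑-cong (words n n) λ w → ∑-cong (subsets n) λ dv → ▹-congˡ (does-isStLD π w dv k) _)))
      where
      decorate : DyckPath n → Vec (Fin n) n × Subset n → DecoratedPath n
      decorate π (w , dv) = decorated π w dv
      valid : DecoratedPath n → Carrier
      valid P = does (DecoratedPath.isStLD? P k) ▹ pathTerm P

    ∑-decorations : 1 ≤ n → ∀ π w dv →
      ∑ (upTo n) (λ k → (unique w ∧ starts N (letters (areaWord π) w dv) ∧ (∣ dv ∣ ≡ᵇ k) ▹ pathTerm (decorated π w dv)) * z ^ k)
        ≈ unique w ▹ term (zip (map slot (toList w)) (zipEntries (areaWord π) dv))
    ∑-decorations 1≤n π w dv = begin
      ∑ (upTo n) (λ k → (unique w ∧ s ∧ (∣ dv ∣ ≡ᵇ k) ▹ g) * z ^ k)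
        ≈⟨ ∑-cong (upTo n) (λ k → ≈-trans (▹-* (unique w ∧ s ∧ (∣ dv ∣ ≡ᵇ k)) g (z ^ k))
             (≈-trans (▹-∧ (unique w) (s ∧ (∣ dv ∣ ≡ᵇ k)) _) (▹-congʳ (unique w) (▹-∧ s (∣ dv ∣ ≡ᵇ k) _)))) ⟩
      ∑ (upTo n) (λ k → unique w ▹ s ▹ (∣ dv ∣ ≡ᵇ k) ▹ g * z ^ k)
        ≈⟨ ≈-trans (▹-congʳ (unique w) (▹-∑ s (upTo n) _)) (▹-∑ (unique w) (upTo n) _) ⟨
      (unique w ▹ s ▹ ∑ (upTo n) (λ k → (∣ dv ∣ ≡ᵇ k) ▹ g * z ^ k))
        ≈⟨ ▹-congʳ (unique w) (▹-cong s λ st → ≈-trans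
             (∑-upTo-≡ᵇ n ∣ dv ∣ (λ k → g * z ^ k) (few-decorations (areaWord π) w dv 1≤n st))
             (≈-trans (*-assoc _ _ _) (*-cong (≈-reflexive (cong sign (odd-dinv π w dv))) (≈-sym (weight-zipEntries (areaWord π) dv))))) ⟩
      (unique w ▹ s ▹ sign (dinvParity (letters (areaWord π) w dv)) * weight (zipEntries (areaWord π) dv))
        ≡⟨ cong₂ (λ l q → unique w ▹ starts N l ▹ sign (dinvParity l) * weight q) (letters-position (areaWord π) w dv)
             (sym (proj₂-zip (areaWord π) w dv)) ⟩
      (unique w ▹ term (zip (map slot (toList w)) (zipEntries (areaWord π) dv))) ∎
      where
      s = starts N (letters (areaWord π) w dv)
      g = pathTerm (decorated π w dv)
      proj₂-zip : ∀ {m} (as : Vec ℕ m) (xs : Vec (Fin n) m) es →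
        map proj₂ (zip (map slot (toList xs)) (zipEntries as es)) ≡ zipEntries as es
      proj₂-zip []       []       []       = refl
      proj₂-zip (a ∷ as) (x ∷ xs) (e ∷ es) = cong (_ ∷_) (proj₂-zip as xs es)

    ∑-paths : ∀ w → ∑ (dyckPaths n 0) (λ π → ∑ (subsets n) (λ dv →
        term (zip (map slot (toList w)) (zipEntries (areaWord π) dv))))
      ≈ ∑ configurations (λ e → term (zip (map slot (toList w)) e))
    ∑-paths w = begin
      ∑ (dyckPaths n 0) (f ∘ areaWord)
        ≈⟨ ∑-dyckPaths n n 0 ℕ.≤-refl f ⟩
      ∑ (vectors (upTo n) n) (λ as → isDyck 0 as ▹ f as)
        ≈⟨ ∑-cong (vectors (upTo n) n) (λ as → ≈-trans (▹-∑ (isDyck 0 as) (subsets n) _)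
             (∑-cong (subsets n) λ dv → redundant (isDyck 0 as) (starts N (map position (letterList as dv)))
               (λ st → starts⇒isDyck as w dv (trans (cong (starts N) (letters-position as w dv)) st)) _)) ⟩
      ∑ (vectors (upTo n) n) f
        ≈⟨ ∑-zipEntries n n (λ e → term (zip (map slot (toList w)) e)) ⟩
      ∑ configurations (λ e → term (zip (map slot (toList w)) e)) ∎
      where
      letterList : Vec ℕ n → Subset n → List (ℕ × Entry)
      letterList as dv = zip (map slot (toList w)) (zipEntries as dv)
      f : Vec ℕ n → Carrier
      f as = ∑ (subsets n) (λ dv → term (letterList as dv))
      redundant : ∀ a b → (b ≡ true → a ≡ true) → ∀ x → a ▹ b ▹ x ≈ b ▹ x
      redundant true  b     b⇒a x = ≈-refl
      redundant false false b⇒a x = ≈-refl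
      redundant false true  b⇒a x with b⇒a refl
      ... | ()

  ∑-stLD-total : 1 ≤ n → ∑ (upTo n) (λ k → ∑ (stLD n k) pathTerm * z ^ k) ≈ total n (λ _ → 1#)
  ∑-stLD-total 1≤n = begin
    ∑ (upTo n) (λ k → ∑ (stLD n k) pathTerm * z ^ k)
      ≈⟨ ∑-cong (upTo n) (λ k → ≈-trans (*-congʳ (∑-stLD k)) (≈-trans (∑-* (dyckPaths n 0) _ _)
           (∑-cong (dyckPaths n 0) λ π → ≈-trans (∑-* (words n n) _ _) (∑-cong (words n n) λ w → ∑-* (subsets n) _ _)))) ⟩
    ∑ (upTo n) (λ k → ∑ (dyckPaths n 0) (λ π → ∑ (words n n) (λ w → ∑ (subsets n) (λ dv → summand k π w dv))))
      ≈⟨ ≈-trans (∑-swap (upTo n) (dyckPaths n 0) _) (∑-cong (dyckPaths n 0) λ π →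
           ≈-trans (∑-swap (upTo n) (words n n) _) (∑-cong (words n n) λ w →
           ≈-trans (∑-swap (upTo n) (subsets n) _) (∑-cong (subsets n) λ dv → ∑-decorations 1≤n π w dv))) ⟩
    ∑ (dyckPaths n 0) (λ π → ∑ (words n n) (λ w → ∑ (subsets n) (λ dv →
      unique w ▹ term (zip (map slot (toList w)) (zipEntries (areaWord π) dv)))))
      ≈⟨ ∑-swap (dyckPaths n 0) (words n n) _ ⟩
    ∑ (words n n) (λ w → ∑ (dyckPaths n 0) (λ π → ∑ (subsets n) (λ dv →
      unique w ▹ term (zip (map slot (toList w)) (zipEntries (areaWord π) dv)))))
      ≈⟨ ∑-cong (words n n) (λ w → ≈-sym (≈-trans (▹-congʳ (unique w) (≈-sym (∑-paths w)))
           (≈-trans (▹-∑ (unique w) (dyckPaths n 0) _) (∑-cong (dyckPaths n 0) λ π → ▹-∑ (unique w) (subsets n) _)))) ⟩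
    ∑ (words n n) (λ w → unique w ▹ ∑ configurations (λ e → term (zip (map slot (toList w)) e)))
      ≈⟨ ∑-unique-words n (λ v → ∑ configurations (λ e → term (zip (map slot v) e))) ⟩
    ∑ (arrangements (allFin n)) (λ v → ∑ configurations (λ e → term (zip (map slot v) e)))
      ≈⟨ ∑-map (map slot) (arrangements (allFin n)) (λ v → ∑ configurations (λ e → term (zip v e))) ⟨
    ∑ (map (map slot) (arrangements (allFin n))) (λ v → ∑ configurations (λ e → term (zip v e)))
      ≡⟨ cong (λ l → ∑ l (λ v → ∑ configurations (λ e → term (zip v e)))) (arrangements-map slot (allFin n)) ⟨
    ∑ (arrangements (map slot (allFin n))) (λ v → ∑ configurations (λ e → term (zip v e)))
      ≈⟨ ∑-arrangements-↭ (positions-↭ n) _ ⟩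
    ∑ (arrangements (positions n)) (λ v → ∑ configurations (λ e → term (zip v e)))
      ≈⟨ ∑-term ⟩
    total n (λ _ → 1#) ∎
    where
    summand : ℕ → DyckPath n → Vec (Fin n) n → Subset n → Carrier
    summand k π w dv = (unique w ∧ starts N (letters (areaWord π) w dv) ∧ (∣ dv ∣ ≡ᵇ k) ▹ pathTerm (decorated π w dv)) * z ^ k

-- Evaluation at q = -1

module Evaluation (R : CommutativeRing 0ℓ 0ℓ) where
  open CommutativeRing R hiding (zero)
    renaming (refl to ≈-refl; sym to ≈-sym; trans to ≈-trans; reflexive to ≈-reflexive)
  open CommutativeSemigroupProperties +-commutativeSemigroup using (interchange)
  open CommutativeSemigroupProperties *-commutativeSemigroup using (x∙yz≈y∙xz)
  open Polynomials R
  open SetoidReasoning setoid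

  module _ (x : Carrier) where
    evaluate-+ : ∀ p q → evaluate x (p +ₚ q) ≈ evaluate x p + evaluate x q
    evaluate-+ []      q       = ≈-sym (+-identityˡ _)
    evaluate-+ (a ∷ p) []      = ≈-sym (+-identityʳ _)
    evaluate-+ (a ∷ p) (b ∷ q) = ≈-trans
      (+-congˡ (≈-trans (*-congˡ (evaluate-+ p q)) (distribˡ _ _ _))) (interchange _ _ _ _)

    evaluate-scale : ∀ a p → evaluate x (map (a *_) p) ≈ a * evaluate x p
    evaluate-scale a []      = ≈-sym (zeroʳ a)
    evaluate-scale a (b ∷ p) = ≈-trans
      (+-congˡ (≈-trans (*-congˡ (evaluate-scale a p)) (x∙yz≈y∙xz _ _ _))) (≈-sym (distribˡ _ _ _))

    evaluate-* : ∀ p q → evaluate x (p *ₚ q) ≈ evaluate x p * evaluate x q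
    evaluate-* []      q = ≈-sym (zeroˡ _)
    evaluate-* (a ∷ p) q = begin
      evaluate x (map (a *_) q +ₚ (0# ∷ p *ₚ q))
        ≈⟨ evaluate-+ (map (a *_) q) (0# ∷ p *ₚ q) ⟩
      evaluate x (map (a *_) q) + (0# + x * evaluate x (p *ₚ q))
        ≈⟨ +-cong (evaluate-scale a q) (≈-trans (+-identityˡ _) (≈-trans (*-congˡ (evaluate-* p q)) (≈-sym (*-assoc _ _ _)))) ⟩
      a * evaluate x q + (x * evaluate x p) * evaluate x q
        ≈⟨ distribʳ _ _ _ ⟨
      (a + x * evaluate x p) * evaluate x q ∎

    evaluate-constant : ∀ a → evaluate x (constant a) ≈ a
    evaluate-constant a = ≈-trans (+-congˡ (zeroʳ x)) (+-identityʳ a)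

    evaluate-X : evaluate x X ≈ x
    evaluate-X = ≈-trans (+-identityˡ _) (≈-trans (*-congˡ (evaluate-constant 1#)) (*-identityʳ x))

module Constants (R : CommutativeRing 0ℓ 0ℓ) where
  open CommutativeRing R hiding (zero)
    renaming (refl to ≈-refl; sym to ≈-sym; trans to ≈-trans; reflexive to ≈-reflexive)
  open Polynomials R
  open SemiringExp semiring using (_^_)
  private
    module P = CommutativeRing polynomialRing
    module P^ = SemiringExp P.semiring
    module PSums = Sums polynomialRing
    open Sums R

  constant-0 : constant 0# ≈ₚ 0ₚ
  constant-0 = coeffwise λ { zero → ≈-refl ; (suc n) → ≈-refl }

  constant-* : ∀ a b → constant (a * b) ≈ₚ constant a *ₚ constant b
  constant-* a b = coeffwise λ { zero → ≈-sym (+-identityʳ _) ; (suc n) → ≈-refl }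

  constant-^ : ∀ a n → constant (a ^ n) ≈ₚ constant a P^.^ n
  constant-^ a zero    = P.refl
  constant-^ a (suc n) = P.trans (constant-* a (a ^ n)) (P.*-congˡ {x = constant a} (constant-^ a n))

  constant-∑ : (xs : List A) (f : A → Carrier) → constant (∑ xs f) ≈ₚ PSums.∑ xs (constant ∘ f)
  constant-∑ []       f = constant-0
  constant-∑ (x ∷ xs) f = P.+-congˡ (constant-∑ xs f)

  constant-sign : ∀ b → constant (sign b) ≈ₚ PSums.sign b
  constant-sign true  = P.refl
  constant-sign false = P.refl

module AtMinusOne where
  module 𝔻 = ℚ[t]
  module 𝔽 = ℚ⟨t⟩
  open Fractions ℚ[t] using (cross)
  open Polynomials 𝔻.commutativeRing using (X; constant)
  private
    X₀ : 𝔻.Carrier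
    X₀ = Polynomials.X (IntegralDomain.commutativeRing ℚ-domain)
    at-1 : ℚ[t][q].Carrier → 𝔻.Carrier
    at-1 = Polynomials.evaluate 𝔻.commutativeRing (𝔻.- 𝔻.1#)
    module Ev = Evaluation 𝔻.commutativeRing
    open Sums ℚ⟨t⟩ using (sign; sign-not)
    module R𝔽 = RingProperties 𝔽.ring
    module R𝔻 = RingProperties 𝔻.ring

    at-1-* : ∀ a b → at-1 (a ℚ[t][q].* b) 𝔻.≈ at-1 a 𝔻.* at-1 b
    at-1-* = Ev.evaluate-* (𝔻.- 𝔻.1#)

    at-1-≉0 : ∀ a b → ¬ (at-1 a 𝔻.≈ 𝔻.0#) → ¬ (at-1 b 𝔻.≈ 𝔻.0#) → ¬ (at-1 (a ℚ[t][q].* b) 𝔻.≈ 𝔻.0#)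
    at-1-≉0 a b a≉0 b≉0 e = Fractions.*-≉0 ℚ[t] {at-1 a} {at-1 b} a≉0 b≉0 (𝔻.trans (𝔻.sym (at-1-* a b)) e)

    at-1-1 : at-1 ℚ[t][q].1# 𝔻.≈ 𝔻.1#
    at-1-1 = Ev.evaluate-constant (𝔻.- 𝔻.1#) 𝔻.1#

    at-1-1≉0 : ¬ (at-1 ℚ[t][q].1# 𝔻.≈ 𝔻.0#)
    at-1-1≉0 e = 𝔻.1≉0 (𝔻.trans (𝔻.sym at-1-1) e)

  ↦-cong : ∀ {f f′ g g′} → f ℚ⟨q,t⟩.≈ f′ → g 𝔽.≈ g′ → f ∣q=-1↦ g → f′ ∣q=-1↦ g′
  ↦-cong f≈f′ g≈g′ (a , b , b≉0 , b[-1]≉0 , f≈ , g≈) =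
    a , b , b≉0 , b[-1]≉0 , ℚ⟨q,t⟩.trans (ℚ⟨q,t⟩.sym f≈f′) f≈ , 𝔽.trans (𝔽.sym g≈g′) g≈

  -- The product of two denominators that do not vanish at q = -1 does not vanish there either,
  -- since ℚ[t] is a domain.
  ↦-+ : ∀ {f f′ g g′} → f ∣q=-1↦ g → f′ ∣q=-1↦ g′ → (f ℚ⟨q,t⟩.+ f′) ∣q=-1↦ (g 𝔽.+ g′)
  ↦-+ (a , b , b≉0 , b[-1]≉0 , f≈ , g≈) (a′ , b′ , b′≉0 , b′[-1]≉0 , f′≈ , g′≈) =
    a ℚ[t][q].* b′ ℚ[t][q].+ a′ ℚ[t][q].* b , b ℚ[t][q].* b′ , Fractions.*-≉0 ℚ[t][q] {b} {b′} b≉0 b′≉0 , at-1-≉0 b b′ b[-1]≉0 b′[-1]≉0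
    , ℚ⟨q,t⟩.+-cong f≈ f′≈
    , 𝔽.trans (𝔽.+-cong g≈ g′≈) (cross (𝔻.*-cong
        (𝔻.sym (𝔻.trans (Ev.evaluate-+ (𝔻.- 𝔻.1#) (a ℚ[t][q].* b′) (a′ ℚ[t][q].* b)) (𝔻.+-cong (at-1-* a b′) (at-1-* a′ b))))
        (at-1-* b b′)))

  ↦-* : ∀ {f f′ g g′} → f ∣q=-1↦ g → f′ ∣q=-1↦ g′ → (f ℚ⟨q,t⟩.* f′) ∣q=-1↦ (g 𝔽.* g′)
  ↦-* (a , b , b≉0 , b[-1]≉0 , f≈ , g≈) (a′ , b′ , b′≉0 , b′[-1]≉0 , f′≈ , g′≈) =
    a ℚ[t][q].* a′ , b ℚ[t][q].* b′ , Fractions.*-≉0 ℚ[t][q] {b} {b′} b≉0 b′≉0 , at-1-≉0 b b′ b[-1]≉0 b′[-1]≉0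
    , ℚ⟨q,t⟩.*-cong f≈ f′≈
    , 𝔽.trans (𝔽.*-cong g≈ g′≈) (cross (𝔻.*-cong (𝔻.sym (at-1-* a a′)) (at-1-* b b′)))

  ↦-embed : ∀ a c → at-1 a 𝔻.≈ c → Fractions.embed ℚ[t][q] a ∣q=-1↦ Fractions.embed ℚ[t] c
  ↦-embed a c a≈c = a , ℚ[t][q].1# , ℚ[t][q].1≉0 , at-1-1≉0 , ℚ⟨q,t⟩.refl , cross (𝔻.*-cong (𝔻.sym a≈c) at-1-1)

  ↦-0 : ℚ⟨q,t⟩.0# ∣q=-1↦ 𝔽.0#
  ↦-0 = ↦-embed ℚ[t][q].0# 𝔻.0# 𝔻.refl

  ↦-1 : ℚ⟨q,t⟩.1# ∣q=-1↦ 𝔽.1#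
  ↦-1 = ↦-embed ℚ[t][q].1# 𝔻.1# at-1-1

  ↦-q : ℚ⟨q,t⟩.q ∣q=-1↦ (𝔽.- 𝔽.1#)
  ↦-q = ↦-embed X (𝔻.- 𝔻.1#) (Ev.evaluate-X (𝔻.- 𝔻.1#))

  ↦-t : ℚ⟨q,t⟩.t ∣q=-1↦ 𝔽.t
  ↦-t = ↦-embed (constant X₀) X₀ (Ev.evaluate-constant (𝔻.- 𝔻.1#) X₀)

  -- Negative values of `dinv` bring in powers of `q⁻¹`; its denominator takes the value -1, which
  -- is its own inverse.
  ↦-q⁻¹ : ℚ⟨q,t⟩.q⁻¹ ∣q=-1↦ (𝔽.- 𝔽.1#)
  ↦-q⁻¹ = ℚ[t][q].1# , X , Fractions.den≉0 ℚ⟨q,t⟩.q⁻¹ , -1≉0 , ℚ⟨q,t⟩.refl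
    , cross (𝔻.trans (𝔻.*-congˡ {x = 𝔻.- 𝔻.1#} (Ev.evaluate-X (𝔻.- 𝔻.1#)))
        (𝔻.trans (R𝔻.-1*x≈-x (𝔻.- 𝔻.1#)) (𝔻.trans (R𝔻.-‿involutive 𝔻.1#)
          (𝔻.sym (𝔻.trans (𝔻.*-identityʳ (at-1 ℚ[t][q].1#)) at-1-1)))))
    where
    -1≉0 : ¬ (at-1 (X) 𝔻.≈ 𝔻.0#)
    -1≉0 e = 𝔻.1≉0 (𝔻.trans (𝔻.sym (R𝔻.-‿involutive 𝔻.1#)) (𝔻.trans
      (𝔻.-‿cong (𝔻.trans (𝔻.sym (Ev.evaluate-X (𝔻.- 𝔻.1#))) e)) R𝔻.-0#≈0#))

  -- Stated for any f with value -1 so that it serves both `q` and `q⁻¹`.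
  ↦-sign : ∀ {f} → f ∣q=-1↦ (𝔽.- 𝔽.1#) → ∀ n → (f ℚ⟨q,t⟩.^ n) ∣q=-1↦ sign (odd n)
  ↦-sign f↦ zero    = ↦-1
  ↦-sign f↦ (suc n) = ↦-cong ℚ⟨q,t⟩.refl (𝔽.trans (R𝔽.-1*x≈-x _) (𝔽.sym (sign-not (odd n)))) (↦-* f↦ (↦-sign f↦ n))

  ↦-^ : ∀ {f g} → f ∣q=-1↦ g → ∀ n → (f ℚ⟨q,t⟩.^ n) ∣q=-1↦ (g 𝔽.^ n)
  ↦-^ f↦ zero    = ↦-1
  ↦-^ f↦ (suc n) = ↦-* f↦ (↦-^ f↦ n)

  ↦-q^ᶻ : ∀ d → (ℚ⟨q,t⟩.q^ᶻ d) ∣q=-1↦ sign (odd ℤ.∣ d ∣)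
  ↦-q^ᶻ (+ n)    = ↦-sign ↦-q n
  ↦-q^ᶻ -[1+ n ] = ↦-sign ↦-q⁻¹ (suc n)

  ↦-∑ : (xs : List A) {f : A → ℚ⟨q,t⟩.Carrier} {g : A → 𝔽.Carrier} →
        (∀ x → f x ∣q=-1↦ g x) → ℚ⟨q,t⟩.∑ xs f ∣q=-1↦ 𝔽.∑ xs g
  ↦-∑ []       f↦ = ↦-0
  ↦-∑ (x ∷ xs) f↦ = ↦-+ (f↦ x) (↦-∑ xs f↦)

corollary1p2 : (⟨_,_⟩ : Λ → Λ → ℚ⟨q,t⟩.Carrier) → IsHallScalarProduct ⟨_,_⟩ →
    (H̃ : Partition → Λ) → IsModifiedMacdonald ℚ⟨q,t⟩.q ℚ⟨q,t⟩.t ⟨_,_⟩ H̃ →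
    (Δ′ : Λ → Λ → Λ) → IsDeltaPrime ℚ⟨q,t⟩.q ℚ⟨q,t⟩.t H̃ Δ′ →
    (∀ n k → 1 ≤ n → k ≤ n ∸ 1 → let open ℚ⟨q,t⟩ in
    ⟨ Δ′ (e (n ∸ k ∸ 1)) (e n) , h 1 ^Λ n ⟩ ≈ ∑ (stLD n k) (λ P → (q^ᶻ dinv P) * t ^ area P)) →
    ∀ n → 1 ≤ n →
    Σ[ c ∈ (ℕ → ℚ⟨t⟩.Carrier) ]
    (∀ k → k ≤ n ∸ 1 → ⟨ Δ′ (e (n ∸ k ∸ 1)) (e n) , h 1 ^Λ n ⟩ ∣q=-1↦ c k) ×
    (let open ℚ⟨t⟩[z] in
    ∑ (upTo n) (λ k → const (c k) * z ^ k)
    ≈ ∑ (permutations n) (λ σ → const (ℚ⟨t⟩.t ℚ⟨t⟩.^ inv₃ σ) * z ^ monot σ))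
corollary1p2 ⟨_,_⟩ _ H̃ _ Δ′ _ valleyDelta n 1≤n = c , values , identity
  where
  open Sums ℚ⟨t⟩ using (sign)
  module Z = ℚ⟨t⟩[z]
  module ZSums = Sums (Polynomials.polynomialRing ℚ⟨t⟩)
  open Constants ℚ⟨t⟩
  -- Both recursions are carried out over ℚ(t)[z], where t is a constant polynomial and z the
  -- variable.
  t[z] : Z.Carrier
  t[z] = Z.const ℚ⟨t⟩.t

  term : DecoratedPath n → ℚ⟨t⟩.Carrier
  term P = sign (odd ℤ.∣ dinv P ∣) ℚ⟨t⟩.* ℚ⟨t⟩.t ℚ⟨t⟩.^ area P

  c : ℕ → ℚ⟨t⟩.Carrier
  c k = ℚ⟨t⟩.∑ (stLD n k) term

  values : ∀ k → k ≤ n ∸ 1 → ⟨ Δ′ (e (n ∸ k ∸ 1)) (e n) , h 1 ^Λ n ⟩ ∣q=-1↦ c k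
  values k k<n = ↦-cong (ℚ⟨q,t⟩.sym (valleyDelta n k 1≤n k<n)) ℚ⟨t⟩.refl
    (↦-∑ (stLD n k) λ P → ↦-* (↦-q^ᶻ (dinv P)) (↦-^ ↦-t (area P)))
    where open AtMinusOne

  identity : Z.∑ (upTo n) (λ k → Z.const (c k) Z.* Z.z Z.^ k)
             Z.≈ Z.∑ (permutations n) (λ σ → Z.const (ℚ⟨t⟩.t ℚ⟨t⟩.^ inv₃ σ) Z.* Z.z Z.^ monot σ)
  identity = begin
    Z.∑ (upTo n) (λ k → Z.const (c k) Z.* Z.z Z.^ k)
      ≈⟨ ZSums.∑-cong (upTo n) (λ k → Z.*-congʳ (Z.trans (constant-∑ (stLD n k) term) (ZSums.∑-cong (stLD n k) constant-term))) ⟩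
    Z.∑ (upTo n) (λ k → Z.∑ (stLD n k) pathTerm Z.* Z.z Z.^ k)
      ≈⟨ ∑-stLD-total 1≤n ⟩
    total n (λ _ → Z.1#)
      ≈⟨ ∑-permutations-total n ⟨
    Z.∑ (permutations n) (λ σ → t[z] Z.^ inv₃ σ Z.* Z.z Z.^ monot σ)
      ≈⟨ ZSums.∑-cong (permutations n) (λ σ → Z.*-congʳ (constant-^ ℚ⟨t⟩.t (inv₃ σ))) ⟨
    Z.∑ (permutations n) (λ σ → Z.const (ℚ⟨t⟩.t ℚ⟨t⟩.^ inv₃ σ) Z.* Z.z Z.^ monot σ) ∎
    where
    open SetoidReasoning Z.setoid
    open PathSums (Polynomials.polynomialRing ℚ⟨t⟩) t[z] Z.z n using (pathTerm; ∑-stLD-total)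
    open PermutationTransfer (Polynomials.polynomialRing ℚ⟨t⟩) t[z] Z.z using (∑-permutations-total)
    open Transfer (Polynomials.polynomialRing ℚ⟨t⟩) t[z] Z.z using (total)
    constant-term : ∀ P → Z.const (term P) Z.≈ pathTerm P
    constant-term P = Z.trans (constant-* (sign (odd ℤ.∣ dinv P ∣)) (ℚ⟨t⟩.t ℚ⟨t⟩.^ area P))
      (Z.*-cong (constant-sign (odd ℤ.∣ dinv P ∣)) (constant-^ ℚ⟨t⟩.t (area P)))
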